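{- For every integer $k$ with $0\leq k\leq 9$, there exist collections $\mathcal{C}_\mu$ and $\overline{\mathcal{C}}_\mu$ of partitions, one pair for each $\mu\in\mathrm{Par}(k)$ (possibly $\mathcal{C}_\mu=\overline{\mathcal{C}}_\mu$), satisfying: (1) the sets $\mathcal{C}_\mu$ ($\mu\in\mathrm{Par}(k)$) are pairwise disjoint, and the sets $\overline{\mathcal{C}}_\mu$ are pairwise disjoint; (2) $\mathrm{DP}_{*,k}=\bigcup_{\mu\in\mathrm{Par}(k)}\mathcal{C}_\mu=\bigcup_{\mu\in\mathrm{Par}(k)}\overline{\mathcal{C}}_\mu$; (3) for all $m\geq0$, $\nu^m(\gamma_\mu)\in\mathcal{C}_\mu$; (4) for each $\mu\in\mathrm{Par}(k)$ there is a unique $\mu^*\in\mathrm{Par}(k)$ with $\mathcal{C}_\mu=\overline{\mathcal{C}}_{\mu^*}$ and $\mathcal{C}_{\mu^*}=\overline{\mathcal{C}}_\mu$; (5) for all $\mu\in\mathrm{Par}(k)$ and all $i\geq\ell(\mu^*)$ there is a unique partition $C_{\mu,i}\in\mathcal{C}_\mu$ with $\mathrm{dinv}(C_{\mu,i})=i$; moreover there is an increasing integer sequence $i_1<i_2<\cdots$ such that $\mathcal{C}_\mu=\bigcup_{j\geq1}R(C_{\mu,i_j})$ and, for some $t\geq1$, the map $j\mapsto\Delta(C_{\mu,i_j})$ is weakly decreasing on $\{1,\ldots,t\}$ and weakly increasing on $\{t,t+1,\ldots\}$; (6) for all $n\geq\max(\zeta(\mu)+2,\zeta(\mu^*)+2)$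 and all integers $i$: $\ell(\mu^*)\leq i\leq\binom{n}{2}-k-\ell(\mu)$ holds if and only if there exists a (unique) $\gamma\in\mathcal{C}_\mu$ with $\Delta(\gamma)\leq n$ and $\mathrm{dinv}(\gamma)=i$; (7) if $\gamma\in\mathcal{C}_\mu$ and $\nu(\gamma)$ is defined, then $\nu(\gamma)\in\mathcal{C}_\mu$; (8) if $\mathrm{dp}_n(\mathrm{dyck}(\lambda))\in\mathcal{C}_\mu$ for some $\lambda\in\mathrm{Par}(n)$, then $\mathrm{dp}_n(\mathrm{dyck}(\lambda'))\in\overline{\mathcal{C}}_\mu$, where $\lambda'$ is the conjugate of $\lambda$; (9) for all $n\geq0$, $\mathcal{C}_\mu\cap\mathrm{DP}_n$ and $\overline{\mathcal{C}}_\mu\cap\mathrm{DP}_n$ are $n$-opposite to each other.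
   Context: $\mathrm{Par}(k)$ is the set of partitions of $k$; partitions are identified up to trailing zeros; $\ell(\gamma)$ is the number of nonzero parts, $|\gamma|$ the sum of parts; the diagram of $\gamma$ is $\{(i,j):1\leq i\leq\ell(\gamma),1\leq j\leq\gamma_i\}$. For a cell $c=(i,j)$, $\mathrm{arm}(c)=\gamma_i-j$, $\mathrm{leg}(c)=\gamma'_j-i$ ($\gamma'$ the conjugate). $\mathrm{dinv}(\gamma)$ is the number of cells with $\mathrm{arm}(c)-\mathrm{leg}(c)\in\{0,1\}$; $\mathrm{def}(\gamma)=|\gamma|-\mathrm{dinv}(\gamma)$; $\mathrm{DP}_{*,k}$ is the set of all partitions $\gamma$ with $\mathrm{def}(\gamma)=k$. $\gamma\in\mathrm{DP}_n$ means the diagram of $\gamma$ is contained in that of $(n-1,n-2,\ldots,1,0)$; $\Delta(\gamma)$ is the least such $n$; for $\gamma\in\mathrm{DP}_n$, $\mathrm{area}_n(\gamma)=\binom{n}{2}-|\gamma|$. Subsets $B,C\subseteq\mathrm{DP}_n$ are $n$-opposite if there is a unique bijection $g:B\to C$ with $\mathrm{area}_n(\gamma)=\mathrm{dinv}(g(\gamma))$ and $\mathrm{dinv}(\gamma)=\mathrm{area}_n(g(\gamma))$ for all $\gamma\in B$. If $\gamma_1\leq\ell(\gamma)+2$, $\nu(\gamma)=(\ell(\gamma)+1,\gamma_1-1,\ldots,\gamma_{\ell(\gamma)}-1)$ (otherwise undefined); $\nu^m$ is the $m$-fold iterate. For a partition $\gamma=(\gamma_1,\ldots,\gamma_v)$,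 let $H_\gamma=\{j:\gamma_j=\gamma_{j+1}=\gamma_{j+2}>0\}$ and set $\rho(\gamma)=\gamma_{\max H_\gamma}$ if $\nu(\gamma)$ is defined and $H_\gamma\neq\emptyset$; $\rho(\gamma)=\gamma_1$ if $\nu(\gamma)$ is defined and $H_\gamma=\emptyset$; $\rho(\gamma)=0$ if $\nu(\gamma)$ is undefined; and $R(\gamma)=\{\nu^m(\gamma):0\leq m\leq\rho(\gamma)\}$. For a Dyck vector $v=(v_1,\ldots,v_n)$ ($v_1=0$, $v_i\geq0$, $v_{i+1}\leq v_i+1$), $\mathrm{dp}_n(v)=(n-1-v_n,n-2-v_{n-1},\ldots,1-v_2,0-v_1)$. For $\lambda\in\mathrm{Par}(n)$, $\mathrm{dyck}(\lambda)$ is the length-$n$ sequence of $\lambda_1$ zeros, followed by $\lambda_2$ ones, $\lambda_3$ twos, etc. For a nonzero partition $\mu$, $\zeta(\mu)=\mu_1+\ell(\mu)$, $e_j$ is the number of parts equal to $j$, and $\gamma_\mu=\mathrm{dp}_{\zeta(\mu)+1}(0,0,\underline{1}^{e_1},0,\underline{1}^{e_2},\ldots,0,\underline{1}^{e_{\mu_1}})$ ($\underline{1}^e$ denotes $e$ ones); for $\mu=(0)$, $\zeta(\mu)=0$ and $\gamma_\mu=(0)$. -}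

module Defs where

open import Data.Nat using (ℕ; zero; suc; _+_; _∸_; _≤_; _<_; pred; _≡ᵇ_; _≤ᵇ_; _⊔_)
open import Data.Nat.Combinatorics using (_C_)
open import Data.Bool using (Bool; true; false; if_then_else_; _∧_; _∨_; T)
open import Data.Nat.ListAction using (sum)
open import Data.List using (List; []; _∷_; _++_; length; map; replicate; concat;
  concatMap; zipWith; reverse; downFrom; upTo; applyUpTo)
open import Data.List.Relation.Unary.All using (All)
open import Data.List.Relation.Unary.Linked using (Linked)
open import Data.Maybe using (Maybe; just; nothing; _>>=_)
open import Data.Product using (Σ; ∃; _×_; _,_)
open import Data.Empty using (⊥)
open import Relation.Binary.PropositionalEquality using (_≡_; _≢_)
open import Function.Bundles using (_⇔_)

-- Partitions: represented canonically as lists of positive parts in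
-- weakly decreasing order (trailing zeros removed).

IsPartition : List ℕ → Set
IsPartition γ = Linked (λ x y → y ≤ x) γ × All (λ x → 0 < x) γ

Par : ℕ → List ℕ → Set
Par k μ = IsPartition μ × sum μ ≡ k

-- remove zero entries (used to identify partitions up to trailing zeros)
stripZeros : List ℕ → List ℕ
stripZeros [] = []
stripZeros (zero ∷ xs) = stripZeros xs
stripZeros (suc x ∷ xs) = suc x ∷ stripZeros xs

-- γ_i, 1-indexed, with γ_i = 0 beyond the length
part : List ℕ → ℕ → ℕ
part [] _ = 0
part (x ∷ xs) zero = 0
part (x ∷ xs) (suc zero) = x
part (x ∷ xs) (suc (suc i)) = part xs (suc i)

head0 : List ℕ → ℕ
head0 [] = 0
head0 (x ∷ _) = x

countGE : ℕ → List ℕ → ℕ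
countGE j [] = 0
countGE j (x ∷ xs) = (if j ≤ᵇ x then 1 else 0) + countGE j xs

countEq : ℕ → List ℕ → ℕ
countEq j [] = 0
countEq j (x ∷ xs) = (if j ≡ᵇ x then 1 else 0) + countEq j xs

range1 : ℕ → List ℕ
range1 = applyUpTo suc

conj : List ℕ → List ℕ
conj γ = map (λ j → countGE j γ) (range1 (head0 γ))

arm : List ℕ → ℕ → ℕ → ℕ
arm γ i j = part γ i ∸ j

leg : List ℕ → ℕ → ℕ → ℕ
leg γ i j = part (conj γ) j ∸ i

cellScore : List ℕ → ℕ → ℕ → ℕ
cellScore γ i j =
  if (arm γ i j ≡ᵇ leg γ i j) ∨ (arm γ i j ≡ᵇ suc (leg γ i j)) then 1 else 0

dinv : List ℕ → ℕ
dinv γ = sum (map (λ i → sum (map (λ j → cellScore γ i j) (range1 (part γ i))))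
                  (range1 (length γ)))

-- def(γ) = |γ| - dinv(γ)   (dinv(γ) ≤ |γ| always)
defect : List ℕ → ℕ
defect γ = sum γ ∸ dinv γ

DPstar : ℕ → List ℕ → Set
DPstar k γ = IsPartition γ × defect γ ≡ k

-- DP_n : diagram contained in that of (n-1, n-2, ..., 1, 0),
-- i.e. γ_i ≤ n - i for every row i = 1..ℓ(γ).

inDPᵇ : ℕ → List ℕ → Bool
inDPᵇ n [] = true
inDPᵇ n (x ∷ xs) = (suc x ≤ᵇ n) ∧ inDPᵇ (pred n) xs

InDP : ℕ → List ℕ → Set
InDP n γ = T (inDPᵇ n γ)

searchDP : ℕ → ℕ → List ℕ → ℕ
searchDP n zero γ = n
searchDP n (suc fuel) γ = if inDPᵇ n γ then n else searchDP (suc n) fuel γ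

-- Δ(γ): least n with γ ∈ DP_n  (n = |γ| + ℓ(γ) always works, so the
-- fuel |γ| + ℓ(γ) + 1 suffices)
Δ : List ℕ → ℕ
Δ γ = searchDP 0 (sum γ + length γ + 1) γ

area : ℕ → List ℕ → ℕ
area n γ = (n C 2) ∸ sum γ

module _ (n : ℕ) (B B′ : List ℕ → Set) where

  IsOppositeBijection : ((γ : List ℕ) → B γ → List ℕ) → Set
  IsOppositeBijection g =
    ((γ : List ℕ) (b : B γ) → B′ (g γ b)) ×
    ((γ δ : List ℕ) (b : B γ) (b' : B δ) → g γ b ≡ g δ b' → γ ≡ δ) ×
    ((δ : List ℕ) → B′ δ → Σ (List ℕ) λ γ → Σ (B γ) λ b → g γ b ≡ δ) ×
    ((γ : List ℕ) (b : B γ) →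
       (area n γ ≡ dinv (g γ b)) × (dinv γ ≡ area n (g γ b)))

  Opposite : Set
  Opposite =
    Σ ((γ : List ℕ) → B γ → List ℕ) λ g →
      IsOppositeBijection g ×
      ((g' : (γ : List ℕ) → B γ → List ℕ) → IsOppositeBijection g' →
         (γ : List ℕ) (b : B γ) → g' γ b ≡ g γ b)

nuDefᵇ : List ℕ → Bool
nuDefᵇ γ = head0 γ ≤ᵇ (length γ + 2)

nu : List ℕ → List ℕ
nu γ = stripZeros ((length γ + 1) ∷ map pred γ)

nuStep : List ℕ → Maybe (List ℕ)
nuStep γ = if nuDefᵇ γ then just (nu γ) else nothing

nuIter : ℕ → List ℕ → Maybe (List ℕ)
nuIter zero γ = just γ
nuIter (suc m) γ = nuIter m γ >>= nuStep

lastTriple : List ℕ → Maybe ℕ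
lastTriple (a ∷ b ∷ c ∷ rest) with lastTriple (b ∷ c ∷ rest)
... | just v = just v
... | nothing = if (a ≡ᵇ b) ∧ (b ≡ᵇ c) ∧ (1 ≤ᵇ a) then just a else nothing
lastTriple _ = nothing

ρ : List ℕ → ℕ
ρ γ with nuDefᵇ γ | lastTriple γ
... | false | _ = 0
... | true | just v = v
... | true | nothing = head0 γ

InR : List ℕ → List ℕ → Set
InR γ δ = Σ ℕ λ m → m ≤ ρ γ × nuIter m γ ≡ just δ

dp : ℕ → List ℕ → List ℕ
dp n v = stripZeros (zipWith _∸_ (downFrom n) (reverse v))

dyck : List ℕ → List ℕ
dyck λ′ = concat (zipWith (λ i p → replicate p i) (upTo (length λ′)) λ′)

ζ : List ℕ → ℕ
ζ μ = head0 μ + length μ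

γmu : List ℕ → List ℕ
γmu [] = []
γmu μ@(_ ∷ _) =
  dp (ζ μ + 1)
     (0 ∷ 0 ∷ replicate (countEq 1 μ) 1
        ++ concatMap (λ j → 0 ∷ replicate (countEq j μ) 1)
                     (applyUpTo (λ i → 2 + i) (head0 μ ∸ 1)))

-- The conditions of Theorem 4.10 for a given k and families 𝒞 , 𝒞̄
-- (indexed by partitions μ; only μ ∈ Par(k) matter).

SameSet : (List ℕ → Set) → (List ℕ → Set) → Set
SameSet A B = (γ : List ℕ) → A γ ⇔ B γ

module _ (k : ℕ) (𝒞 𝒞̄ : List ℕ → List ℕ → Set) where

  Cond1 : Set
  Cond1 =
    ((μ μ′ : List ℕ) → Par k μ → Par k μ′ → μ ≢ μ′ →
       (γ : List ℕ) → 𝒞 μ γ → 𝒞 μ′ γ → ⊥) ×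
    ((μ μ′ : List ℕ) → Par k μ → Par k μ′ → μ ≢ μ′ →
       (γ : List ℕ) → 𝒞̄ μ γ → 𝒞̄ μ′ γ → ⊥)

  Cond2 : Set
  Cond2 =
    ((γ : List ℕ) → DPstar k γ ⇔ (Σ (List ℕ) λ μ → Par k μ × 𝒞 μ γ)) ×
    ((γ : List ℕ) → DPstar k γ ⇔ (Σ (List ℕ) λ μ → Par k μ × 𝒞̄ μ γ))

  Cond3 : Set
  Cond3 = (μ : List ℕ) → Par k μ → (m : ℕ) →
    Σ (List ℕ) λ δ → nuIter m (γmu μ) ≡ just δ × 𝒞 μ δ

  Cond5 : List ℕ → List ℕ → Set
  Cond5 μ μ* =
    Σ (ℕ → List ℕ) λ Cμ →          -- i ↦ C_{μ,i}  (meaningful for i ≥ ℓ(μ*))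
      ((i : ℕ) → length μ* ≤ i →
         𝒞 μ (Cμ i) × dinv (Cμ i) ≡ i ×
         ((γ : List ℕ) → 𝒞 μ γ → dinv γ ≡ i → γ ≡ Cμ i)) ×
      -- increasing sequence i_1 < i_2 < ...  (indexed from 0 here)
      Σ (ℕ → ℕ) λ s →
        ((j : ℕ) → s j < s (suc j)) ×
        ((j : ℕ) → length μ* ≤ s j) ×
        SameSet (𝒞 μ) (λ γ → Σ ℕ λ j → InR (Cμ (s j)) γ) ×
        -- unimodality of j ↦ Δ(C_{μ,i_j}) with turning index t (0-indexed)
        Σ ℕ λ t →
          ((a b : ℕ) → a ≤ b → b ≤ t → Δ (Cμ (s b)) ≤ Δ (Cμ (s a))) ×
          ((a b : ℕ) → t ≤ a → a ≤ b → Δ (Cμ (s a)) ≤ Δ (Cμ (s b)))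

  Cond6 : List ℕ → List ℕ → Set
  Cond6 μ μ* =
    (n : ℕ) → (ζ μ + 2) ⊔ (ζ μ* + 2) ≤ n → (i : ℕ) →
      ((length μ* ≤ i × i + k + length μ ≤ n C 2) ⇔
         (Σ (List ℕ) λ γ → 𝒞 μ γ × Δ γ ≤ n × dinv γ ≡ i)) ×
      ((γ γ′ : List ℕ) → 𝒞 μ γ → Δ γ ≤ n → dinv γ ≡ i →
         𝒞 μ γ′ → Δ γ′ ≤ n → dinv γ′ ≡ i → γ ≡ γ′)

  Cond456 : Set
  Cond456 = (μ : List ℕ) → Par k μ →
    Σ (List ℕ) λ μ* →
      Par k μ* ×
      (SameSet (𝒞 μ) (𝒞̄ μ*) × SameSet (𝒞 μ*) (𝒞̄ μ)) ×
      ((μ′ : List ℕ) → Par k μ′ →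
         SameSet (𝒞 μ) (𝒞̄ μ′) → SameSet (𝒞 μ′) (𝒞̄ μ) → μ′ ≡ μ*) ×
      Cond5 μ μ* ×
      Cond6 μ μ*

  Cond7 : Set
  Cond7 = (μ : List ℕ) → Par k μ → (γ : List ℕ) → 𝒞 μ γ →
    head0 γ ≤ length γ + 2 → 𝒞 μ (nu γ)

  Cond8 : Set
  Cond8 = (μ : List ℕ) → Par k μ → (n : ℕ) (λ′ : List ℕ) → Par n λ′ →
    𝒞 μ (dp n (dyck λ′)) → 𝒞̄ μ (dp n (dyck (conj λ′)))

  Cond9 : Set
  Cond9 = (μ : List ℕ) → Par k μ → (n : ℕ) →
    Opposite n (λ γ → 𝒞 μ γ × InDP n γ) (λ γ → 𝒞̄ μ γ × InDP n γ)

{-# OPTIONS --safe #-}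
module Submission where

-- ν preserves the defect, raises dinv by one, and is injective, so DP_{*,k} splits into ν-orbits, each with a unique
-- initial partition: the empty one, or one with length > first part. The change of dinv, and the bound
-- length ≤ defect + 1 for initial partitions, come from counting how often the boundary path of a partition crosses
-- the antidiagonals next to its ends. Hence DP_{*,k} has finitely many orbits. The infinite ones start at the
-- γ_μ, and with n = ℓ(γ) + 1 one has ν^n(γ) = (n , γ) along them, which determines Δ on the whole tail.
-- A chain 𝒞_μ is a concatenation of finite orbits followed by the tail of γ_μ; everything outside the tails is finite.

open import Defs
open import Data.Nat
open import Data.Nat.Properties
open import Data.Nat.Combinatorics using (_C_; nCk+nC[k+1]≡[n+1]C[k+1]; nC1≡n)
open import Data.Nat.ListAction using (sum)
open import Data.Nat.Tactic.RingSolver using (solve-∀)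
open import Data.Bool using (Bool; true; false; if_then_else_; _∧_; _∨_; not; T)
open import Data.Bool.ListAction using (all; any)
open import Data.Bool.Properties using (T-∧)
open import Data.Empty using (⊥; ⊥-elim)
open import Data.List using (List; []; _∷_; _++_; _∷ʳ_; _ʳ++_; length; map; replicate; reverse; concat; concatMap; zipWith; downFrom; applyUpTo; upTo)
open import Data.List.Properties using (length-++; length-map; length-replicate; length-reverse; map-++; map-∘; map-cong; map-id; map-applyUpTo; ++-identityʳ; ++-assoc; ++-ʳ++; reverse-involutive)
open import Data.List.Membership.Propositional using (_∈_)
open import Data.List.Membership.Propositional.Properties using (∈-map⁺; ∈-map⁻; ∈-concatMap⁺; ∈-applyUpTo⁺; ∈-upTo⁺)
open import Data.List.Relation.Unary.All as All using (All; []; _∷_)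
import Data.List.Relation.Unary.All.Properties as AllP
open import Data.List.Relation.Unary.Any as Any using (Any; here; there)
open import Data.List.Relation.Unary.Any.Properties using (any⁻)
open import Data.List.Relation.Unary.Linked using ([]; [-]; _∷_)
open import Data.Maybe using (Maybe; just; nothing; is-just; _>>=_)
open import Data.Maybe.Properties using (just-injective)
open import Data.Product using (Σ; ∃; _×_; _,_; proj₁; proj₂)
open import Data.Sum using (inj₁; inj₂)
open import Data.Unit using (tt)
open import Function using (_∘_; id)
open import Function.Bundles using (mk⇔; Equivalence)
open import Relation.Binary.PropositionalEquality
open import Relation.Nullary using (¬_; yes; no)

-- dinv by rows, by columns, and under ν

-- Once every orbit has an owner μ, conditions (1), (2) and (7) speak about orbits alone, and a
-- chain whose orbits abut in dinv has exactly one member for each dinv from its first value on.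
-- Condition (9) then leaves no choice: on defect k, area_n equals C(n,2) - k - dinv, so g must be
-- the reflection i ↦ C(n,2) - k - i of indices. It is a bijection when it carries the indices of
-- members of 𝒞_μ with Δ ≤ n onto those of the partner chain. For n at least the bound in (6) both
-- index sets are intervals dictated by the tails; for smaller n only finitely many pairs (i, n)
-- occur, because Δ ≤ n bounds i. The other infinite statement is (8): the defect of dp_n(dyck λ) is
-- at least (n - λ_1)(λ_1 - 1), which exceeds 9 for n ≥ 12 unless λ is a single row or a single
-- column. Nothing is assumed about the search that produced `table`: its output is tested by
-- evaluation, and a bounded enumeration shows that no initial partition of defect at most 9 is
-- missing.

data Partition : List ℕ → Set where
  []   : Partition []
  cons : ∀ {x δ} → 0 < x → head0 δ ≤ x → Partition δ → Partition (x ∷ δ)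

toPartition : ∀ {γ} → IsPartition γ → Partition γ
toPartition ([] , []) = []
toPartition ([-] , p ∷ []) = cons p z≤n []
toPartition (r ∷ l , p ∷ ps) = cons p r (toPartition (l , ps))

fromPartition : ∀ {γ} → Partition γ → IsPartition γ
fromPartition [] = [] , []
fromPartition (cons p _ []) = [-] , p ∷ []
fromPartition (cons p h (cons q h′ d)) with fromPartition (cons q h′ d)
... | l , qs = h ∷ l , p ∷ qs

ind : Bool → ℕ
ind b = if b then 1 else 0

sumTo : (ℕ → ℕ) → ℕ → ℕ
sumTo f n = sum (applyUpTo f n)

sumTo-cong : ∀ {f g} n → (∀ j → j < n → f j ≡ g j) → sumTo f n ≡ sumTo g n
sumTo-cong zero h = refl
sumTo-cong (suc n) h = cong₂ _+_ (h 0 z<s) (sumTo-cong n (λ j j<n → h (suc j) (s<s j<n)))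

interchange : ∀ a b c d → (a + b) + (c + d) ≡ (a + c) + (b + d)
interchange = solve-∀

sumTo-+ : ∀ f g n → sumTo f n + sumTo g n ≡ sumTo (λ j → f j + g j) n
sumTo-+ f g zero = refl
sumTo-+ f g (suc n) = trans (interchange (f 0) _ (g 0) _)
  (cong (f 0 + g 0 +_) (sumTo-+ (f ∘ suc) (g ∘ suc) n))

sumTo-split : ∀ f a b → sumTo f (a + b) ≡ sumTo f a + sumTo (λ j → f (a + j)) b
sumTo-split f zero b = refl
sumTo-split f (suc a) b = trans (cong (f 0 +_) (sumTo-split (f ∘ suc) a b)) (sym (+-assoc (f 0) _ _))

sumTo-≤ : ∀ f n → (∀ j → j < n → f j ≤ 1) → sumTo f n ≤ n
sumTo-≤ f zero h = z≤n
sumTo-≤ f (suc n) h = +-mono-≤ (h 0 z<s) (sumTo-≤ (f ∘ suc) n (λ j j<n → h (suc j) (s<s j<n)))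

sum-range1 : ∀ (g : ℕ → ℕ) n → sum (map g (range1 n)) ≡ sumTo (g ∘ suc) n
sum-range1 g n = cong sum (map-applyUpTo suc g n)

score : ℕ → ℕ → ℕ
score a l = if (a ≡ᵇ l) ∨ (a ≡ᵇ suc l) then 1 else 0

-- For a row `x` lying over the rows `δ`, the leg of a cell is the number of rows of `δ` that reach
-- its column. The score of a row thus depends only on the rows below it, which makes dinv recursive
-- in the list.
rowScore : ℕ → List ℕ → ℕ
rowScore x δ = sumTo (λ j → score (x ∸ suc j) (countGE (suc j) δ)) x

rowDinv : List ℕ → ℕ
rowDinv [] = 0
rowDinv (x ∷ δ) = rowScore x δ + rowDinv δ

score-≤1 : ∀ a l → score a l ≤ 1
score-≤1 a l with (a ≡ᵇ l) ∨ (a ≡ᵇ suc l)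
... | true = ≤-refl
... | false = z≤n

rowScore-≤ : ∀ x δ → rowScore x δ ≤ x
rowScore-≤ x δ = sumTo-≤ _ x (λ j _ → score-≤1 (x ∸ suc j) (countGE (suc j) δ))

-- A row never scores more than its length, so the truncated differences are exact. Each summand
-- being nonnegative, putting a row on top cannot lower the defect; this is what prunes `explore`.
rowDefect : List ℕ → ℕ
rowDefect [] = 0
rowDefect (x ∷ δ) = (x ∸ rowScore x δ) + rowDefect δ

sum≡rowDinv+rowDefect : ∀ γ → sum γ ≡ rowDinv γ + rowDefect γ
sum≡rowDinv+rowDefect [] = refl
sum≡rowDinv+rowDefect (x ∷ δ) = trans (cong₂ _+_ (sym (m+[n∸m]≡n (rowScore-≤ x δ))) (sum≡rowDinv+rowDefect δ))
  (interchange (rowScore x δ) _ (rowDinv δ) _)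

rowDinv≤sum : ∀ γ → rowDinv γ ≤ sum γ
rowDinv≤sum γ = subst (rowDinv γ ≤_) (sym (sum≡rowDinv+rowDefect γ)) (m≤m+n _ _)

≤ᵇ-true : ∀ {m n} → m ≤ n → (m ≤ᵇ n) ≡ true
≤ᵇ-true {m} {n} p with m ≤ᵇ n | ≤⇒≤ᵇ p
... | true | _ = refl

≤ᵇ-false : ∀ {m n} → n < m → (m ≤ᵇ n) ≡ false
≤ᵇ-false {m} {n} p with m ≤ᵇ n in eq
... | false = refl
... | true = ⊥-elim (<⇒≱ p (≤ᵇ⇒≤ m n (subst T (sym eq) tt)))

≡ᵇ-true : ∀ {m n} → m ≡ n → (m ≡ᵇ n) ≡ true
≡ᵇ-true {m} {n} p with m ≡ᵇ n | ≡⇒≡ᵇ m n p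
... | true | _ = refl

≡ᵇ-false : ∀ {m n} → m ≢ n → (m ≡ᵇ n) ≡ false
≡ᵇ-false {m} {n} p with m ≡ᵇ n in eq
... | false = refl
... | true = ⊥-elim (p (≡ᵇ⇒≡ m n (subst T (sym eq) tt)))

<ᵇ-true : ∀ {m n} → m < n → (m <ᵇ n) ≡ true
<ᵇ-true {m} {n} p = ≤ᵇ-true p

<ᵇ-false : ∀ {m n} → n ≤ m → (m <ᵇ n) ≡ false
<ᵇ-false {m} {n} p = ≤ᵇ-false (s≤s p)

countGE-hit : ∀ {j x} δ → j ≤ x → countGE j (x ∷ δ) ≡ suc (countGE j δ)
countGE-hit δ p rewrite ≤ᵇ-true p = refl

countGE-miss : ∀ {j x} δ → x < j → countGE j (x ∷ δ) ≡ countGE j δ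
countGE-miss δ p rewrite ≤ᵇ-false p = refl

countGE-beyond : ∀ {γ} → Partition γ → ∀ {j} → head0 γ < j → countGE j γ ≡ 0
countGE-beyond [] p = refl
countGE-beyond {x ∷ δ} (cons _ h d) p = trans (countGE-miss δ p) (countGE-beyond d (≤-<-trans h p))

countGE-1 : ∀ {γ} → Partition γ → countGE 1 γ ≡ length γ
countGE-1 [] = refl
countGE-1 {x ∷ δ} (cons p h d) = trans (countGE-hit δ p) (cong suc (countGE-1 d))

countGE-pred : ∀ j γ → countGE (suc (suc j)) γ ≡ countGE (suc j) (map pred γ)
countGE-pred j [] = refl
countGE-pred j (zero ∷ γ) = countGE-pred j γ
countGE-pred j (suc x ∷ γ) = cong (_ +_) (countGE-pred j γ)

countGE-strip : ∀ j γ → countGE (suc j) (stripZeros γ) ≡ countGE (suc j) γ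
countGE-strip j [] = refl
countGE-strip j (zero ∷ γ) = countGE-strip j γ
countGE-strip j (suc x ∷ γ) = cong (_ +_) (countGE-strip j γ)

rowScore-strip : ∀ x δ → rowScore x (stripZeros δ) ≡ rowScore x δ
rowScore-strip x δ = sumTo-cong x (λ j _ → cong (score (x ∸ suc j)) (countGE-strip j δ))

rowDinv-strip : ∀ γ → rowDinv (stripZeros γ) ≡ rowDinv γ
rowDinv-strip [] = refl
rowDinv-strip (zero ∷ γ) = rowDinv-strip γ
rowDinv-strip (suc x ∷ γ) = cong₂ _+_ (rowScore-strip (suc x) γ) (rowDinv-strip γ)

part≤head : ∀ {γ} → Partition γ → ∀ i → part γ (suc i) ≤ head0 γ
part≤head [] i = z≤n
part≤head (cons _ h d) zero = ≤-refl
part≤head (cons {δ = []} _ h d) (suc i) = z≤n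
part≤head (cons {δ = _ ∷ _} _ h d) (suc i) = ≤-trans (part≤head d i) h

part-applyUpTo : ∀ f n {j} → j < n → part (applyUpTo f n) (suc j) ≡ f j
part-applyUpTo f (suc n) {zero} p = refl
part-applyUpTo f (suc (suc n)) {suc j} (s≤s p) = part-applyUpTo (f ∘ suc) (suc n) p

part-conj : ∀ γ {j} → j < head0 γ → part (conj γ) (suc j) ≡ countGE (suc j) γ
part-conj γ {j} p = trans (cong (λ l → part l (suc j)) (map-applyUpTo suc (λ j → countGE j γ) (head0 γ)))
  (part-applyUpTo _ (head0 γ) p)

rowOf : List ℕ → ℕ → ℕ
rowOf γ i = sumTo (λ j → cellScore γ (suc i) (suc j)) (part γ (suc i))

dinv-rows : ∀ γ → dinv γ ≡ sumTo (rowOf γ) (length γ)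
dinv-rows γ = trans (sum-range1 (λ i → sum (map (cellScore γ i) (range1 (part γ i)))) (length γ))
  (sumTo-cong (length γ) (λ i _ → sum-range1 (cellScore γ (suc i)) (part γ (suc i))))

rowOf-head : ∀ x δ → rowOf (x ∷ δ) 0 ≡ rowScore x δ
rowOf-head x δ = sumTo-cong x λ j j<x →
  cong (score (x ∸ suc j)) (cong (_∸ 1) (trans (part-conj (x ∷ δ) j<x) (countGE-hit δ j<x)))

-- Removing the first row lowers by one both the row index and the height of every column involved,
-- so legs do not change.
rowOf-tail : ∀ {x δ} → Partition (x ∷ δ) → ∀ i → rowOf (x ∷ δ) (suc i) ≡ rowOf δ i
rowOf-tail {x} {δ} (cons _ h d) i = sumTo-cong (part δ (suc i)) λ j j<p →
  let j<h = <-≤-trans j<p (part≤head d i) in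
  cong (score (part δ (suc i) ∸ suc j))
    (trans (cong (_∸ suc (suc i)) (trans (part-conj (x ∷ δ) (<-≤-trans j<h h)) (countGE-hit δ (<-≤-trans j<h h))))
           (cong (_∸ suc i) (sym (part-conj δ j<h))))

dinv≡rowDinv : ∀ {γ} → Partition γ → dinv γ ≡ rowDinv γ
dinv≡rowDinv {γ} p = trans (dinv-rows γ) (go p)
  where
  go : ∀ {γ} → Partition γ → sumTo (rowOf γ) (length γ) ≡ rowDinv γ
  go [] = refl
  go {x ∷ δ} (cons a h d) = cong₂ _+_ (rowOf-head x δ)
    (trans (sumTo-cong (length δ) (λ i _ → rowOf-tail (cons a h d) i)) (go d))

defect≡rowDefect : ∀ {γ} → Partition γ → defect γ ≡ rowDefect γ
defect≡rowDefect {γ} p = trans (cong (sum γ ∸_) (dinv≡rowDinv p)) (trans (cong (_∸ rowDinv γ) (sum≡rowDinv+rowDefect γ)) (m+n∸m≡n (rowDinv γ) _))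

-- The cell in the first column of a row `x` over `δ` has arm `pred x` and leg `length δ`.
colScore : List ℕ → ℕ
colScore [] = 0
colScore (x ∷ δ) = score (pred x) (length δ) + colScore δ

-- Deleting the first column preserves arm and leg of every remaining cell.
rowDinv-column : ∀ {γ} → Partition γ → rowDinv γ ≡ colScore γ + rowDinv (map pred γ)
rowDinv-column [] = refl
rowDinv-column {suc x ∷ δ} (cons p h d) =
  trans (cong₂ _+_ (cong₂ _+_ (cong (score x) (countGE-1 d))
                              (sumTo-cong x (λ j _ → cong (score (x ∸ suc j)) (countGE-pred j δ))))
                   (rowDinv-column d))
        (interchange (score x (length δ)) _ (colScore δ) _)

-- Scores as level crossings of the boundary path

score-split : ∀ a l → score a l ≡ ind (a ≡ᵇ l) + ind (a ≡ᵇ suc l)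
score-split zero zero = refl
score-split zero (suc l) = refl
score-split (suc zero) zero = refl
score-split (suc (suc a)) zero = refl
score-split (suc a) (suc l) = score-split a l

-- Read as a lattice path from (0 , length γ) to (M , 0), the boundary of γ climbs into level s
-- at the columns c with c + γ'_c = s and leaves it at the rows i with γ_i + i = s.
ups : List ℕ → ℕ → ℕ → ℕ
ups γ M s = sumTo (λ c → ind (suc c + countGE (suc c) γ ≡ᵇ s)) M

downs : List ℕ → ℕ → ℕ
downs [] s = 0
downs (x ∷ δ) zero = 0
downs (x ∷ δ) (suc s) = ind (x ≡ᵇ s) + downs δ s

ind-< : ∀ x s → ind (x ≡ᵇ s) + ind (x <ᵇ s) ≡ ind (x <ᵇ suc s)
ind-< zero zero = refl
ind-< zero (suc s) = refl
ind-< (suc x) zero = refl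
ind-< (suc x) (suc s) = ind-< x s

-- Telescoping with `ind-<`: `b` unit steps starting from `x` meet level `s` once if x ≤ s < x + b,
-- and never otherwise.
climb : ∀ x s b → sumTo (λ c → ind (x + c ≡ᵇ s)) b + ind (x + b <ᵇ suc s) ≡ ind (x <ᵇ suc s)
climb x s zero rewrite +-identityʳ x = refl
climb x s (suc b) = begin
  (ind (x + 0 ≡ᵇ s) + sumTo (λ c → ind (x + suc c ≡ᵇ s)) b) + ind (x + suc b <ᵇ suc s)
    ≡⟨ +-assoc (ind (x + 0 ≡ᵇ s)) _ _ ⟩
  ind (x + 0 ≡ᵇ s) + (sumTo (λ c → ind (x + suc c ≡ᵇ s)) b + ind (x + suc b <ᵇ suc s))
    ≡⟨ cong₂ _+_ (cong (λ y → ind (y ≡ᵇ s)) (+-identityʳ x))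
         (cong₂ _+_ (sumTo-cong b (λ c _ → cong (λ y → ind (y ≡ᵇ s)) (+-suc x c)))
                    (cong (λ y → ind (y <ᵇ suc s)) (+-suc x b))) ⟩
  ind (x ≡ᵇ s) + (sumTo (λ c → ind (suc x + c ≡ᵇ s)) b + ind (suc x + b <ᵇ suc s))
    ≡⟨ cong (ind (x ≡ᵇ s) +_) (climb (suc x) s b) ⟩
  ind (x ≡ᵇ s) + ind (x <ᵇ s)
    ≡⟨ ind-< x s ⟩
  ind (x <ᵇ suc s) ∎
  where open ≡-Reasoning

ups-zero : ∀ γ M → ups γ M 0 ≡ 0
ups-zero γ M = go (λ c → c + countGE (suc c) γ) M
  where
  go : ∀ (f : ℕ → ℕ) M → sumTo (λ c → ind (suc (f c) ≡ᵇ 0)) M ≡ 0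
  go f zero = refl
  go f (suc M) = go (f ∘ suc) M

downs-zero : ∀ γ → downs γ 0 ≡ 0
downs-zero [] = refl
downs-zero (x ∷ γ) = refl

-- The level changes by one at each step of the path, so entries into level `s` minus departures
-- from it depend only on the end levels `length γ` and `M`. The induction removes the first row:
-- its descent is the last one, the part before it drops by one level, and the part after it climbs
-- along the axis.
crossings : ∀ {γ} → Partition γ → ∀ {M} → head0 γ ≤ M → ∀ s →
  ups γ M s + ind (M <ᵇ s) ≡ downs γ s + ind (length γ <ᵇ s)
crossings {γ} p {M} h zero rewrite ups-zero γ M | downs-zero γ = refl
crossings [] {M} h (suc s) = trans
  (cong (_+ ind (M <ᵇ suc s)) (sumTo-cong M (λ c _ → cong (λ y → ind (y ≡ᵇ s)) (+-identityʳ c))))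
  (climb 0 s M)
crossings {x ∷ δ} p@(cons _ hd d) {M} h (suc s) = begin
  ups (x ∷ δ) M (suc s) + ind (M <ᵇ suc s)
    ≡⟨ cong₂ _+_ (trans (cong (sumTo f) (sym (m+[n∸m]≡n h))) (sumTo-split f x (M ∸ x)))
                 (cong (λ y → ind (y <ᵇ suc s)) (sym (m+[n∸m]≡n h))) ⟩
  (sumTo f x + sumTo (λ c → f (x + c)) (M ∸ x)) + ind (x + (M ∸ x) <ᵇ suc s)
    ≡⟨ +-assoc (sumTo f x) _ _ ⟩
  sumTo f x + (sumTo (λ c → f (x + c)) (M ∸ x) + ind (x + (M ∸ x) <ᵇ suc s))
    ≡⟨ cong₂ _+_ (sumTo-cong x low) (cong (_+ _) (sumTo-cong (M ∸ x) high)) ⟩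
  ups δ x s + (sumTo (λ c → ind (x + c ≡ᵇ s)) (M ∸ x) + ind (x + (M ∸ x) <ᵇ suc s))
    ≡⟨ cong (ups δ x s +_) (trans (climb x s (M ∸ x)) (sym (ind-< x s))) ⟩
  ups δ x s + (ind (x ≡ᵇ s) + ind (x <ᵇ s))
    ≡⟨ swap (ups δ x s) (ind (x ≡ᵇ s)) (ind (x <ᵇ s)) ⟩
  ind (x ≡ᵇ s) + (ups δ x s + ind (x <ᵇ s))
    ≡⟨ cong (ind (x ≡ᵇ s) +_) (crossings d hd s) ⟩
  ind (x ≡ᵇ s) + (downs δ s + ind (length δ <ᵇ s))
    ≡⟨ +-assoc (ind (x ≡ᵇ s)) _ _ ⟨
  ind (x ≡ᵇ s) + downs δ s + ind (length δ <ᵇ s) ∎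
  where
  open ≡-Reasoning
  f : ℕ → ℕ
  f c = ind (c + countGE (suc c) (x ∷ δ) ≡ᵇ s)
  swap : ∀ a b c → a + (b + c) ≡ b + (a + c)
  swap = solve-∀
  low : ∀ c → c < x → f c ≡ ind (suc c + countGE (suc c) δ ≡ᵇ s)
  low c c<x = cong (λ y → ind (y ≡ᵇ s)) (trans (cong (c +_) (countGE-hit δ c<x)) (+-suc c _))
  high : ∀ c → c < M ∸ x → f (x + c) ≡ ind (x + c ≡ᵇ s)
  high c _ = cong (λ y → ind (y ≡ᵇ s))
    (trans (cong (x + c +_) (countGE-beyond p (s≤s (m≤m+n x c)))) (+-identityʳ _))

-- In row i the first cell has arm γ_i - 1 and leg ℓ - i; these are equal iff γ_i + i = ℓ + 1, and
-- the arm is larger by one iff γ_i + i = ℓ + 2.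
colScore-downs : ∀ {γ} → Partition γ → colScore γ ≡ downs γ (suc (length γ)) + downs γ (suc (suc (length γ)))
colScore-downs [] = refl
colScore-downs {suc x ∷ δ} (cons _ _ d) = trans
  (cong₂ _+_ (score-split x (length δ)) (colScore-downs d))
  (interchange (ind (x ≡ᵇ length δ)) _ _ _)

shift-≡ᵇ : ∀ x c l → c ≤ x → (x ∸ c ≡ᵇ l) ≡ (c + l ≡ᵇ x)
shift-≡ᵇ x zero l p = sym-≡ᵇ x l
  where
  sym-≡ᵇ : ∀ a b → (a ≡ᵇ b) ≡ (b ≡ᵇ a)
  sym-≡ᵇ zero zero = refl
  sym-≡ᵇ zero (suc b) = refl
  sym-≡ᵇ (suc a) zero = refl
  sym-≡ᵇ (suc a) (suc b) = sym-≡ᵇ a b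
shift-≡ᵇ (suc x) (suc c) l (s≤s p) = shift-≡ᵇ x c l p

score-shift : ∀ x c l → c ≤ x → score (x ∸ c) l ≡ ind (c + l ≡ᵇ x) + ind (suc (c + l) ≡ᵇ x)
score-shift x c l p = trans (score-split (x ∸ c) l)
  (cong₂ (λ a b → ind a + ind b) (shift-≡ᵇ x c l p)
    (trans (shift-≡ᵇ x c (suc l) p) (cong (_≡ᵇ x) (+-suc c l))))

-- The lost column scored the descents from levels ℓ + 1 and ℓ + 2; the new row scores the climbs
-- into these two levels, except the one in column 1. With M = ℓ + 2, allowed because ν is defined,
-- the path starts below both levels and ends at or above them, so each has one more climb than
-- descents. The net gain is 2 - 1 = 1.
nuRow : ∀ {γ} → Partition γ → head0 γ ≤ length γ + 2 →
  rowScore (suc (length γ)) (map pred γ) ≡ suc (colScore γ)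
nuRow {γ} p h = suc-injective (trans (sym eq₁) (trans eq₂ (cong (suc ∘ suc) (sym (colScore-downs p)))))
  where
  open ≡-Reasoning
  ℓ = length γ
  h′ : head0 γ ≤ suc (suc ℓ)
  h′ = subst (head0 γ ≤_) (+-comm ℓ 2) h
  g : ℕ → ℕ → ℕ
  g s c = ind (suc c + countGE (suc c) γ ≡ᵇ s)
  first₁ : g (suc ℓ) 0 ≡ 1
  first₁ = cong ind (≡ᵇ-true (cong suc (countGE-1 p)))
  first₂ : g (suc (suc ℓ)) 0 ≡ 0
  first₂ = cong ind (≡ᵇ-false (λ e → 1+n≢n (sym (trans (sym (countGE-1 p)) (suc-injective e)))))
  term : ∀ j → j < suc ℓ → score (suc ℓ ∸ suc j) (countGE (suc j) (map pred γ))
           ≡ g (suc (suc ℓ)) (suc j) + g (suc ℓ) (suc j)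
  term j (s≤s j≤ℓ) = trans (cong (score (ℓ ∸ j)) (sym (countGE-pred j γ))) (score-shift ℓ j _ j≤ℓ)
  eq₁ : ups γ (suc (suc ℓ)) (suc ℓ) + ups γ (suc (suc ℓ)) (suc (suc ℓ)) ≡ suc (rowScore (suc ℓ) (map pred γ))
  eq₁ = begin
    (g (suc ℓ) 0 + sumTo (g (suc ℓ) ∘ suc) (suc ℓ)) + (g (suc (suc ℓ)) 0 + sumTo (g (suc (suc ℓ)) ∘ suc) (suc ℓ))
      ≡⟨ cong₂ _+_ (cong (_+ sumTo (g (suc ℓ) ∘ suc) (suc ℓ)) first₁)
                   (cong (_+ sumTo (g (suc (suc ℓ)) ∘ suc) (suc ℓ)) first₂) ⟩
    suc (sumTo (g (suc ℓ) ∘ suc) (suc ℓ) + sumTo (g (suc (suc ℓ)) ∘ suc) (suc ℓ))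
      ≡⟨ cong suc (trans (+-comm (sumTo (g (suc ℓ) ∘ suc) (suc ℓ)) _) (sumTo-+ (g (suc (suc ℓ)) ∘ suc) (g (suc ℓ) ∘ suc) (suc ℓ))) ⟩
    suc (sumTo (λ j → g (suc (suc ℓ)) (suc j) + g (suc ℓ) (suc j)) (suc ℓ))
      ≡⟨ cong suc (sumTo-cong (suc ℓ) term) ⟨
    suc (rowScore (suc ℓ) (map pred γ)) ∎
  plus0 : ∀ {a b c} → c ≡ false → a + ind c ≡ b → a ≡ b
  plus0 {a} refl e = trans (sym (+-identityʳ a)) e
  u₁ : ups γ (suc (suc ℓ)) (suc ℓ) ≡ downs γ (suc ℓ) + 1
  u₁ = trans (plus0 (<ᵇ-false (n≤1+n (suc ℓ))) (crossings p h′ (suc ℓ)))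
             (cong (λ b → downs γ (suc ℓ) + ind b) (<ᵇ-true {ℓ} ≤-refl))
  u₂ : ups γ (suc (suc ℓ)) (suc (suc ℓ)) ≡ downs γ (suc (suc ℓ)) + 1
  u₂ = trans (plus0 (<ᵇ-false {suc (suc ℓ)} ≤-refl) (crossings p h′ (suc (suc ℓ))))
             (cong (λ b → downs γ (suc (suc ℓ)) + ind b) (<ᵇ-true {ℓ} (n≤1+n _)))
  eq₂ : ups γ (suc (suc ℓ)) (suc ℓ) + ups γ (suc (suc ℓ)) (suc (suc ℓ))
    ≡ suc (suc (downs γ (suc ℓ) + downs γ (suc (suc ℓ))))
  eq₂ = trans (cong₂ _+_ u₁ u₂) (ar (downs γ (suc ℓ)) _)
    where
    ar : ∀ a b → (a + 1) + (b + 1) ≡ suc (suc (a + b))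
    ar = solve-∀

rowDinv-nu : ∀ {γ} → Partition γ → head0 γ ≤ length γ + 2 → rowDinv (nu γ) ≡ suc (rowDinv γ)
rowDinv-nu {γ} p h = begin
  rowDinv (nu γ) ≡⟨ rowDinv-strip ((length γ + 1) ∷ map pred γ) ⟩
  rowScore (length γ + 1) (map pred γ) + rowDinv (map pred γ)
    ≡⟨ cong (λ l → rowScore l (map pred γ) + rowDinv (map pred γ)) (+-comm (length γ) 1) ⟩
  rowScore (suc (length γ)) (map pred γ) + rowDinv (map pred γ)
    ≡⟨ cong (_+ rowDinv (map pred γ)) (nuRow p h) ⟩
  suc (colScore γ + rowDinv (map pred γ)) ≡⟨ cong suc (rowDinv-column p) ⟨
  suc (rowDinv γ) ∎
  where open ≡-Reasoning

sum-strip : ∀ γ → sum (stripZeros γ) ≡ sum γ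
sum-strip [] = refl
sum-strip (zero ∷ γ) = sum-strip γ
sum-strip (suc x ∷ γ) = cong (suc x +_) (sum-strip γ)

sum-pred : ∀ {γ} → Partition γ → sum γ ≡ length γ + sum (map pred γ)
sum-pred [] = refl
sum-pred {suc x ∷ δ} (cons _ _ d) = cong suc (trans (cong (x +_) (sum-pred d)) (sw x (length δ) _))
  where
  sw : ∀ a b c → a + (b + c) ≡ b + (a + c)
  sw = solve-∀

sum-nu : ∀ {γ} → Partition γ → sum (nu γ) ≡ suc (sum γ)
sum-nu {γ} p = begin
  sum (nu γ) ≡⟨ sum-strip ((length γ + 1) ∷ map pred γ) ⟩
  length γ + 1 + sum (map pred γ) ≡⟨ cong (_+ sum (map pred γ)) (+-comm (length γ) 1) ⟩
  suc (length γ + sum (map pred γ)) ≡⟨ cong suc (sum-pred p) ⟨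
  suc (sum γ) ∎
  where open ≡-Reasoning

rowDefect-nu : ∀ {γ} → Partition γ → head0 γ ≤ length γ + 2 → rowDefect (nu γ) ≡ rowDefect γ
rowDefect-nu {γ} p h = +-cancelˡ-≡ (rowDinv (nu γ)) _ _ (begin
  rowDinv (nu γ) + rowDefect (nu γ) ≡⟨ sum≡rowDinv+rowDefect (nu γ) ⟨
  sum (nu γ) ≡⟨ sum-nu p ⟩
  suc (sum γ) ≡⟨ cong suc (sum≡rowDinv+rowDefect γ) ⟩
  suc (rowDinv γ) + rowDefect γ ≡⟨ cong (_+ rowDefect γ) (rowDinv-nu p h) ⟨
  rowDinv (nu γ) + rowDefect γ ∎)
  where open ≡-Reasoning

-- Initial partitions have few rows

disjoint-levels : ∀ x L w → x ≤ L →
  (ind (w ≡ᵇ x) + ind (suc w ≡ᵇ x)) + (ind (w ≡ᵇ suc L) + ind (w ≡ᵇ suc (suc L))) ≤ 1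
disjoint-levels x L w x≤L with w ≤? L
... | yes w≤L rewrite ≡ᵇ-false {w} {suc L} (<⇒≢ (s≤s w≤L))
                    | ≡ᵇ-false {w} {suc (suc L)} (<⇒≢ (m≤n⇒m≤1+n (s≤s w≤L)))
                    | +-identityʳ (ind (w ≡ᵇ x) + ind (suc w ≡ᵇ x)) = two w x
  where
  two : ∀ w x → ind (w ≡ᵇ x) + ind (suc w ≡ᵇ x) ≤ 1
  two zero zero = ≤-refl
  two zero (suc zero) = ≤-refl
  two zero (suc (suc x)) = z≤n
  two (suc w) zero = z≤n
  two (suc w) (suc x) = two w x
... | no w≰L rewrite ≡ᵇ-false {w} {x} (λ e → w≰L (subst (_≤ L) (sym e) x≤L))
                   | ≡ᵇ-false {suc w} {x} (λ e → w≰L (<⇒≤ (subst (_≤ L) (sym e) x≤L))) = two w (suc L)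
  where
  two : ∀ w y → ind (w ≡ᵇ y) + ind (w ≡ᵇ suc y) ≤ 1
  two zero zero = ≤-refl
  two zero (suc y) = z≤n
  two (suc zero) zero = ≤-refl
  two (suc (suc w)) zero = z≤n
  two (suc w) (suc y) = two w y

-- The first row scores the columns that climb into level x - 1 or x. For x ≤ L both ends of the
-- path of `δ` lie below the levels L + 1 and L + 2, so descents from these match climbs into them,
-- and the column score of `δ` also counts columns. By `disjoint-levels` no column is counted twice,
-- and there are x of them.
row+col-≤ : ∀ {x δ} → Partition (x ∷ δ) → x ≤ length δ → rowScore x δ + colScore δ ≤ x
row+col-≤ {x} {δ} (cons _ h d) x≤L = subst (_≤ x) (sym total)
  (sumTo-≤ _ x (λ j j<x → disjoint-levels x L (w j) x≤L))
  where
  open ≡-Reasoning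
  L = length δ
  u : ∀ s → x ≤ s → L ≤ s → ups δ x (suc s) ≡ downs δ (suc s)
  u s p q = +-cancelʳ-≡ 1 _ _ (begin
    ups δ x (suc s) + 1 ≡⟨ cong (λ b → ups δ x (suc s) + ind b) (<ᵇ-true (s≤s p)) ⟨
    ups δ x (suc s) + ind (x <ᵇ suc s) ≡⟨ crossings d h (suc s) ⟩
    downs δ (suc s) + ind (L <ᵇ suc s) ≡⟨ cong (λ b → downs δ (suc s) + ind b) (<ᵇ-true (s≤s q)) ⟩
    downs δ (suc s) + 1 ∎)
  w : ℕ → ℕ
  w j = suc j + countGE (suc j) δ
  total : rowScore x δ + colScore δ ≡
    sumTo (λ j → (ind (w j ≡ᵇ x) + ind (suc (w j) ≡ᵇ x)) + (ind (w j ≡ᵇ suc L) + ind (w j ≡ᵇ suc (suc L)))) x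
  total = begin
    rowScore x δ + colScore δ
      ≡⟨ cong₂ _+_ (sumTo-cong x (λ j j<x → score-shift x (suc j) _ j<x))
          (trans (colScore-downs d) (cong₂ _+_ (sym (u L x≤L ≤-refl)) (sym (u (suc L) (m≤n⇒m≤1+n x≤L) (n≤1+n L))))) ⟩
    sumTo (λ j → ind (w j ≡ᵇ x) + ind (suc (w j) ≡ᵇ x)) x + (ups δ x (suc L) + ups δ x (suc (suc L)))
      ≡⟨ cong (sumTo (λ j → ind (w j ≡ᵇ x) + ind (suc (w j) ≡ᵇ x)) x +_) (sumTo-+ _ _ x) ⟩
    sumTo (λ j → ind (w j ≡ᵇ x) + ind (suc (w j) ≡ᵇ x)) x + sumTo (λ j → ind (w j ≡ᵇ suc L) + ind (w j ≡ᵇ suc (suc L))) x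
      ≡⟨ sumTo-+ _ _ x ⟩
    _ ∎

-- The first row together with the first column of `δ`, which have x + length δ cells, score at most
-- x, and all other cells score at most one each.
length≤rowDefect : ∀ {x δ} → Partition (x ∷ δ) → x ≤ length δ → length δ ≤ rowDefect (x ∷ δ)
length≤rowDefect {x} {δ} p@(cons _ _ d) x≤L = +-cancelˡ-≤ (rowDinv (x ∷ δ)) _ _ (begin
  (rowScore x δ + rowDinv δ) + length δ
    ≡⟨ cong (λ v → (rowScore x δ + v) + length δ) (rowDinv-column d) ⟩
  (rowScore x δ + (colScore δ + rowDinv (map pred δ))) + length δ
    ≡⟨ re (rowScore x δ) (colScore δ) _ _ ⟩
  (rowScore x δ + colScore δ) + (length δ + rowDinv (map pred δ))
    ≤⟨ +-mono-≤ (row+col-≤ p x≤L) (+-monoʳ-≤ (length δ) (rowDinv≤sum (map pred δ))) ⟩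
  x + (length δ + sum (map pred δ)) ≡⟨ cong (x +_) (sum-pred d) ⟨
  x + sum δ ≡⟨ sum≡rowDinv+rowDefect (x ∷ δ) ⟩
  rowDinv (x ∷ δ) + rowDefect (x ∷ δ) ∎)
  where
  open ≤-Reasoning
  re : ∀ a b c e → (a + (b + c)) + e ≡ (a + b) + (e + c)
  re = solve-∀

-- ν-orbits, their initial partitions, and Δ

Partition-strip-pred : ∀ {γ} → Partition γ →
  Partition (stripZeros (map pred γ)) × head0 (stripZeros (map pred γ)) ≤ pred (head0 γ)
Partition-strip-pred [] = [] , z≤n
Partition-strip-pred {suc zero ∷ δ} (cons _ h d) with Partition-strip-pred d
... | q , r = q , ≤-trans r (pred-mono-≤ h)
Partition-strip-pred {suc (suc x) ∷ δ} (cons _ h d) with Partition-strip-pred d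
... | q , r = cons z<s (≤-trans r (pred-mono-≤ h)) q , ≤-refl

nu≡ : ∀ γ → nu γ ≡ suc (length γ) ∷ stripZeros (map pred γ)
nu≡ γ = cong (λ l → stripZeros (l ∷ map pred γ)) (+-comm (length γ) 1)

Partition-nu : ∀ {γ} → Partition γ → head0 γ ≤ length γ + 2 → Partition (nu γ)
Partition-nu {γ} p h = subst Partition (sym (nu≡ γ)) (cons z<s
  (≤-trans (proj₂ (Partition-strip-pred p)) (≤-trans (pred-mono-≤ h) (≤-reflexive (cong pred (+-comm (length γ) 2)))))
  (proj₁ (Partition-strip-pred p)))

isInit : List ℕ → Bool
isInit [] = true
isInit (x ∷ δ) = x ≤ᵇ length δ

-- Drops the first row and restores a first column of height x - 1; the appended ones are the rows
-- that ν had emptied.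
nuInv : List ℕ → List ℕ
nuInv [] = []
nuInv (x ∷ δ) = map suc δ ++ replicate (x ∸ suc (length δ)) 1

-- Each backward step removes one cell, so `sum γ` is enough fuel.
rootF : ℕ → List ℕ → List ℕ
rootF zero γ = γ
rootF (suc f) γ = if isInit γ then γ else rootF f (nuInv γ)

root : List ℕ → List ℕ
root γ = rootF (sum γ) γ

Partition-head-0 : ∀ {γ} → Partition γ → head0 γ ≤ 0 → γ ≡ []
Partition-head-0 [] _ = refl
Partition-head-0 (cons p _ _) q = ⊥-elim (<⇒≱ p q)

refill : ∀ {γ} → Partition γ → map suc (stripZeros (map pred γ))
  ++ replicate (length γ ∸ length (stripZeros (map pred γ))) 1 ≡ γ
refill [] = refl
refill {suc zero ∷ δ} (cons _ h d)
  with stripZeros (map pred δ) | Partition-head-0 (proj₁ (Partition-strip-pred d)) (≤-trans (proj₂ (Partition-strip-pred d)) (pred-mono-≤ h)) | refill d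
... | .[] | refl | ih = cong (1 ∷_) ih
refill {suc (suc x) ∷ δ} (cons _ h d) = cong (suc (suc x) ∷_) (refill d)

nuInv-nu : ∀ {γ} → Partition γ → nuInv (nu γ) ≡ γ
nuInv-nu {γ} p = trans (cong nuInv (nu≡ γ)) (refill p)

length-strip : ∀ γ → length (stripZeros γ) ≤ length γ
length-strip [] = z≤n
length-strip (zero ∷ γ) = m≤n⇒m≤1+n (length-strip γ)
length-strip (suc x ∷ γ) = s≤s (length-strip γ)

nu-not-init : ∀ γ → isInit (nu γ) ≡ false
nu-not-init γ = trans (cong isInit (nu≡ γ))
  (≤ᵇ-false (s≤s (≤-trans (length-strip (map pred γ)) (≤-reflexive (length-map pred γ)))))

-- `nu γ` has exactly one cell more than `γ`, so one unfolding of the fuel arrives at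
-- `rootF (sum γ) γ`.
root-nu : ∀ {γ} → Partition γ → root (nu γ) ≡ root γ
root-nu {γ} p rewrite sum-nu p | nu-not-init γ | nuInv-nu p = refl

Partition-ones : ∀ n → Partition (replicate n 1)
Partition-ones zero = []
Partition-ones (suc zero) = cons z<s z≤n []
Partition-ones (suc (suc n)) = cons z<s ≤-refl (Partition-ones (suc n))

head-ones : ∀ n → head0 (replicate n 1) ≤ 1
head-ones zero = z≤n
head-ones (suc n) = ≤-refl

head-grow : ∀ δ n → head0 (map suc δ ++ replicate n 1) ≤ suc (head0 δ)
head-grow [] n = head-ones n
head-grow (x ∷ δ) n = ≤-refl

Partition-grow : ∀ {δ} → Partition δ → ∀ n → Partition (map suc δ ++ replicate n 1)
Partition-grow [] n = Partition-ones n
Partition-grow {x ∷ δ} (cons p h d) n = cons z<s (≤-trans (head-grow δ n) (s≤s h)) (Partition-grow d n)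

strip-shrink : ∀ {δ} → Partition δ → ∀ n → stripZeros (map pred (map suc δ ++ replicate n 1)) ≡ δ
strip-shrink [] zero = refl
strip-shrink [] (suc n) = strip-shrink [] n
strip-shrink {suc x ∷ δ} (cons p h d) n = cong (suc x ∷_) (strip-shrink d n)

length-nuInv : ∀ {x δ} → length δ < x → suc (length (nuInv (x ∷ δ))) ≡ x
length-nuInv {x} {δ} p = trans (cong suc (trans (length-++ (map suc δ))
  (cong₂ _+_ (length-map suc δ) (length-replicate (x ∸ suc (length δ)))))) (m+[n∸m]≡n p)

nu-nuInv : ∀ {x δ} → Partition (x ∷ δ) → length δ < x → nu (nuInv (x ∷ δ)) ≡ x ∷ δ
nu-nuInv {x} {δ} (cons _ _ d) p = trans (nu≡ (nuInv (x ∷ δ)))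
  (cong₂ _∷_ (length-nuInv {x} {δ} p) (strip-shrink d (x ∸ suc (length δ))))

nuInv-defined : ∀ {x δ} → Partition (x ∷ δ) → length δ < x → head0 (nuInv (x ∷ δ)) ≤ length (nuInv (x ∷ δ)) + 2
nuInv-defined {x} {δ} (cons _ h _) p = begin
  head0 (nuInv (x ∷ δ)) ≤⟨ head-grow δ _ ⟩
  suc (head0 δ) ≤⟨ s≤s h ⟩
  suc x ≡⟨ cong suc (length-nuInv {x} {δ} p) ⟨
  suc (suc (length (nuInv (x ∷ δ)))) ≡⟨ +-comm 2 _ ⟩
  length (nuInv (x ∷ δ)) + 2 ∎
  where open ≤-Reasoning

nuStep-defined : ∀ {γ} → head0 γ ≤ length γ + 2 → nuStep γ ≡ just (nu γ)
nuStep-defined p rewrite ≤ᵇ-true p = refl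

nuStep-inv : ∀ {γ δ} → nuStep γ ≡ just δ → head0 γ ≤ length γ + 2 × δ ≡ nu γ
nuStep-inv {γ} e with head0 γ ≤ᵇ (length γ + 2) in eq
nuStep-inv {γ} refl | true = ≤ᵇ⇒≤ (head0 γ) (length γ + 2) (subst T (sym eq) tt) , refl
nuStep-inv () | false

nuIter-inv : ∀ m {γ δ} → nuIter (suc m) γ ≡ just δ →
  Σ (List ℕ) λ ε → nuIter m γ ≡ just ε × head0 ε ≤ length ε + 2 × δ ≡ nu ε
nuIter-inv m {γ} e with nuIter m γ
... | just ε = ε , refl , nuStep-inv {ε} e

nuIter-suc : ∀ m {γ δ} → nuIter m γ ≡ just δ → head0 δ ≤ length δ + 2 → nuIter (suc m) γ ≡ just (nu δ)
nuIter-suc m {δ = δ} e h rewrite e = nuStep-defined {δ} h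

nuIter-+ : ∀ a b {γ δ} → nuIter b γ ≡ just δ → nuIter (a + b) γ ≡ nuIter a δ
nuIter-+ zero b e = e
nuIter-+ (suc a) b e = cong (_>>= nuStep) (nuIter-+ a b e)

nuIter-prefix : ∀ a b {γ δ} → nuIter (a + b) γ ≡ just δ → ∃ λ ε → nuIter b γ ≡ just ε
nuIter-prefix zero b e = _ , e
nuIter-prefix (suc a) b e with nuIter-inv (a + b) e
... | _ , e′ , _ = nuIter-prefix a b e′

-- Total, with meaning only where `nuIter` is defined; there the two agree by `nuIter-ν^`.
ν^ : ℕ → List ℕ → List ℕ
ν^ zero γ = γ
ν^ (suc m) γ = nu (ν^ m γ)

nuIter-ν^ : ∀ m {γ δ} → nuIter m γ ≡ just δ → δ ≡ ν^ m γ
nuIter-ν^ zero refl = refl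
nuIter-ν^ (suc m) e with nuIter-inv m e
... | _ , e′ , _ , refl = cong nu (nuIter-ν^ m e′)

-- `Δ` as the maximum of γ_i + i, and its growth under ν

Δ′ : List ℕ → ℕ
Δ′ [] = 0
Δ′ (x ∷ δ) = suc (x ⊔ Δ′ δ)

Δ′-strip : ∀ {γ} → Partition γ → Δ′ γ ≤ suc (length γ) ⊔ suc (Δ′ (stripZeros (map pred γ)))
Δ′-strip [] = z≤n
Δ′-strip {suc zero ∷ δ} (cons _ h d)
  with stripZeros (map pred δ) | Partition-head-0 (proj₁ (Partition-strip-pred d)) (≤-trans (proj₂ (Partition-strip-pred d)) (pred-mono-≤ h)) | Δ′-strip d
... | .[] | refl | ih = s≤s (⊔-lub (s≤s z≤n) (≤-trans ih (⊔-lub ≤-refl (s≤s z≤n))))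
Δ′-strip {suc (suc x) ∷ δ} (cons _ h d) = s≤s (⊔-lub
  (≤-trans (s≤s (m≤m⊔n (suc x) (Δ′ (stripZeros (map pred δ))))) (m≤n⊔m (suc (length δ)) _))
  (≤-trans (Δ′-strip d) (⊔-monoʳ-≤ (suc (length δ)) (s≤s (m≤n⊔m (suc x) (Δ′ (stripZeros (map pred δ))))))))

-- Row i becomes row i + 1 and loses one cell, so γ_i + i is unchanged. A row that vanishes had
-- value at most ℓ + 1, less than the value ℓ + 2 of the new first row.
Δ′-nu-mono : ∀ {γ} → Partition γ → Δ′ γ ≤ Δ′ (nu γ)
Δ′-nu-mono {γ} p = subst (λ δ → Δ′ γ ≤ Δ′ δ) (sym (nu≡ γ))
  (≤-trans (Δ′-strip p) (⊔-monoˡ-≤ (suc (Δ′ (stripZeros (map pred γ)))) (n≤1+n (suc (length γ)))))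

Δ′-nu-length : ∀ γ → suc (suc (length γ)) ≤ Δ′ (nu γ)
Δ′-nu-length γ = subst (λ δ → suc (suc (length γ)) ≤ Δ′ δ) (sym (nu≡ γ)) (s≤s (m≤m⊔n (suc (length γ)) (Δ′ (stripZeros (map pred γ)))))

inDP⇒ : ∀ n γ → InDP n γ → Δ′ γ ≤ n
inDP⇒ n [] _ = z≤n
inDP⇒ n (x ∷ γ) t with Equivalence.to (T-∧ {suc x ≤ᵇ n}) t
inDP⇒ (suc n) (x ∷ γ) t | a , b = s≤s (⊔-lub (≤-pred (≤ᵇ⇒≤ (suc x) (suc n) a)) (inDP⇒ n γ b))

inDP⇐ : ∀ n γ → Δ′ γ ≤ n → InDP n γ
inDP⇐ n [] _ = tt
inDP⇐ (suc n) (x ∷ γ) (s≤s p) = Equivalence.from (T-∧ {suc x ≤ᵇ suc n})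
  (≤⇒≤ᵇ (s≤s (≤-trans (m≤m⊔n x _) p)) , inDP⇐ n γ (≤-trans (m≤n⊔m x _) p))

Δ′-bound : ∀ γ → Δ′ γ ≤ sum γ + length γ + 1
Δ′-bound γ = ≤-trans (go γ) (≤-trans (n≤1+n _) (≤-reflexive (+-comm 1 _)))
  where
  go : ∀ γ → Δ′ γ ≤ sum γ + length γ
  go [] = z≤n
  go (x ∷ γ) = ≤-trans (s≤s (⊔-lub (≤-trans (m≤m+n x (sum γ)) (m≤m+n _ _))
    (≤-trans (go γ) (+-monoˡ-≤ (length γ) (m≤n+m (sum γ) x))))) (≤-reflexive (sym (+-suc _ (length γ))))

search-finds : ∀ n f γ → n ≤ Δ′ γ → Δ′ γ ≤ n + f → searchDP n f γ ≡ Δ′ γ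
search-finds n zero γ p q = ≤-antisym p (subst (Δ′ γ ≤_) (+-identityʳ n) q)
search-finds n (suc f) γ p q with inDPᵇ n γ in eq
... | true = ≤-antisym p (inDP⇒ n γ (subst T (sym eq) tt))
... | false = search-finds (suc n) f γ
  (≰⇒> (λ r → subst T eq (inDP⇐ n γ r))) (subst (Δ′ γ ≤_) (+-suc n f) q)

Δ≡Δ′ : ∀ γ → Δ γ ≡ Δ′ γ
Δ≡Δ′ γ = search-finds 0 _ γ z≤n (Δ′-bound γ)

-- Invariants along an orbit, and existence of the initial partition

record Orbit (r δ : List ℕ) (m : ℕ) : Set where
  field
    pt  : Partition δ
    dvδ : rowDinv δ ≡ m + rowDinv r
    ddδ : rowDefect δ ≡ rowDefect r
    rt  : root δ ≡ root r
    mon : Δ′ r ≤ Δ′ δ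

orbit : ∀ m {r δ} → Partition r → nuIter m r ≡ just δ → Orbit r δ m
orbit zero p refl = record { pt = p ; dvδ = refl ; ddδ = refl ; rt = refl ; mon = ≤-refl }
orbit (suc m) p e with nuIter-inv m e
... | ε , e′ , h , refl = record
  { pt  = Partition-nu pt h
  ; dvδ = trans (rowDinv-nu pt h) (cong suc dvδ)
  ; ddδ = trans (rowDefect-nu pt h) ddδ
  ; rt  = trans (root-nu pt) rt
  ; mon = ≤-trans mon (Δ′-nu-mono pt) }
  where open Orbit (orbit m p e′)

record RootOf (γ r : List ℕ) : Set where
  field
    steps : ℕ
    reach : nuIter steps r ≡ just γ
    pt    : Partition r
    init  : isInit r ≡ true

sum-0 : ∀ {γ} → Partition γ → sum γ ≤ 0 → γ ≡ []
sum-0 [] _ = refl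
sum-0 {x ∷ δ} (cons p _ _) q = ⊥-elim (<⇒≱ p (≤-trans (m≤m+n x (sum δ)) q))

rootF-spec : ∀ f {γ} → Partition γ → sum γ ≤ f → RootOf γ (rootF f γ)
rootF-spec zero p q with sum-0 p q
... | refl = record { steps = 0 ; reach = refl ; pt = [] ; init = refl }
rootF-spec (suc f) {[]} p q = record { steps = 0 ; reach = refl ; pt = [] ; init = refl }
rootF-spec (suc f) {x ∷ δ} p@(cons _ _ d) q with x ≤ᵇ length δ in eq
... | true = record { steps = 0 ; reach = refl ; pt = p ; init = eq }
... | false = record
  { steps = suc steps
  ; reach = trans (nuIter-suc steps reach (nuInv-defined p big)) (cong just (nu-nuInv p big))
  ; pt = pt ; init = init }
  where
  big : length δ < x
  big = ≰⇒> (λ r → subst T eq (≤⇒≤ᵇ r))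
  pi : Partition (nuInv (x ∷ δ))
  pi = Partition-grow d (x ∸ suc (length δ))
  smaller : suc (sum (nuInv (x ∷ δ))) ≤ suc f
  smaller = ≤-trans (≤-reflexive (trans (sym (sum-nu pi)) (cong sum (nu-nuInv p big)))) q
  open RootOf (rootF-spec f pi (≤-pred smaller))

root-spec : ∀ {γ} → Partition γ → RootOf γ (root γ)
root-spec p = rootF-spec _ p ≤-refl

root-init : ∀ {r} → Partition r → isInit r ≡ true → root r ≡ r
root-init {r} p i = go (sum r)
  where
  go : ∀ f → rootF f r ≡ r
  go zero = refl
  go (suc f) rewrite i = refl

tri : ℕ → ℕ
tri zero = 0
tri (suc n) = n + tri n

C2≡tri : ∀ n → n C 2 ≡ tri n
C2≡tri zero = refl
C2≡tri (suc n) = trans (sym (nCk+nC[k+1]≡[n+1]C[k+1] n 1)) (cong₂ _+_ (nC1≡n n) (C2≡tri n))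

tri-mono : ∀ {m n} → m ≤ n → tri m ≤ tri n
tri-mono z≤n = z≤n
tri-mono (s≤s p) = +-mono-≤ p (tri-mono p)

-- ν-tails

-- The shape of the γ_μ: a 0/1 Dyck vector gives rows with ℓ - i or ℓ - i + 1 cells. It passes from
-- γ to (ℓ + 1, γ), so the argument for one block of steps can be repeated.
data Stair : List ℕ → Set where
  []   : Stair []
  cons : ∀ {x δ} → length δ ≤ x → x ≤ suc (length δ) → Stair δ → Stair (x ∷ δ)

strip-++ : ∀ a b → stripZeros (a ++ b) ≡ stripZeros a ++ stripZeros b
strip-++ [] b = refl
strip-++ (zero ∷ a) b = strip-++ a b
strip-++ (suc x ∷ a) b = cong (suc x ∷_) (strip-++ a b)

strip-positive : ∀ {a} → All (0 <_) a → stripZeros a ≡ a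
strip-positive [] = refl
strip-positive {suc x ∷ a} (_ ∷ p) = cong (suc x ∷_) (strip-positive p)

-- The rows of β have been recreated, raised by 1 + |α|; those of α have been lowered |β| times.
state : List ℕ → List ℕ → List ℕ
state α β = map (_+ suc (length α)) β ++ stripZeros (map (_∸ length β) α)

module _ (α : List ℕ) (x : ℕ) (β : List ℕ) (α≥ : All (suc (length β) ≤_) α)
         (s≤x : length β ≤ x) (x≤ : x ≤ suc (length β)) where

  private
    s = length β
    A = map (_∸ s) α
    last = stripZeros ((x ∸ s) ∷ [])

    A-positive : All (0 <_) A
    A-positive = AllP.map⁺ (All.map m<n⇒0<n∸m α≥)

    S≡ : state (α ∷ʳ x) β ≡ map (_+ suc (suc (length α))) β ++ (A ++ last)
    S≡ = cong₂ _++_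
      (map-cong (λ b → cong (λ l → b + suc l) (trans (length-++ α) (+-comm (length α) 1))) β)
      (trans (cong stripZeros (map-++ (_∸ s) α (x ∷ [])))
             (trans (strip-++ A _) (cong (_++ last) (strip-positive A-positive))))

    last-length : ∀ y → y ≤ 1 → length (stripZeros (y ∷ [])) ≡ y
    last-length zero _ = refl
    last-length (suc zero) _ = refl
    last-length (suc (suc _)) (s≤s ())

    last-pred : ∀ y → y ≤ 1 → stripZeros (map pred (stripZeros (y ∷ []))) ≡ []
    last-pred zero _ = refl
    last-pred (suc zero) _ = refl
    last-pred (suc (suc _)) (s≤s ())

    x∸s≤1 : x ∸ s ≤ 1
    x∸s≤1 = ≤-trans (∸-monoˡ-≤ s x≤) (≤-reflexive (m+n∸n≡m 1 s))

  state-length : length (state (α ∷ʳ x) β) ≡ x + length α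
  state-length = begin
    length (state (α ∷ʳ x) β) ≡⟨ cong length S≡ ⟩
    length (map (_+ suc (suc (length α))) β ++ (A ++ last)) ≡⟨ length-++ (map (_+ suc (suc (length α))) β) ⟩
    length (map (_+ suc (suc (length α))) β) + length (A ++ last)
      ≡⟨ cong₂ _+_ (length-map _ β) (trans (length-++ A) (cong₂ _+_ (length-map _ α) (last-length (x ∸ s) x∸s≤1))) ⟩
    s + (length α + (x ∸ s)) ≡⟨ re s (length α) (x ∸ s) ⟩
    (s + (x ∸ s)) + length α ≡⟨ cong (_+ length α) (m+[n∸m]≡n s≤x) ⟩
    x + length α ∎
    where
    open ≡-Reasoning
    re : ∀ a b c → a + (b + c) ≡ (a + c) + b
    re = solve-∀

  -- After s = `length β` lowerings, row `x` has x - s cells, which is 0 or 1. The current length is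
  -- therefore s + |α| + (x - s) = x + |α|, so the new first row has x + |α| + 1 cells: it is row
  -- `x` raised by 1 + |α|. The remnant of the old row `x` disappears in the same step.
  state-step : nu (state (α ∷ʳ x) β) ≡ state α (x ∷ β)
  state-step = trans (nu≡ (state (α ∷ʳ x) β)) (cong₂ _∷_ (trans (cong suc state-length) (sym (+-suc x _))) (begin
    stripZeros (map pred (state (α ∷ʳ x) β))
      ≡⟨ cong (stripZeros ∘ map pred) S≡ ⟩
    stripZeros (map pred (map (_+ suc (suc (length α))) β ++ (A ++ last)))
      ≡⟨ cong stripZeros (trans (map-++ pred (map (_+ suc (suc (length α))) β) _)
           (cong (map pred (map (_+ suc (suc (length α))) β) ++_) (map-++ pred A last))) ⟩
    stripZeros (map pred (map (_+ suc (suc (length α))) β) ++ (map pred A ++ map pred last))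
      ≡⟨ trans (strip-++ (map pred (map (_+ suc (suc (length α))) β)) _)
           (cong (stripZeros (map pred (map (_+ suc (suc (length α))) β)) ++_) (strip-++ (map pred A) _)) ⟩
    stripZeros (map pred (map (_+ suc (suc (length α))) β)) ++ (stripZeros (map pred A) ++ stripZeros (map pred last))
      ≡⟨ cong₂ _++_ (cong stripZeros (raise β)) (cong₂ _++_ (cong stripZeros lower) (last-pred (x ∸ s) x∸s≤1)) ⟩
    stripZeros (map (_+ suc (length α)) β) ++ (stripZeros (map (_∸ suc s) α) ++ [])
      ≡⟨ cong₂ _++_ (strip-positive (AllP.map⁺ (All.universal (λ b → m≤n⇒m≤o+n b z<s) β))) (++-identityʳ _) ⟩
    map (_+ suc (length α)) β ++ stripZeros (map (_∸ suc s) α) ∎))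
    where
    open ≡-Reasoning
    raise : ∀ b → map pred (map (_+ suc (suc (length α))) b) ≡ map (_+ suc (length α)) b
    raise b = trans (sym (map-∘ b)) (map-cong (λ y → cong pred (+-suc y (suc (length α)))) b)
    lower : map pred A ≡ map (_∸ suc s) α
    lower = trans (sym (map-∘ α)) (map-cong (λ y → pred[m∸n]≡m∸[1+n] y s) α)

Stair-head : ∀ {γ} → Stair γ → head0 γ ≤ length γ
Stair-head [] = z≤n
Stair-head (cons _ h _) = h

state-defined : ∀ {γ} → head0 γ ≤ length γ + 2 → ∀ α x β → All (suc (length β) ≤_) α →
  length β ≤ x → x ≤ suc (length β) → Stair β → nuIter (length β) γ ≡ just (state (α ∷ʳ x) β) →
  head0 (state (α ∷ʳ x) β) ≤ length (state (α ∷ʳ x) β) + 2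
-- Before any step the state is `γ` itself, so the hypothesis on `γ` applies.
state-defined hγ α x [] α≥ lo hi st e = subst (λ δ → head0 δ ≤ length δ + 2) (just-injective e) hγ
state-defined hγ α x β@(b ∷ _) α≥ lo hi (cons _ b≤ _) e = begin
  b + suc (length (α ∷ʳ x)) ≤⟨ +-monoˡ-≤ _ (≤-trans b≤ lo) ⟩
  x + suc (length (α ∷ʳ x)) ≡⟨ cong (λ l → x + suc l) (trans (length-++ α) (+-comm (length α) 1)) ⟩
  x + suc (suc (length α)) ≡⟨ re x (length α) ⟩
  x + length α + 2 ≡⟨ cong (_+ 2) (state-length α x β α≥ lo hi) ⟨
  length (state (α ∷ʳ x) β) + 2 ∎
  where
  open ≤-Reasoning
  re : ∀ a c → a + suc (suc c) ≡ a + c + 2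
  re = solve-∀

module _ {γ : List ℕ} (γ>0 : All (0 <_) γ) (hγ : head0 γ ≤ length γ + 2) where

  -- One step recreates one row, from the bottom of `γ` upwards. The bound on `α` says that no row
  -- still waiting is emptied too early.
  block : ∀ α β → α ++ β ≡ γ → All (length β ≤_) α → Stair β → nuIter (length β) γ ≡ just (state α β)
  block α [] e _ _ = cong just (sym (trans (cong stripZeros (map-id α)) (trans (strip-positive
    (subst (All (0 <_)) (trans (sym e) (++-identityʳ α)) γ>0)) (trans (sym (++-identityʳ α)) e))))
  block α (x ∷ β) e α≥ (cons lo hi st) = trans
    (nuIter-suc (length β) ih (state-defined hγ α x β α≥ lo hi st ih)) (cong just (state-step α x β α≥ lo hi))
    where
    ih : nuIter (length β) γ ≡ just (state (α ∷ʳ x) β)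
    ih = block (α ∷ʳ x) β (trans (++-assoc α (x ∷ []) β) e)
      (AllP.++⁺ (All.map (≤-trans (n≤1+n _)) α≥) (lo ∷ [])) st

Partition-positive : ∀ {γ} → Partition γ → All (0 <_) γ
Partition-positive p = proj₂ (fromPartition p)

-- After ℓ steps every row has been recreated with one extra cell; step ℓ + 1 removes this extra
-- column and puts the row ℓ + 1 on top.
grow : ∀ {γ} → Stair γ → Partition γ → nuIter (suc (length γ)) γ ≡ just (suc (length γ) ∷ γ)
grow {γ} st p = trans (nuIter-suc (length γ) raised defined) (cong just (trans (nu≡ (map (_+ 1) γ))
    (cong₂ _∷_ (cong suc (length-map (_+ 1) γ)) (trans (cong stripZeros lowered) (strip-positive (Partition-positive p))))))
  where
  raised : nuIter (length γ) γ ≡ just (map (_+ 1) γ)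
  raised = trans (block (Partition-positive p) (≤-trans (Stair-head st) (m≤m+n _ 2)) [] γ refl [] st)
                 (cong just (++-identityʳ _))
  lowered : map pred (map (_+ 1) γ) ≡ γ
  lowered = trans (sym (map-∘ γ)) (trans (map-cong (λ y → cong pred (+-comm y 1)) γ) (map-id γ))
  head-raised : ∀ γ → head0 (map (_+ 1) γ) ≤ head0 γ + 1
  head-raised [] = z≤n
  head-raised (x ∷ γ) = ≤-refl
  defined : head0 (map (_+ 1) γ) ≤ length (map (_+ 1) γ) + 2
  defined = ≤-trans (head-raised γ) (≤-trans (+-mono-≤ (Stair-head st) (n≤1+n 1))
    (≤-reflexive (cong (_+ 2) (sym (length-map (_+ 1) γ)))))

Stair-grow : ∀ {γ} → Stair γ → Stair (suc (length γ) ∷ γ)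
Stair-grow st = cons (n≤1+n _) ≤-refl st

Partition-grow-row : ∀ {γ} → Stair γ → Partition γ → Partition (suc (length γ) ∷ γ)
Partition-grow-row st p = cons z<s (m≤n⇒m≤1+n (Stair-head st)) p

Δ′-Stair : ∀ {γ} → Stair γ → Δ′ γ ≤ suc (length γ)
Δ′-Stair [] = z≤n
Δ′-Stair (cons _ h st) = s≤s (⊔-lub h (Δ′-Stair st))

-- The steps are cut into blocks of lengths ℓ + 1, ℓ + 2, ..., each ending in a stair; a final
-- incomplete block is a prefix of a complete one.
tail-defined : ∀ {γ} → Stair γ → Partition γ → ∀ m → nuIter m γ ≡ just (ν^ m γ)
tail-defined {γ} st p m = let δ , e = go m m ≤-refl st p in trans e (cong just (nuIter-ν^ m e))
  where
  go : ∀ f m → m ≤ f → ∀ {γ} → Stair γ → Partition γ → ∃ λ δ → nuIter m γ ≡ just δ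
  go zero zero _ st p = _ , refl
  go (suc f) m m≤ {γ} st p with m ≤? suc (length γ)
  ... | yes q = nuIter-prefix (suc (length γ) ∸ m) m (trans (cong (λ l → nuIter l γ) (m∸n+n≡m q)) (grow st p))
  ... | no q with go f (m ∸ suc (length γ)) (≤-trans (∸-monoˡ-≤ (suc (length γ)) m≤) (m∸n≤m f (length γ)))
                   (Stair-grow st) (Partition-grow-row st p)
  ... | δ , e = δ , trans (cong (λ l → nuIter l γ) (sym (m∸n+n≡m (<⇒≤ (≰⇒> q)))))
                      (trans (nuIter-+ (m ∸ suc (length γ)) (suc (length γ)) (grow st p)) e)

Δ′-first-step : ∀ m {γ δ} → Partition γ → nuIter (suc m) γ ≡ just δ → suc (suc (length γ)) ≤ Δ′ δ
Δ′-first-step m {γ} p e with nuIter-prefix m 1 (trans (cong (λ l → nuIter l γ) (+-comm m 1)) e)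
... | ε , e₁ with nuIter-inv 0 {γ} e₁
... | .γ , refl , h , refl = ≤-trans (Δ′-nu-length γ) (Orbit.mon (orbit m (Partition-nu p h) (trans (sym (nuIter-+ m 1 e₁))
  (trans (cong (λ l → nuIter l γ) (+-comm m 1)) e))))

-- Writing n = length γ + 1, the iterates up to ν^n γ = n ∷ γ stay inside DP_{n+1}, all but γ itself leave DP_n.
tail-Δ : ∀ d m {γ δ} → Stair γ → Partition γ → nuIter m γ ≡ just δ → let n = suc (length γ) in
  (Δ′ δ ≤ d + n → m + tri n ≤ tri (d + n)) × (m + tri n ≤ tri (d + n) → Δ′ δ ≤ d + n)
tail-Δ zero zero st p refl = (λ _ → ≤-refl) , (λ _ → Δ′-Stair st)
tail-Δ zero (suc m) {γ} {δ} st p e =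
  (λ q → ⊥-elim (<⇒≱ (Δ′-first-step m p e) q)) ,
  (λ q → ⊥-elim (<⇒≱ (s≤s (m≤n+m (tri (suc (length γ))) m)) q))
tail-Δ (suc d) m {γ} {δ} st p e with m ≤? suc (length γ)
... | yes m≤n = (λ _ → ≤-trans (+-monoˡ-≤ (tri n) m≤n) (tri-mono {suc n} {suc d + n} (s≤s (m≤n+m n d))))
              , (λ _ → ≤-trans upper (s≤s (m≤n+m n d)))
  where
  n = suc (length γ)
  rest : nuIter (n ∸ m) δ ≡ just (n ∷ γ)
  rest = trans (sym (nuIter-+ (n ∸ m) m e)) (trans (cong (λ l → nuIter l γ) (m∸n+n≡m m≤n)) (grow st p))
  upper : Δ′ δ ≤ suc n
  upper = ≤-trans (Orbit.mon (orbit (n ∸ m) (Orbit.pt (orbit m p e)) rest)) (Δ′-Stair (Stair-grow st))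
... | no m≰n = subst₂ (λ k u → (Δ′ δ ≤ k → u ≤ tri k) × (u ≤ tri k → Δ′ δ ≤ k)) (+-suc d n) shift
                 (tail-Δ d (m ∸ n) (Stair-grow st) (Partition-grow-row st p) rest)
  where
  n = suc (length γ)
  n≤m : n ≤ m
  n≤m = <⇒≤ (≰⇒> m≰n)
  rest : nuIter (m ∸ n) (n ∷ γ) ≡ just δ
  rest = trans (sym (nuIter-+ (m ∸ n) n (grow st p))) (trans (cong (λ l → nuIter l γ) (m∸n+n≡m n≤m)) e)
  shift : (m ∸ n) + tri (suc n) ≡ m + tri n
  shift = trans (sym (+-assoc (m ∸ n) n (tri n))) (cong (_+ tri n) (m∸n+n≡m n≤m))

-- Partitions dp_n(dyck(λ))

blocks : ℕ → List ℕ → List ℕ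
blocks c [] = []
blocks c (p ∷ ps) = replicate p c ++ blocks (suc c) ps

dyck≡blocks : ∀ ps → dyck ps ≡ blocks 0 ps
dyck≡blocks ps = go (λ i → i) 0 ps (λ i → refl)
  where
  go : ∀ g c ps → (∀ i → g i ≡ c + i) →
    concat (zipWith (λ i p → replicate p i) (applyUpTo g (length ps)) ps) ≡ blocks c ps
  go g c [] h = refl
  go g c (p ∷ ps) h = cong₂ _++_ (cong (replicate p) (trans (h 0) (+-identityʳ c)))
    (go (g ∘ suc) (suc c) ps (λ i → trans (h (suc i)) (+-suc c i)))

length-blocks : ∀ c ps → length (blocks c ps) ≡ sum ps
length-blocks c [] = refl
length-blocks c (p ∷ ps) = trans (length-++ (replicate p c)) (cong₂ _+_ (length-replicate p) (length-blocks (suc c) ps))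

-- The rows of dp, zeros included, for a Dyck vector read from its last entry.
rows : List ℕ → List ℕ
rows [] = []
rows (c ∷ u) = (length u ∸ c) ∷ rows u

dp≡rows : ∀ ps → dp (sum ps) (dyck ps) ≡ stripZeros (rows (blocks 0 ps ʳ++ []))
dp≡rows ps = trans (cong (dp (sum ps)) (dyck≡blocks ps))
  (cong stripZeros (trans (cong (λ n → zipWith _∸_ (downFrom n) v) (sym len)) (go v)))
  where
  v = reverse (blocks 0 ps)
  len : length v ≡ sum ps
  len = trans (length-reverse (blocks 0 ps)) (length-blocks 0 ps)
  go : ∀ u → zipWith _∸_ (downFrom (length u)) u ≡ rows u
  go [] = refl
  go (c ∷ u) = cong ((length u ∸ c) ∷_) (go u)

rowDefect-strip : ∀ γ → rowDefect (stripZeros γ) ≡ rowDefect γ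
rowDefect-strip [] = refl
rowDefect-strip (zero ∷ γ) = rowDefect-strip γ
rowDefect-strip (suc x ∷ γ) = cong₂ _+_ (cong (suc x ∸_) (rowScore-strip (suc x) γ)) (rowDefect-strip γ)

module LowCells (a : ℕ) where

  -- For `t = suc x` this says that in a row of length x over `δ` each of the first `a` cells has
  -- leg greater than arm.
  Tall : ℕ → List ℕ → Set
  Tall t δ = ∀ j → j < a → t ≤ countGE (suc j) δ + suc j

  bad-row : ∀ {x δ} → a ≤ x → Tall (suc x) δ → a ≤ x ∸ rowScore x δ
  bad-row {x} {δ} a≤x tall = begin
    a ≡⟨ m∸[m∸n]≡n a≤x ⟨
    x ∸ (x ∸ a) ≤⟨ ∸-monoʳ-≤ x few ⟩
    x ∸ rowScore x δ ∎
    where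
    open ≤-Reasoning
    f : ℕ → ℕ
    f j = score (x ∸ suc j) (countGE (suc j) δ)
    low : ∀ j → j < a → f j ≡ 0
    low j j<a = trans (score-shift x (suc j) _ (≤-trans j<a a≤x))
      (cong₂ (λ b c → ind b + ind c) (≡ᵇ-false (>⇒≢ big)) (≡ᵇ-false (>⇒≢ (m≤n⇒m≤1+n big))))
      where
      big : x < suc j + countGE (suc j) δ
      big = subst (x <_) (+-comm (countGE (suc j) δ) (suc j)) (tall j j<a)
    zeros : ∀ n → sumTo (λ _ → 0) n ≡ 0
    zeros zero = refl
    zeros (suc n) = zeros n
    few : rowScore x δ ≤ x ∸ a
    few = begin
      rowScore x δ ≡⟨ cong (sumTo f) (m+[n∸m]≡n a≤x) ⟨
      sumTo f (a + (x ∸ a)) ≡⟨ sumTo-split f a (x ∸ a) ⟩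
      sumTo f a + sumTo (λ j → f (a + j)) (x ∸ a) ≡⟨ cong (_+ sumTo (λ j → f (a + j)) (x ∸ a)) (trans (sumTo-cong a low) (zeros a)) ⟩
      sumTo (λ j → f (a + j)) (x ∸ a) ≤⟨ sumTo-≤ _ (x ∸ a) (λ j _ → score-≤1 (x ∸ suc (a + j)) _) ⟩
      x ∸ a ∎

  -- The row that a next Dyck entry `c` creates has `length u ∸ c` cells, at least `a` of them
  -- non-scoring. Repeating `c` lengthens the following row by one and raises the first `a` columns
  -- by one; passing to c + 1 keeps the length. Both preserve the invariant.
  Ready : List ℕ → ℕ → Set
  Ready u c = c ≤ length u × a ≤ length u ∸ c × Tall (suc (length u ∸ c)) (rows u)

  tall-cons : ∀ {u c} → Ready u c → Tall (suc (suc (length u ∸ c))) (rows (c ∷ u))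
  tall-cons {u} {c} (_ , a≤ , tall) j j<a = subst (λ h → suc (suc (length u ∸ c)) ≤ h + suc j)
    (sym (countGE-hit (rows u) (≤-trans j<a a≤))) (s≤s (tall j j<a))

  stay : ∀ {u c} → Ready u c → Ready (c ∷ u) c
  stay {u} {c} r@(c≤ , a≤ , _) rewrite +-∸-assoc 1 c≤ = m≤n⇒m≤1+n c≤ , m≤n⇒m≤1+n a≤ , tall-cons {u} {c} r

  advance : ∀ {u c} → Ready u c → Ready (c ∷ u) (suc c)
  advance {u} {c} r@(c≤ , a≤ , _) = s≤s c≤ , a≤ , λ j j<a → ≤-trans (n≤1+n _) (tall-cons {u} {c} r j j<a)

  block-defect : ∀ p {u c} → Ready u c → Ready (replicate (suc p) c ʳ++ u) (suc c) ×
    suc p * a + rowDefect (rows u) ≤ rowDefect (rows (replicate (suc p) c ʳ++ u))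
  block-defect zero {u} {c} r@(_ , a≤ , tall) = advance {u} {c} r ,
    ≤-trans (≤-reflexive (cong (_+ rowDefect (rows u)) (+-identityʳ a))) (+-monoˡ-≤ (rowDefect (rows u)) (bad-row {δ = rows u} a≤ tall))
  block-defect (suc p) {u} {c} r@(_ , a≤ , tall) with block-defect p (stay {u} {c} r)
  ... | r′ , q = r′ , ≤-trans (≤-trans (≤-reflexive (re a (suc p * a) _))
                        (+-monoʳ-≤ (suc p * a) (+-monoˡ-≤ (rowDefect (rows u)) (bad-row {δ = rows u} a≤ tall)))) q
    where
    re : ∀ x y z → x + y + z ≡ y + (x + z)
    re = solve-∀

  blocks-defect : ∀ {ps} → Partition ps → ∀ {u c} → Ready u c →
    sum ps * a + rowDefect (rows u) ≤ rowDefect (rows (blocks c ps ʳ++ u))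
  blocks-defect [] r = ≤-refl
  blocks-defect {suc p ∷ ps} (cons _ _ d) {u} {c} r
    rewrite ++-ʳ++ (replicate (suc p) c) {blocks (suc c) ps} {u} with block-defect p {u} {c} r
  ... | r′ , q = ≤-trans (≤-reflexive (re (suc p) (sum ps) a (rowDefect (rows u))))
                   (≤-trans (+-monoʳ-≤ (sum ps * a) q) (blocks-defect d {replicate (suc p) c ʳ++ u} r′))
    where
    re : ∀ x y a z → (x + y) * a + z ≡ y * a + (x * a + z)
    re = solve-∀

replicate-ʳ++ : ∀ n (c : ℕ) u → replicate n c ʳ++ (c ∷ u) ≡ c ∷ (replicate n c ʳ++ u)
replicate-ʳ++ zero c u = refl
replicate-ʳ++ (suc n) c u = replicate-ʳ++ n c (c ∷ u)

replicate-reverse : ∀ n (c : ℕ) → replicate n c ʳ++ [] ≡ replicate n c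
replicate-reverse zero c = refl
replicate-reverse (suc n) c = trans (replicate-ʳ++ n c []) (cong (c ∷_) (replicate-reverse n c))

first-block-tall : ∀ p j → j < p → p ≤ countGE (suc j) (rows (replicate p 0)) + suc j
first-block-tall (suc p) j (s≤s j≤p) with suc j ≤? p
... | yes q = subst (suc p ≤_) (cong (_+ suc j) (sym (trans (cong (λ l → countGE (suc j) (l ∷ rows (replicate p 0))) (length-replicate p))
                (countGE-hit (rows (replicate p 0)) q)))) (s≤s (first-block-tall p j q))
... | no q = ≤-trans (≰⇒> q) (m≤n+m (suc j) _)

-- In every row that does not come from the first block of zeros, the first a cells have leg > arm.
defect-bound : ∀ {a ps} → Partition (suc a ∷ ps) →
  sum ps * a ≤ rowDefect (dp (sum (suc a ∷ ps)) (dyck (suc a ∷ ps)))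
defect-bound {a} {ps} (cons _ _ d) = begin
  sum ps * a ≤⟨ m≤m+n _ _ ⟩
  sum ps * a + rowDefect (rows u) ≤⟨ blocks-defect d {u} {1} ready ⟩
  rowDefect (rows (blocks 1 ps ʳ++ u)) ≡⟨ cong (rowDefect ∘ rows) (trans (cong (blocks 1 ps ʳ++_) (sym (replicate-reverse (suc a) 0)))
                                     (sym (++-ʳ++ (replicate (suc a) 0)))) ⟩
  rowDefect (rows (blocks 0 (suc a ∷ ps) ʳ++ [])) ≡⟨ rowDefect-strip (rows (blocks 0 (suc a ∷ ps) ʳ++ [])) ⟨
  rowDefect (stripZeros (rows (blocks 0 (suc a ∷ ps) ʳ++ []))) ≡⟨ cong rowDefect (dp≡rows (suc a ∷ ps)) ⟨
  rowDefect (dp (sum (suc a ∷ ps)) (dyck (suc a ∷ ps))) ∎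
  where
  open ≤-Reasoning
  open LowCells a
  u = replicate (suc a) 0
  ready : Ready u 1
  -- The first block supplies a + 1 rows, so an entry 1 right after it makes a row of exactly a
  -- cells.
  ready = s≤s z≤n , ≤-reflexive (sym (length-replicate a)) , λ j j<a →
    subst (λ l → suc l ≤ countGE (suc j) (rows u) + suc j) (sym (length-replicate a)) (first-block-tall (suc a) j (m≤n⇒m≤1+n j<a))

-- Single rows and columns, and the cut-off at size 12

Trivial : List ℕ → Set
Trivial γ = ∃ λ m → nuIter m [] ≡ just γ

staircase : ℕ → List ℕ
staircase zero = []
staircase (suc n) = suc (length (staircase n)) ∷ staircase n

staircase-ok : ∀ n → Stair (staircase n) × Partition (staircase n) × length (staircase n) ≡ n × Trivial (staircase n)
staircase-ok zero = [] , [] , refl , 0 , refl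
staircase-ok (suc n) with staircase-ok n
... | st , p , e , m , q = Stair-grow st , Partition-grow-row st p , cong suc e ,
  suc (length (staircase n)) + m , trans (nuIter-+ (suc (length (staircase n))) m q) (grow st p)

sum-ones : ∀ n → sum (replicate n 1) ≡ n
sum-ones zero = refl
sum-ones (suc n) = cong suc (sum-ones n)

row-trivial : ∀ n → Trivial (dp n (dyck (n ∷ [])))
row-trivial n = subst Trivial (sym eq) (tr n)
  where
  eq : dp n (dyck (n ∷ [])) ≡ stripZeros (rows (replicate n 0))
  eq = trans (cong (λ l → dp l (dyck (n ∷ []))) (sym (+-identityʳ n))) (trans (dp≡rows (n ∷ []))
    (cong (stripZeros ∘ rows) (trans (cong (_ʳ++ []) (++-identityʳ (replicate n 0))) (replicate-reverse n 0))))
  st : ∀ n → stripZeros (rows (replicate (suc n) 0)) ≡ staircase n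
  st zero = refl
  st (suc n) rewrite length-replicate n {x = 0} = cong₂ _∷_ (cong suc (sym (proj₁ (proj₂ (proj₂ (staircase-ok n))))))
    (trans (cong (λ l → stripZeros (l ∷ rows (replicate n 0))) (sym (length-replicate n {x = 0}))) (st n))
  tr : ∀ n → Trivial (stripZeros (rows (replicate n 0)))
  tr zero = 0 , refl
  tr (suc n) = subst Trivial (sym (st n)) (proj₂ (proj₂ (proj₂ (staircase-ok n))))

column-trivial : ∀ n → Trivial (dp n (dyck (replicate n 1)))
column-trivial n = 0 , cong just (sym (trans (cong (λ l → dp l (dyck (replicate n 1))) (sym (sum-ones n)))
    (trans (dp≡rows (replicate n 1)) (go n [] refl))))
  where
  go : ∀ n u → stripZeros (rows u) ≡ [] → stripZeros (rows (blocks (length u) (replicate n 1) ʳ++ u)) ≡ []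
  go zero u e = e
  go (suc n) u e = go n (length u ∷ u) (trans (cong (λ l → stripZeros (l ∷ rows u)) (n∸n≡0 (length u))) e)

conj-row : ∀ n → conj (n ∷ []) ≡ replicate n 1
conj-row n = trans (map-applyUpTo suc (λ j → countGE j (n ∷ [])) n) (go n n ≤-refl (λ j → suc j) (λ j p → p))
  where
  go : ∀ m n → m ≤ n → (f : ℕ → ℕ) → (∀ j → j < m → f j ≤ n) → applyUpTo (λ j → countGE (f j) (n ∷ [])) m ≡ replicate m 1
  go zero n _ f h = refl
  go (suc m) n m≤ f h = cong₂ _∷_ (countGE-hit [] (h 0 z<s)) (go m n (<⇒≤ m≤) (f ∘ suc) (λ j p → h (suc j) (s≤s p)))

conj-column : ∀ n → conj (replicate (suc n) 1) ≡ suc n ∷ []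
conj-column n = cong (_∷ []) (go (suc n))
  where
  go : ∀ n → countGE 1 (replicate n 1) ≡ n
  go zero = refl
  go (suc n) = cong suc (go n)

all-ones : ∀ {ps} → Partition ps → head0 ps ≤ 1 → ps ≡ replicate (sum ps) 1
all-ones [] _ = refl
all-ones {suc zero ∷ ps} (cons _ h d) _ = cong (1 ∷_) (all-ones d h)
all-ones {suc (suc x) ∷ ps} (cons _ _ _) (s≤s ())

large-trivial : ∀ {n λ′} → 12 ≤ n → Partition λ′ → sum λ′ ≡ n → rowDefect (dp n (dyck λ′)) ≤ 9 →
  Trivial (dp n (dyck λ′)) × Trivial (dp n (dyck (conj λ′)))
large-trivial () [] refl _
large-trivial {λ′ = suc a ∷ []} 12≤ p refl small rewrite +-identityʳ a =
  row-trivial (suc a) , subst (λ l → Trivial (dp (suc a) (dyck l))) (sym (conj-row (suc a))) (column-trivial (suc a))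
large-trivial {λ′ = suc zero ∷ ps@(_ ∷ _)} 12≤ p refl small =
  subst (λ l → Trivial (dp n (dyck l)) × Trivial (dp n (dyck (conj l)))) (sym (all-ones p ≤-refl))
    (column-trivial n , subst (λ l → Trivial (dp n (dyck l))) (sym (conj-column (sum ps))) (row-trivial n))
  where n = suc (sum ps)
large-trivial {λ′ = suc (suc a) ∷ suc b ∷ ps} 12≤ p refl small =
  -- With first part a + 2 and q + 1 cells below it, n ≥ 12 gives a + q + 1 ≥ 10. The defect is at
  -- least (q + 1)(a + 1), which is no smaller than this sum: hence the constant 12 for defects up
  -- to 9.
  ⊥-elim (<⇒≱ (≤-trans (≤-trans (≤-pred (≤-pred 12≤)) (product-bound a (b + sum ps))) (defect-bound p)) small)
  where
  product-bound : ∀ a q → a + suc q ≤ suc q * suc a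
  product-bound a q = ≤-trans (m≤m+n (a + suc q) (q * a)) (≤-reflexive (re a q))
    where
    re : ∀ a q → (a + suc q) + q * a ≡ suc q * suc a
    re = solve-∀
large-trivial {λ′ = suc (suc a) ∷ zero ∷ ps} 12≤ (cons _ _ (cons () _ _)) refl small

-- The chains and their finite verification

-- (μ , μ* , the initial partitions of the ν-orbits that make up 𝒞 μ, by increasing dinv); the last one is γ_μ.
Entry : Set
Entry = List ℕ × List ℕ × List (List ℕ)

-- Found by an exact-cover search over all ways to concatenate the finite ν-orbits with the ν-tails.
table : ℕ → List Entry
table 0 = ([] , [] , [] ∷ []) ∷ []
table 1 =
  ((1 ∷ []) , (1 ∷ []) ,
    (1 ∷ 1 ∷ []) ∷ []) ∷ []
table 2 =
  ((2 ∷ []) , (2 ∷ []) ,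
    (1 ∷ 1 ∷ 1 ∷ []) ∷ (2 ∷ 2 ∷ 1 ∷ []) ∷ []) ∷
  ((1 ∷ 1 ∷ []) , (1 ∷ 1 ∷ []) ,
    (2 ∷ 1 ∷ 1 ∷ []) ∷ []) ∷ []
table 3 =
  ((3 ∷ []) , (3 ∷ []) ,
    (1 ∷ 1 ∷ 1 ∷ 1 ∷ []) ∷ (2 ∷ 2 ∷ 2 ∷ []) ∷ (3 ∷ 3 ∷ 2 ∷ 1 ∷ []) ∷ []) ∷
  ((2 ∷ 1 ∷ []) , (1 ∷ 1 ∷ 1 ∷ []) ,
    (3 ∷ 1 ∷ 1 ∷ 1 ∷ []) ∷ (3 ∷ 3 ∷ 1 ∷ 1 ∷ []) ∷ []) ∷
  ((1 ∷ 1 ∷ 1 ∷ []) , (2 ∷ 1 ∷ []) ,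
    (2 ∷ 1 ∷ 1 ∷ 1 ∷ []) ∷ (3 ∷ 2 ∷ 1 ∷ 1 ∷ []) ∷ []) ∷ []
table 4 =
  ((4 ∷ []) , (4 ∷ []) ,
    (1 ∷ 1 ∷ 1 ∷ 1 ∷ 1 ∷ []) ∷ (2 ∷ 2 ∷ 2 ∷ 1 ∷ []) ∷ (3 ∷ 3 ∷ 3 ∷ 1 ∷ []) ∷ (4 ∷ 4 ∷ 3 ∷ 2 ∷ 1 ∷ []) ∷ []) ∷
  ((3 ∷ 1 ∷ []) , (2 ∷ 2 ∷ []) ,
    (2 ∷ 2 ∷ 1 ∷ 1 ∷ []) ∷ (4 ∷ 4 ∷ 3 ∷ 1 ∷ 1 ∷ []) ∷ []) ∷
  ((2 ∷ 2 ∷ []) , (3 ∷ 1 ∷ []) ,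
    (2 ∷ 1 ∷ 1 ∷ 1 ∷ 1 ∷ []) ∷ (3 ∷ 2 ∷ 2 ∷ 1 ∷ []) ∷ []) ∷
  ((2 ∷ 1 ∷ 1 ∷ []) , (1 ∷ 1 ∷ 1 ∷ 1 ∷ []) ,
    (3 ∷ 2 ∷ 1 ∷ 1 ∷ 1 ∷ []) ∷ (4 ∷ 3 ∷ 1 ∷ 1 ∷ 1 ∷ []) ∷ (4 ∷ 4 ∷ 2 ∷ 1 ∷ 1 ∷ []) ∷ []) ∷
  ((1 ∷ 1 ∷ 1 ∷ 1 ∷ []) , (2 ∷ 1 ∷ 1 ∷ []) ,
    (3 ∷ 1 ∷ 1 ∷ 1 ∷ 1 ∷ []) ∷ (4 ∷ 2 ∷ 1 ∷ 1 ∷ 1 ∷ []) ∷ (4 ∷ 3 ∷ 2 ∷ 1 ∷ 1 ∷ []) ∷ []) ∷ []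
table 5 =
  ((5 ∷ []) , (5 ∷ []) ,
    (1 ∷ 1 ∷ 1 ∷ 1 ∷ 1 ∷ 1 ∷ []) ∷ (2 ∷ 2 ∷ 2 ∷ 2 ∷ []) ∷ (3 ∷ 3 ∷ 3 ∷ 2 ∷ []) ∷ (4 ∷ 4 ∷ 4 ∷ 2 ∷ 1 ∷ []) ∷
    (5 ∷ 5 ∷ 4 ∷ 3 ∷ 2 ∷ 1 ∷ []) ∷ []) ∷
  ((4 ∷ 1 ∷ []) , (2 ∷ 2 ∷ 1 ∷ []) ,
    (4 ∷ 1 ∷ 1 ∷ 1 ∷ 1 ∷ []) ∷ (3 ∷ 3 ∷ 2 ∷ 2 ∷ []) ∷ (5 ∷ 5 ∷ 4 ∷ 3 ∷ 1 ∷ 1 ∷ []) ∷ []) ∷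
  ((3 ∷ 2 ∷ []) , (3 ∷ 2 ∷ []) ,
    (2 ∷ 2 ∷ 1 ∷ 1 ∷ 1 ∷ []) ∷ (3 ∷ 3 ∷ 1 ∷ 1 ∷ 1 ∷ []) ∷ (4 ∷ 4 ∷ 1 ∷ 1 ∷ 1 ∷ []) ∷
    (4 ∷ 4 ∷ 2 ∷ 2 ∷ 1 ∷ []) ∷ []) ∷
  ((3 ∷ 1 ∷ 1 ∷ []) , (3 ∷ 1 ∷ 1 ∷ []) ,
    (3 ∷ 1 ∷ 1 ∷ 1 ∷ 1 ∷ 1 ∷ []) ∷ (4 ∷ 2 ∷ 2 ∷ 1 ∷ 1 ∷ []) ∷ (5 ∷ 5 ∷ 4 ∷ 2 ∷ 1 ∷ 1 ∷ []) ∷ []) ∷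
  ((2 ∷ 2 ∷ 1 ∷ []) , (4 ∷ 1 ∷ []) ,
    (2 ∷ 1 ∷ 1 ∷ 1 ∷ 1 ∷ 1 ∷ []) ∷ (3 ∷ 2 ∷ 2 ∷ 2 ∷ []) ∷ (4 ∷ 3 ∷ 3 ∷ 1 ∷ 1 ∷ []) ∷ []) ∷
  ((2 ∷ 1 ∷ 1 ∷ 1 ∷ []) , (2 ∷ 1 ∷ 1 ∷ 1 ∷ []) ,
    (3 ∷ 2 ∷ 1 ∷ 1 ∷ 1 ∷ 1 ∷ []) ∷ (4 ∷ 3 ∷ 1 ∷ 1 ∷ 1 ∷ 1 ∷ []) ∷ (5 ∷ 3 ∷ 2 ∷ 1 ∷ 1 ∷ 1 ∷ []) ∷
    (5 ∷ 4 ∷ 3 ∷ 1 ∷ 1 ∷ 1 ∷ []) ∷ (5 ∷ 5 ∷ 3 ∷ 2 ∷ 1 ∷ 1 ∷ []) ∷ []) ∷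
  ((1 ∷ 1 ∷ 1 ∷ 1 ∷ 1 ∷ []) , (1 ∷ 1 ∷ 1 ∷ 1 ∷ 1 ∷ []) ,
    (4 ∷ 2 ∷ 1 ∷ 1 ∷ 1 ∷ 1 ∷ []) ∷ (4 ∷ 3 ∷ 2 ∷ 1 ∷ 1 ∷ 1 ∷ []) ∷ (5 ∷ 4 ∷ 2 ∷ 1 ∷ 1 ∷ 1 ∷ []) ∷
    (5 ∷ 4 ∷ 3 ∷ 2 ∷ 1 ∷ 1 ∷ []) ∷ []) ∷ []
table 6 =
  ((6 ∷ []) , (6 ∷ []) ,
    (1 ∷ 1 ∷ 1 ∷ 1 ∷ 1 ∷ 1 ∷ 1 ∷ []) ∷ (2 ∷ 2 ∷ 2 ∷ 2 ∷ 1 ∷ []) ∷ (3 ∷ 3 ∷ 3 ∷ 2 ∷ 1 ∷ []) ∷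
    (4 ∷ 4 ∷ 4 ∷ 3 ∷ 1 ∷ []) ∷ (5 ∷ 5 ∷ 5 ∷ 3 ∷ 2 ∷ 1 ∷ []) ∷ (6 ∷ 6 ∷ 5 ∷ 4 ∷ 3 ∷ 2 ∷ 1 ∷ []) ∷ []) ∷
  ((5 ∷ 1 ∷ []) , (3 ∷ 3 ∷ []) ,
    (2 ∷ 2 ∷ 2 ∷ 1 ∷ 1 ∷ []) ∷ (3 ∷ 3 ∷ 3 ∷ 1 ∷ 1 ∷ []) ∷ (4 ∷ 4 ∷ 3 ∷ 3 ∷ 1 ∷ []) ∷
    (6 ∷ 6 ∷ 5 ∷ 4 ∷ 3 ∷ 1 ∷ 1 ∷ []) ∷ []) ∷
  ((4 ∷ 2 ∷ []) , (4 ∷ 1 ∷ 1 ∷ []) ,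
    (3 ∷ 1 ∷ 1 ∷ 1 ∷ 1 ∷ 1 ∷ 1 ∷ []) ∷ (4 ∷ 2 ∷ 2 ∷ 2 ∷ 1 ∷ []) ∷ (4 ∷ 4 ∷ 4 ∷ 1 ∷ 1 ∷ []) ∷
    (5 ∷ 5 ∷ 4 ∷ 2 ∷ 2 ∷ 1 ∷ []) ∷ []) ∷
  ((4 ∷ 1 ∷ 1 ∷ []) , (4 ∷ 2 ∷ []) ,
    (2 ∷ 2 ∷ 1 ∷ 1 ∷ 1 ∷ 1 ∷ []) ∷ (3 ∷ 3 ∷ 2 ∷ 1 ∷ 1 ∷ []) ∷ (6 ∷ 6 ∷ 5 ∷ 4 ∷ 2 ∷ 1 ∷ 1 ∷ []) ∷ []) ∷
  ((3 ∷ 3 ∷ []) , (5 ∷ 1 ∷ []) ,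
    (2 ∷ 1 ∷ 1 ∷ 1 ∷ 1 ∷ 1 ∷ 1 ∷ []) ∷ (3 ∷ 2 ∷ 2 ∷ 2 ∷ 1 ∷ []) ∷ (4 ∷ 3 ∷ 3 ∷ 2 ∷ 1 ∷ []) ∷ []) ∷
  ((3 ∷ 2 ∷ 1 ∷ []) , (3 ∷ 1 ∷ 1 ∷ 1 ∷ []) ,
    (3 ∷ 2 ∷ 1 ∷ 1 ∷ 1 ∷ 1 ∷ 1 ∷ []) ∷ (5 ∷ 3 ∷ 1 ∷ 1 ∷ 1 ∷ 1 ∷ []) ∷ (5 ∷ 3 ∷ 3 ∷ 1 ∷ 1 ∷ 1 ∷ []) ∷
    (5 ∷ 5 ∷ 3 ∷ 1 ∷ 1 ∷ 1 ∷ []) ∷ (5 ∷ 5 ∷ 3 ∷ 3 ∷ 1 ∷ 1 ∷ []) ∷ []) ∷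
  ((3 ∷ 1 ∷ 1 ∷ 1 ∷ []) , (3 ∷ 2 ∷ 1 ∷ []) ,
    (4 ∷ 1 ∷ 1 ∷ 1 ∷ 1 ∷ 1 ∷ []) ∷ (4 ∷ 2 ∷ 2 ∷ 1 ∷ 1 ∷ 1 ∷ []) ∷ (4 ∷ 4 ∷ 2 ∷ 1 ∷ 1 ∷ 1 ∷ []) ∷
    (5 ∷ 4 ∷ 2 ∷ 2 ∷ 1 ∷ 1 ∷ []) ∷ (6 ∷ 6 ∷ 5 ∷ 3 ∷ 2 ∷ 1 ∷ 1 ∷ []) ∷ []) ∷
  ((2 ∷ 2 ∷ 2 ∷ []) , (2 ∷ 2 ∷ 1 ∷ 1 ∷ []) ,
    (3 ∷ 3 ∷ 1 ∷ 1 ∷ 1 ∷ 1 ∷ []) ∷ (4 ∷ 3 ∷ 2 ∷ 2 ∷ 1 ∷ []) ∷ []) ∷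
  ((2 ∷ 2 ∷ 1 ∷ 1 ∷ []) , (2 ∷ 2 ∷ 2 ∷ []) ,
    (3 ∷ 2 ∷ 2 ∷ 1 ∷ 1 ∷ []) ∷ (5 ∷ 4 ∷ 4 ∷ 2 ∷ 1 ∷ 1 ∷ []) ∷ []) ∷
  ((2 ∷ 1 ∷ 1 ∷ 1 ∷ 1 ∷ []) , (2 ∷ 1 ∷ 1 ∷ 1 ∷ 1 ∷ []) ,
    (4 ∷ 2 ∷ 1 ∷ 1 ∷ 1 ∷ 1 ∷ 1 ∷ []) ∷ (4 ∷ 3 ∷ 2 ∷ 1 ∷ 1 ∷ 1 ∷ 1 ∷ []) ∷ (5 ∷ 4 ∷ 2 ∷ 1 ∷ 1 ∷ 1 ∷ 1 ∷ []) ∷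
    (5 ∷ 4 ∷ 3 ∷ 2 ∷ 1 ∷ 1 ∷ 1 ∷ []) ∷ (6 ∷ 5 ∷ 3 ∷ 2 ∷ 1 ∷ 1 ∷ 1 ∷ []) ∷ (6 ∷ 5 ∷ 4 ∷ 3 ∷ 1 ∷ 1 ∷ 1 ∷ []) ∷
    (6 ∷ 6 ∷ 4 ∷ 3 ∷ 2 ∷ 1 ∷ 1 ∷ []) ∷ []) ∷
  ((1 ∷ 1 ∷ 1 ∷ 1 ∷ 1 ∷ 1 ∷ []) , (1 ∷ 1 ∷ 1 ∷ 1 ∷ 1 ∷ 1 ∷ []) ,
    (4 ∷ 3 ∷ 1 ∷ 1 ∷ 1 ∷ 1 ∷ 1 ∷ []) ∷ (5 ∷ 3 ∷ 2 ∷ 1 ∷ 1 ∷ 1 ∷ 1 ∷ []) ∷ (5 ∷ 4 ∷ 3 ∷ 1 ∷ 1 ∷ 1 ∷ 1 ∷ []) ∷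
    (6 ∷ 4 ∷ 3 ∷ 2 ∷ 1 ∷ 1 ∷ 1 ∷ []) ∷ (6 ∷ 5 ∷ 4 ∷ 2 ∷ 1 ∷ 1 ∷ 1 ∷ []) ∷ (6 ∷ 5 ∷ 4 ∷ 3 ∷ 2 ∷ 1 ∷ 1 ∷ []) ∷
    []) ∷ []
table 7 =
  ((7 ∷ []) , (7 ∷ []) ,
    (1 ∷ 1 ∷ 1 ∷ 1 ∷ 1 ∷ 1 ∷ 1 ∷ 1 ∷ []) ∷ (2 ∷ 2 ∷ 2 ∷ 2 ∷ 2 ∷ []) ∷ (3 ∷ 3 ∷ 3 ∷ 3 ∷ 1 ∷ []) ∷
    (4 ∷ 4 ∷ 4 ∷ 3 ∷ 2 ∷ []) ∷ (5 ∷ 5 ∷ 5 ∷ 4 ∷ 2 ∷ 1 ∷ []) ∷ (6 ∷ 6 ∷ 6 ∷ 4 ∷ 3 ∷ 2 ∷ 1 ∷ []) ∷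
    (7 ∷ 7 ∷ 6 ∷ 5 ∷ 4 ∷ 3 ∷ 2 ∷ 1 ∷ []) ∷ []) ∷
  ((6 ∷ 1 ∷ []) , (6 ∷ 1 ∷ []) ,
    (2 ∷ 1 ∷ 1 ∷ 1 ∷ 1 ∷ 1 ∷ 1 ∷ 1 ∷ []) ∷ (3 ∷ 2 ∷ 2 ∷ 2 ∷ 2 ∷ []) ∷ (4 ∷ 4 ∷ 3 ∷ 1 ∷ 1 ∷ 1 ∷ []) ∷
    (4 ∷ 4 ∷ 4 ∷ 2 ∷ 2 ∷ []) ∷ (5 ∷ 5 ∷ 4 ∷ 4 ∷ 2 ∷ 1 ∷ []) ∷ (7 ∷ 7 ∷ 6 ∷ 5 ∷ 4 ∷ 3 ∷ 1 ∷ 1 ∷ []) ∷ []) ∷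
  ((5 ∷ 2 ∷ []) , (5 ∷ 2 ∷ []) ,
    (2 ∷ 2 ∷ 1 ∷ 1 ∷ 1 ∷ 1 ∷ 1 ∷ []) ∷ (3 ∷ 3 ∷ 2 ∷ 2 ∷ 1 ∷ []) ∷ (5 ∷ 5 ∷ 5 ∷ 3 ∷ 1 ∷ 1 ∷ []) ∷
    (6 ∷ 6 ∷ 5 ∷ 4 ∷ 2 ∷ 2 ∷ 1 ∷ []) ∷ []) ∷
  ((5 ∷ 1 ∷ 1 ∷ []) , (4 ∷ 3 ∷ []) ,
    (2 ∷ 2 ∷ 2 ∷ 1 ∷ 1 ∷ 1 ∷ []) ∷ (5 ∷ 2 ∷ 1 ∷ 1 ∷ 1 ∷ 1 ∷ []) ∷ (4 ∷ 3 ∷ 3 ∷ 1 ∷ 1 ∷ 1 ∷ []) ∷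
    (4 ∷ 4 ∷ 3 ∷ 2 ∷ 2 ∷ []) ∷ (7 ∷ 7 ∷ 6 ∷ 5 ∷ 4 ∷ 2 ∷ 1 ∷ 1 ∷ []) ∷ []) ∷
  ((4 ∷ 3 ∷ []) , (5 ∷ 1 ∷ 1 ∷ []) ,
    (3 ∷ 1 ∷ 1 ∷ 1 ∷ 1 ∷ 1 ∷ 1 ∷ 1 ∷ []) ∷ (4 ∷ 2 ∷ 2 ∷ 2 ∷ 2 ∷ []) ∷ (5 ∷ 5 ∷ 2 ∷ 1 ∷ 1 ∷ 1 ∷ []) ∷
    (5 ∷ 5 ∷ 4 ∷ 1 ∷ 1 ∷ 1 ∷ []) ∷ (5 ∷ 5 ∷ 3 ∷ 3 ∷ 2 ∷ 1 ∷ []) ∷ []) ∷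
  ((4 ∷ 2 ∷ 1 ∷ []) , (3 ∷ 3 ∷ 1 ∷ []) ,
    (5 ∷ 1 ∷ 1 ∷ 1 ∷ 1 ∷ 1 ∷ []) ∷ (3 ∷ 3 ∷ 3 ∷ 3 ∷ []) ∷ (5 ∷ 5 ∷ 2 ∷ 2 ∷ 1 ∷ 1 ∷ []) ∷
    (6 ∷ 6 ∷ 5 ∷ 3 ∷ 3 ∷ 1 ∷ 1 ∷ []) ∷ []) ∷
  ((4 ∷ 1 ∷ 1 ∷ 1 ∷ []) , (4 ∷ 1 ∷ 1 ∷ 1 ∷ []) ,
    (3 ∷ 2 ∷ 1 ∷ 1 ∷ 1 ∷ 1 ∷ 1 ∷ 1 ∷ []) ∷ (5 ∷ 4 ∷ 1 ∷ 1 ∷ 1 ∷ 1 ∷ []) ∷ (5 ∷ 3 ∷ 3 ∷ 2 ∷ 1 ∷ 1 ∷ []) ∷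
    (7 ∷ 7 ∷ 6 ∷ 5 ∷ 3 ∷ 2 ∷ 1 ∷ 1 ∷ []) ∷ []) ∷
  ((3 ∷ 3 ∷ 1 ∷ []) , (4 ∷ 2 ∷ 1 ∷ []) ,
    (4 ∷ 1 ∷ 1 ∷ 1 ∷ 1 ∷ 1 ∷ 1 ∷ []) ∷ (4 ∷ 4 ∷ 1 ∷ 1 ∷ 1 ∷ 1 ∷ []) ∷ (4 ∷ 3 ∷ 3 ∷ 3 ∷ 1 ∷ []) ∷
    (5 ∷ 4 ∷ 4 ∷ 3 ∷ 1 ∷ 1 ∷ []) ∷ []) ∷
  ((3 ∷ 2 ∷ 2 ∷ []) , (2 ∷ 2 ∷ 2 ∷ 1 ∷ []) ,
    (3 ∷ 3 ∷ 2 ∷ 1 ∷ 1 ∷ 1 ∷ []) ∷ (4 ∷ 3 ∷ 2 ∷ 2 ∷ 2 ∷ []) ∷ (5 ∷ 4 ∷ 4 ∷ 1 ∷ 1 ∷ 1 ∷ []) ∷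
    (5 ∷ 5 ∷ 3 ∷ 2 ∷ 2 ∷ 1 ∷ []) ∷ []) ∷
  ((3 ∷ 2 ∷ 1 ∷ 1 ∷ []) , (3 ∷ 1 ∷ 1 ∷ 1 ∷ 1 ∷ []) ,
    (4 ∷ 2 ∷ 1 ∷ 1 ∷ 1 ∷ 1 ∷ 1 ∷ 1 ∷ []) ∷ (4 ∷ 4 ∷ 2 ∷ 1 ∷ 1 ∷ 1 ∷ 1 ∷ []) ∷
    (5 ∷ 4 ∷ 2 ∷ 2 ∷ 1 ∷ 1 ∷ 1 ∷ []) ∷ (5 ∷ 5 ∷ 3 ∷ 2 ∷ 1 ∷ 1 ∷ 1 ∷ []) ∷ (6 ∷ 5 ∷ 3 ∷ 3 ∷ 1 ∷ 1 ∷ 1 ∷ []) ∷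
    (6 ∷ 6 ∷ 4 ∷ 3 ∷ 1 ∷ 1 ∷ 1 ∷ []) ∷ (6 ∷ 6 ∷ 4 ∷ 4 ∷ 2 ∷ 1 ∷ 1 ∷ []) ∷ []) ∷
  ((3 ∷ 1 ∷ 1 ∷ 1 ∷ 1 ∷ []) , (3 ∷ 2 ∷ 1 ∷ 1 ∷ []) ,
    (3 ∷ 3 ∷ 1 ∷ 1 ∷ 1 ∷ 1 ∷ 1 ∷ []) ∷ (5 ∷ 3 ∷ 1 ∷ 1 ∷ 1 ∷ 1 ∷ 1 ∷ []) ∷ (5 ∷ 3 ∷ 3 ∷ 1 ∷ 1 ∷ 1 ∷ 1 ∷ []) ∷
    (6 ∷ 4 ∷ 3 ∷ 1 ∷ 1 ∷ 1 ∷ 1 ∷ []) ∷ (6 ∷ 4 ∷ 4 ∷ 2 ∷ 1 ∷ 1 ∷ 1 ∷ []) ∷ (6 ∷ 5 ∷ 4 ∷ 2 ∷ 2 ∷ 1 ∷ 1 ∷ []) ∷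
    (7 ∷ 7 ∷ 6 ∷ 4 ∷ 3 ∷ 2 ∷ 1 ∷ 1 ∷ []) ∷ []) ∷
  ((2 ∷ 2 ∷ 2 ∷ 1 ∷ []) , (3 ∷ 2 ∷ 2 ∷ []) ,
    (3 ∷ 2 ∷ 2 ∷ 1 ∷ 1 ∷ 1 ∷ []) ∷ (5 ∷ 2 ∷ 2 ∷ 1 ∷ 1 ∷ 1 ∷ []) ∷ (4 ∷ 4 ∷ 2 ∷ 2 ∷ 2 ∷ []) ∷
    (5 ∷ 4 ∷ 3 ∷ 3 ∷ 1 ∷ 1 ∷ []) ∷ []) ∷
  ((2 ∷ 2 ∷ 1 ∷ 1 ∷ 1 ∷ []) , (2 ∷ 2 ∷ 1 ∷ 1 ∷ 1 ∷ []) ,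
    (4 ∷ 2 ∷ 2 ∷ 1 ∷ 1 ∷ 1 ∷ 1 ∷ []) ∷ (5 ∷ 3 ∷ 2 ∷ 2 ∷ 1 ∷ 1 ∷ []) ∷ (6 ∷ 5 ∷ 5 ∷ 3 ∷ 2 ∷ 1 ∷ 1 ∷ []) ∷ []) ∷
  ((2 ∷ 1 ∷ 1 ∷ 1 ∷ 1 ∷ 1 ∷ []) , (1 ∷ 1 ∷ 1 ∷ 1 ∷ 1 ∷ 1 ∷ 1 ∷ []) ,
    (4 ∷ 3 ∷ 2 ∷ 1 ∷ 1 ∷ 1 ∷ 1 ∷ 1 ∷ []) ∷ (5 ∷ 4 ∷ 2 ∷ 1 ∷ 1 ∷ 1 ∷ 1 ∷ 1 ∷ []) ∷
    (5 ∷ 4 ∷ 3 ∷ 2 ∷ 1 ∷ 1 ∷ 1 ∷ 1 ∷ []) ∷ (6 ∷ 5 ∷ 3 ∷ 2 ∷ 1 ∷ 1 ∷ 1 ∷ 1 ∷ []) ∷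
    (6 ∷ 5 ∷ 4 ∷ 3 ∷ 1 ∷ 1 ∷ 1 ∷ 1 ∷ []) ∷ (7 ∷ 5 ∷ 4 ∷ 3 ∷ 2 ∷ 1 ∷ 1 ∷ 1 ∷ []) ∷
    (7 ∷ 6 ∷ 5 ∷ 3 ∷ 2 ∷ 1 ∷ 1 ∷ 1 ∷ []) ∷ (7 ∷ 6 ∷ 5 ∷ 4 ∷ 3 ∷ 1 ∷ 1 ∷ 1 ∷ []) ∷
    (7 ∷ 7 ∷ 5 ∷ 4 ∷ 3 ∷ 2 ∷ 1 ∷ 1 ∷ []) ∷ []) ∷
  ((1 ∷ 1 ∷ 1 ∷ 1 ∷ 1 ∷ 1 ∷ 1 ∷ []) , (2 ∷ 1 ∷ 1 ∷ 1 ∷ 1 ∷ 1 ∷ []) ,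
    (4 ∷ 3 ∷ 1 ∷ 1 ∷ 1 ∷ 1 ∷ 1 ∷ 1 ∷ []) ∷ (5 ∷ 3 ∷ 2 ∷ 1 ∷ 1 ∷ 1 ∷ 1 ∷ 1 ∷ []) ∷
    (5 ∷ 4 ∷ 3 ∷ 1 ∷ 1 ∷ 1 ∷ 1 ∷ 1 ∷ []) ∷ (6 ∷ 4 ∷ 3 ∷ 2 ∷ 1 ∷ 1 ∷ 1 ∷ 1 ∷ []) ∷
    (6 ∷ 5 ∷ 4 ∷ 2 ∷ 1 ∷ 1 ∷ 1 ∷ 1 ∷ []) ∷ (6 ∷ 5 ∷ 4 ∷ 3 ∷ 2 ∷ 1 ∷ 1 ∷ 1 ∷ []) ∷
    (7 ∷ 6 ∷ 4 ∷ 3 ∷ 2 ∷ 1 ∷ 1 ∷ 1 ∷ []) ∷ (7 ∷ 6 ∷ 5 ∷ 4 ∷ 2 ∷ 1 ∷ 1 ∷ 1 ∷ []) ∷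
    (7 ∷ 6 ∷ 5 ∷ 4 ∷ 3 ∷ 2 ∷ 1 ∷ 1 ∷ []) ∷ []) ∷ []
table 8 =
  ((8 ∷ []) , (6 ∷ 2 ∷ []) ,
    (2 ∷ 2 ∷ 1 ∷ 1 ∷ 1 ∷ 1 ∷ 1 ∷ 1 ∷ []) ∷ (3 ∷ 3 ∷ 2 ∷ 2 ∷ 2 ∷ []) ∷ (5 ∷ 3 ∷ 2 ∷ 2 ∷ 2 ∷ 1 ∷ []) ∷
    (4 ∷ 4 ∷ 4 ∷ 3 ∷ 2 ∷ 1 ∷ []) ∷ (5 ∷ 5 ∷ 5 ∷ 4 ∷ 3 ∷ 1 ∷ []) ∷ (6 ∷ 6 ∷ 6 ∷ 5 ∷ 3 ∷ 2 ∷ 1 ∷ []) ∷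
    (7 ∷ 7 ∷ 7 ∷ 5 ∷ 4 ∷ 3 ∷ 2 ∷ 1 ∷ []) ∷ (8 ∷ 8 ∷ 7 ∷ 6 ∷ 5 ∷ 4 ∷ 3 ∷ 2 ∷ 1 ∷ []) ∷ []) ∷
  ((7 ∷ 1 ∷ []) , (5 ∷ 3 ∷ []) ,
    (2 ∷ 2 ∷ 2 ∷ 1 ∷ 1 ∷ 1 ∷ 1 ∷ []) ∷ (4 ∷ 2 ∷ 2 ∷ 2 ∷ 1 ∷ 1 ∷ []) ∷ (4 ∷ 4 ∷ 4 ∷ 1 ∷ 1 ∷ 1 ∷ []) ∷
    (4 ∷ 4 ∷ 4 ∷ 3 ∷ 1 ∷ 1 ∷ []) ∷ (5 ∷ 5 ∷ 5 ∷ 3 ∷ 3 ∷ 1 ∷ []) ∷ (6 ∷ 6 ∷ 5 ∷ 5 ∷ 3 ∷ 2 ∷ 1 ∷ []) ∷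
    (8 ∷ 8 ∷ 7 ∷ 6 ∷ 5 ∷ 4 ∷ 3 ∷ 1 ∷ 1 ∷ []) ∷ []) ∷
  ((6 ∷ 2 ∷ []) , (8 ∷ []) ,
    (1 ∷ 1 ∷ 1 ∷ 1 ∷ 1 ∷ 1 ∷ 1 ∷ 1 ∷ 1 ∷ []) ∷ (2 ∷ 2 ∷ 2 ∷ 2 ∷ 2 ∷ 1 ∷ []) ∷ (5 ∷ 5 ∷ 1 ∷ 1 ∷ 1 ∷ 1 ∷ []) ∷
    (4 ∷ 4 ∷ 3 ∷ 3 ∷ 2 ∷ []) ∷ (6 ∷ 6 ∷ 6 ∷ 4 ∷ 3 ∷ 1 ∷ 1 ∷ []) ∷ (7 ∷ 7 ∷ 6 ∷ 5 ∷ 4 ∷ 2 ∷ 2 ∷ 1 ∷ []) ∷ []) ∷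
  ((6 ∷ 1 ∷ 1 ∷ []) , (6 ∷ 1 ∷ 1 ∷ []) ,
    (3 ∷ 1 ∷ 1 ∷ 1 ∷ 1 ∷ 1 ∷ 1 ∷ 1 ∷ 1 ∷ []) ∷ (4 ∷ 2 ∷ 2 ∷ 2 ∷ 2 ∷ 1 ∷ []) ∷ (4 ∷ 4 ∷ 4 ∷ 2 ∷ 1 ∷ 1 ∷ []) ∷
    (5 ∷ 5 ∷ 4 ∷ 3 ∷ 3 ∷ 1 ∷ []) ∷ (8 ∷ 8 ∷ 7 ∷ 6 ∷ 5 ∷ 4 ∷ 2 ∷ 1 ∷ 1 ∷ []) ∷ []) ∷
  ((5 ∷ 3 ∷ []) , (7 ∷ 1 ∷ []) ,
    (2 ∷ 1 ∷ 1 ∷ 1 ∷ 1 ∷ 1 ∷ 1 ∷ 1 ∷ 1 ∷ []) ∷ (3 ∷ 3 ∷ 3 ∷ 1 ∷ 1 ∷ 1 ∷ []) ∷ (4 ∷ 3 ∷ 2 ∷ 2 ∷ 2 ∷ 1 ∷ []) ∷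
    (5 ∷ 5 ∷ 2 ∷ 2 ∷ 2 ∷ 1 ∷ []) ∷ (5 ∷ 5 ∷ 5 ∷ 2 ∷ 2 ∷ 1 ∷ []) ∷ (6 ∷ 6 ∷ 5 ∷ 3 ∷ 3 ∷ 2 ∷ 1 ∷ []) ∷ []) ∷
  ((5 ∷ 2 ∷ 1 ∷ []) , (3 ∷ 2 ∷ 2 ∷ 1 ∷ []) ,
    (3 ∷ 3 ∷ 2 ∷ 1 ∷ 1 ∷ 1 ∷ 1 ∷ []) ∷ (5 ∷ 4 ∷ 1 ∷ 1 ∷ 1 ∷ 1 ∷ 1 ∷ []) ∷ (5 ∷ 3 ∷ 3 ∷ 3 ∷ 1 ∷ 1 ∷ []) ∷
    (5 ∷ 5 ∷ 4 ∷ 4 ∷ 1 ∷ 1 ∷ []) ∷ (7 ∷ 7 ∷ 6 ∷ 5 ∷ 3 ∷ 3 ∷ 1 ∷ 1 ∷ []) ∷ []) ∷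
  ((5 ∷ 1 ∷ 1 ∷ 1 ∷ []) , (4 ∷ 3 ∷ 1 ∷ []) ,
    (5 ∷ 1 ∷ 1 ∷ 1 ∷ 1 ∷ 1 ∷ 1 ∷ []) ∷ (4 ∷ 4 ∷ 1 ∷ 1 ∷ 1 ∷ 1 ∷ 1 ∷ []) ∷ (4 ∷ 4 ∷ 3 ∷ 2 ∷ 1 ∷ 1 ∷ []) ∷
    (8 ∷ 8 ∷ 7 ∷ 6 ∷ 5 ∷ 3 ∷ 2 ∷ 1 ∷ 1 ∷ []) ∷ []) ∷
  ((4 ∷ 4 ∷ []) , (2 ∷ 2 ∷ 2 ∷ 2 ∷ []) ,
    (3 ∷ 2 ∷ 2 ∷ 2 ∷ 2 ∷ 1 ∷ []) ∷ (4 ∷ 3 ∷ 3 ∷ 3 ∷ 2 ∷ []) ∷ (5 ∷ 4 ∷ 4 ∷ 3 ∷ 2 ∷ 1 ∷ []) ∷ []) ∷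
  ((4 ∷ 3 ∷ 1 ∷ []) , (5 ∷ 1 ∷ 1 ∷ 1 ∷ []) ,
    (3 ∷ 2 ∷ 1 ∷ 1 ∷ 1 ∷ 1 ∷ 1 ∷ 1 ∷ 1 ∷ []) ∷ (4 ∷ 4 ∷ 2 ∷ 2 ∷ 1 ∷ 1 ∷ []) ∷
    (6 ∷ 6 ∷ 5 ∷ 3 ∷ 1 ∷ 1 ∷ 1 ∷ []) ∷ (6 ∷ 6 ∷ 4 ∷ 4 ∷ 3 ∷ 1 ∷ 1 ∷ []) ∷ []) ∷
  ((4 ∷ 2 ∷ 2 ∷ []) , (4 ∷ 2 ∷ 2 ∷ []) ,
    (3 ∷ 2 ∷ 2 ∷ 1 ∷ 1 ∷ 1 ∷ 1 ∷ []) ∷ (5 ∷ 2 ∷ 2 ∷ 2 ∷ 1 ∷ 1 ∷ []) ∷ (5 ∷ 4 ∷ 2 ∷ 2 ∷ 2 ∷ 1 ∷ []) ∷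
    (5 ∷ 5 ∷ 5 ∷ 2 ∷ 1 ∷ 1 ∷ []) ∷ (6 ∷ 6 ∷ 5 ∷ 3 ∷ 2 ∷ 2 ∷ 1 ∷ []) ∷ []) ∷
  ((4 ∷ 2 ∷ 1 ∷ 1 ∷ []) , (4 ∷ 2 ∷ 1 ∷ 1 ∷ []) ,
    (3 ∷ 3 ∷ 1 ∷ 1 ∷ 1 ∷ 1 ∷ 1 ∷ 1 ∷ []) ∷ (4 ∷ 3 ∷ 3 ∷ 1 ∷ 1 ∷ 1 ∷ 1 ∷ []) ∷
    (6 ∷ 4 ∷ 2 ∷ 1 ∷ 1 ∷ 1 ∷ 1 ∷ []) ∷ (6 ∷ 5 ∷ 3 ∷ 1 ∷ 1 ∷ 1 ∷ 1 ∷ []) ∷ (6 ∷ 4 ∷ 4 ∷ 3 ∷ 1 ∷ 1 ∷ 1 ∷ []) ∷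
    (6 ∷ 6 ∷ 4 ∷ 2 ∷ 2 ∷ 1 ∷ 1 ∷ []) ∷ (7 ∷ 7 ∷ 6 ∷ 4 ∷ 4 ∷ 2 ∷ 1 ∷ 1 ∷ []) ∷ []) ∷
  ((4 ∷ 1 ∷ 1 ∷ 1 ∷ 1 ∷ []) , (4 ∷ 1 ∷ 1 ∷ 1 ∷ 1 ∷ []) ,
    (4 ∷ 2 ∷ 1 ∷ 1 ∷ 1 ∷ 1 ∷ 1 ∷ 1 ∷ 1 ∷ []) ∷ (4 ∷ 4 ∷ 3 ∷ 1 ∷ 1 ∷ 1 ∷ 1 ∷ []) ∷
    (6 ∷ 4 ∷ 2 ∷ 2 ∷ 1 ∷ 1 ∷ 1 ∷ []) ∷ (5 ∷ 5 ∷ 4 ∷ 2 ∷ 1 ∷ 1 ∷ 1 ∷ []) ∷ (6 ∷ 5 ∷ 3 ∷ 3 ∷ 2 ∷ 1 ∷ 1 ∷ []) ∷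
    (8 ∷ 8 ∷ 7 ∷ 6 ∷ 4 ∷ 3 ∷ 2 ∷ 1 ∷ 1 ∷ []) ∷ []) ∷
  ((3 ∷ 3 ∷ 2 ∷ []) , (3 ∷ 3 ∷ 2 ∷ []) ,
    (3 ∷ 2 ∷ 2 ∷ 2 ∷ 1 ∷ 1 ∷ []) ∷ (3 ∷ 3 ∷ 3 ∷ 3 ∷ 2 ∷ []) ∷ (5 ∷ 4 ∷ 4 ∷ 2 ∷ 2 ∷ 1 ∷ []) ∷ []) ∷
  ((3 ∷ 3 ∷ 1 ∷ 1 ∷ []) , (3 ∷ 3 ∷ 1 ∷ 1 ∷ []) ,
    (5 ∷ 2 ∷ 1 ∷ 1 ∷ 1 ∷ 1 ∷ 1 ∷ []) ∷ (4 ∷ 3 ∷ 3 ∷ 2 ∷ 2 ∷ []) ∷ (6 ∷ 5 ∷ 5 ∷ 4 ∷ 2 ∷ 1 ∷ 1 ∷ []) ∷ []) ∷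
  ((3 ∷ 2 ∷ 2 ∷ 1 ∷ []) , (5 ∷ 2 ∷ 1 ∷ []) ,
    (4 ∷ 1 ∷ 1 ∷ 1 ∷ 1 ∷ 1 ∷ 1 ∷ 1 ∷ []) ∷ (4 ∷ 3 ∷ 2 ∷ 2 ∷ 1 ∷ 1 ∷ []) ∷ (6 ∷ 5 ∷ 5 ∷ 3 ∷ 1 ∷ 1 ∷ 1 ∷ []) ∷
    (6 ∷ 6 ∷ 4 ∷ 3 ∷ 3 ∷ 1 ∷ 1 ∷ []) ∷ []) ∷
  ((3 ∷ 2 ∷ 1 ∷ 1 ∷ 1 ∷ []) , (3 ∷ 2 ∷ 1 ∷ 1 ∷ 1 ∷ []) ,
    (4 ∷ 2 ∷ 2 ∷ 1 ∷ 1 ∷ 1 ∷ 1 ∷ 1 ∷ []) ∷ (4 ∷ 4 ∷ 2 ∷ 1 ∷ 1 ∷ 1 ∷ 1 ∷ 1 ∷ []) ∷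
    (5 ∷ 4 ∷ 2 ∷ 2 ∷ 1 ∷ 1 ∷ 1 ∷ 1 ∷ []) ∷ (5 ∷ 5 ∷ 3 ∷ 2 ∷ 1 ∷ 1 ∷ 1 ∷ 1 ∷ []) ∷
    (6 ∷ 5 ∷ 3 ∷ 3 ∷ 1 ∷ 1 ∷ 1 ∷ 1 ∷ []) ∷ (7 ∷ 5 ∷ 4 ∷ 3 ∷ 1 ∷ 1 ∷ 1 ∷ 1 ∷ []) ∷
    (7 ∷ 5 ∷ 5 ∷ 3 ∷ 2 ∷ 1 ∷ 1 ∷ 1 ∷ []) ∷ (7 ∷ 6 ∷ 5 ∷ 3 ∷ 3 ∷ 1 ∷ 1 ∷ 1 ∷ []) ∷
    (7 ∷ 7 ∷ 5 ∷ 4 ∷ 3 ∷ 1 ∷ 1 ∷ 1 ∷ []) ∷ (7 ∷ 7 ∷ 5 ∷ 5 ∷ 3 ∷ 2 ∷ 1 ∷ 1 ∷ []) ∷ []) ∷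
  ((3 ∷ 1 ∷ 1 ∷ 1 ∷ 1 ∷ 1 ∷ []) , (3 ∷ 1 ∷ 1 ∷ 1 ∷ 1 ∷ 1 ∷ []) ,
    (4 ∷ 3 ∷ 1 ∷ 1 ∷ 1 ∷ 1 ∷ 1 ∷ 1 ∷ 1 ∷ []) ∷ (5 ∷ 3 ∷ 3 ∷ 1 ∷ 1 ∷ 1 ∷ 1 ∷ 1 ∷ []) ∷
    (6 ∷ 4 ∷ 3 ∷ 1 ∷ 1 ∷ 1 ∷ 1 ∷ 1 ∷ []) ∷ (6 ∷ 4 ∷ 4 ∷ 2 ∷ 1 ∷ 1 ∷ 1 ∷ 1 ∷ []) ∷
    (6 ∷ 5 ∷ 4 ∷ 2 ∷ 2 ∷ 1 ∷ 1 ∷ 1 ∷ []) ∷ (6 ∷ 6 ∷ 4 ∷ 3 ∷ 2 ∷ 1 ∷ 1 ∷ 1 ∷ []) ∷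
    (7 ∷ 6 ∷ 4 ∷ 4 ∷ 2 ∷ 1 ∷ 1 ∷ 1 ∷ []) ∷ (7 ∷ 6 ∷ 5 ∷ 4 ∷ 2 ∷ 2 ∷ 1 ∷ 1 ∷ []) ∷
    (8 ∷ 8 ∷ 7 ∷ 5 ∷ 4 ∷ 3 ∷ 2 ∷ 1 ∷ 1 ∷ []) ∷ []) ∷
  ((2 ∷ 2 ∷ 2 ∷ 2 ∷ []) , (4 ∷ 4 ∷ []) ,
    (2 ∷ 2 ∷ 2 ∷ 2 ∷ 1 ∷ 1 ∷ []) ∷ (3 ∷ 3 ∷ 3 ∷ 2 ∷ 2 ∷ []) ∷ (5 ∷ 4 ∷ 3 ∷ 2 ∷ 2 ∷ 1 ∷ []) ∷ []) ∷
  ((2 ∷ 2 ∷ 2 ∷ 1 ∷ 1 ∷ []) , (2 ∷ 2 ∷ 2 ∷ 1 ∷ 1 ∷ []) ,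
    (5 ∷ 2 ∷ 2 ∷ 1 ∷ 1 ∷ 1 ∷ 1 ∷ []) ∷ (5 ∷ 3 ∷ 2 ∷ 2 ∷ 1 ∷ 1 ∷ 1 ∷ []) ∷ (5 ∷ 5 ∷ 3 ∷ 1 ∷ 1 ∷ 1 ∷ 1 ∷ []) ∷
    (6 ∷ 4 ∷ 3 ∷ 3 ∷ 1 ∷ 1 ∷ 1 ∷ []) ∷ (6 ∷ 6 ∷ 4 ∷ 2 ∷ 1 ∷ 1 ∷ 1 ∷ []) ∷ (6 ∷ 5 ∷ 4 ∷ 4 ∷ 2 ∷ 1 ∷ 1 ∷ []) ∷
    []) ∷
  ((2 ∷ 2 ∷ 1 ∷ 1 ∷ 1 ∷ 1 ∷ []) , (2 ∷ 2 ∷ 1 ∷ 1 ∷ 1 ∷ 1 ∷ []) ,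
    (5 ∷ 3 ∷ 1 ∷ 1 ∷ 1 ∷ 1 ∷ 1 ∷ 1 ∷ []) ∷ (5 ∷ 3 ∷ 3 ∷ 2 ∷ 1 ∷ 1 ∷ 1 ∷ []) ∷
    (5 ∷ 4 ∷ 4 ∷ 2 ∷ 1 ∷ 1 ∷ 1 ∷ []) ∷ (6 ∷ 5 ∷ 3 ∷ 2 ∷ 2 ∷ 1 ∷ 1 ∷ []) ∷
    (7 ∷ 6 ∷ 6 ∷ 4 ∷ 3 ∷ 2 ∷ 1 ∷ 1 ∷ []) ∷ []) ∷
  ((2 ∷ 1 ∷ 1 ∷ 1 ∷ 1 ∷ 1 ∷ 1 ∷ []) , (1 ∷ 1 ∷ 1 ∷ 1 ∷ 1 ∷ 1 ∷ 1 ∷ 1 ∷ []) ,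
    (5 ∷ 3 ∷ 2 ∷ 1 ∷ 1 ∷ 1 ∷ 1 ∷ 1 ∷ 1 ∷ []) ∷ (5 ∷ 4 ∷ 3 ∷ 1 ∷ 1 ∷ 1 ∷ 1 ∷ 1 ∷ 1 ∷ []) ∷
    (6 ∷ 4 ∷ 3 ∷ 2 ∷ 1 ∷ 1 ∷ 1 ∷ 1 ∷ 1 ∷ []) ∷ (6 ∷ 5 ∷ 4 ∷ 2 ∷ 1 ∷ 1 ∷ 1 ∷ 1 ∷ 1 ∷ []) ∷
    (6 ∷ 5 ∷ 4 ∷ 3 ∷ 2 ∷ 1 ∷ 1 ∷ 1 ∷ 1 ∷ []) ∷ (7 ∷ 6 ∷ 4 ∷ 3 ∷ 2 ∷ 1 ∷ 1 ∷ 1 ∷ 1 ∷ []) ∷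
    (7 ∷ 6 ∷ 5 ∷ 4 ∷ 2 ∷ 1 ∷ 1 ∷ 1 ∷ 1 ∷ []) ∷ (7 ∷ 6 ∷ 5 ∷ 4 ∷ 3 ∷ 2 ∷ 1 ∷ 1 ∷ 1 ∷ []) ∷
    (8 ∷ 7 ∷ 5 ∷ 4 ∷ 3 ∷ 2 ∷ 1 ∷ 1 ∷ 1 ∷ []) ∷ (8 ∷ 7 ∷ 6 ∷ 5 ∷ 3 ∷ 2 ∷ 1 ∷ 1 ∷ 1 ∷ []) ∷
    (8 ∷ 7 ∷ 6 ∷ 5 ∷ 4 ∷ 3 ∷ 1 ∷ 1 ∷ 1 ∷ []) ∷ (8 ∷ 8 ∷ 6 ∷ 5 ∷ 4 ∷ 3 ∷ 2 ∷ 1 ∷ 1 ∷ []) ∷ []) ∷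
  ((1 ∷ 1 ∷ 1 ∷ 1 ∷ 1 ∷ 1 ∷ 1 ∷ 1 ∷ []) , (2 ∷ 1 ∷ 1 ∷ 1 ∷ 1 ∷ 1 ∷ 1 ∷ []) ,
    (4 ∷ 3 ∷ 2 ∷ 1 ∷ 1 ∷ 1 ∷ 1 ∷ 1 ∷ 1 ∷ []) ∷ (5 ∷ 4 ∷ 2 ∷ 1 ∷ 1 ∷ 1 ∷ 1 ∷ 1 ∷ 1 ∷ []) ∷
    (5 ∷ 4 ∷ 3 ∷ 2 ∷ 1 ∷ 1 ∷ 1 ∷ 1 ∷ 1 ∷ []) ∷ (6 ∷ 5 ∷ 3 ∷ 2 ∷ 1 ∷ 1 ∷ 1 ∷ 1 ∷ 1 ∷ []) ∷
    (6 ∷ 5 ∷ 4 ∷ 3 ∷ 1 ∷ 1 ∷ 1 ∷ 1 ∷ 1 ∷ []) ∷ (7 ∷ 5 ∷ 4 ∷ 3 ∷ 2 ∷ 1 ∷ 1 ∷ 1 ∷ 1 ∷ []) ∷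
    (7 ∷ 6 ∷ 5 ∷ 3 ∷ 2 ∷ 1 ∷ 1 ∷ 1 ∷ 1 ∷ []) ∷ (7 ∷ 6 ∷ 5 ∷ 4 ∷ 3 ∷ 1 ∷ 1 ∷ 1 ∷ 1 ∷ []) ∷
    (8 ∷ 6 ∷ 5 ∷ 4 ∷ 3 ∷ 2 ∷ 1 ∷ 1 ∷ 1 ∷ []) ∷ (8 ∷ 7 ∷ 6 ∷ 4 ∷ 3 ∷ 2 ∷ 1 ∷ 1 ∷ 1 ∷ []) ∷
    (8 ∷ 7 ∷ 6 ∷ 5 ∷ 4 ∷ 2 ∷ 1 ∷ 1 ∷ 1 ∷ []) ∷ (8 ∷ 7 ∷ 6 ∷ 5 ∷ 4 ∷ 3 ∷ 2 ∷ 1 ∷ 1 ∷ []) ∷ []) ∷ []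
table 9 =
  ((9 ∷ []) , (9 ∷ []) ,
    (1 ∷ 1 ∷ 1 ∷ 1 ∷ 1 ∷ 1 ∷ 1 ∷ 1 ∷ 1 ∷ 1 ∷ []) ∷ (2 ∷ 2 ∷ 2 ∷ 2 ∷ 2 ∷ 2 ∷ []) ∷
    (3 ∷ 3 ∷ 3 ∷ 3 ∷ 2 ∷ 1 ∷ []) ∷ (5 ∷ 4 ∷ 4 ∷ 4 ∷ 1 ∷ 1 ∷ []) ∷ (5 ∷ 5 ∷ 5 ∷ 4 ∷ 3 ∷ 2 ∷ []) ∷
    (6 ∷ 6 ∷ 6 ∷ 5 ∷ 4 ∷ 2 ∷ 1 ∷ []) ∷ (7 ∷ 7 ∷ 7 ∷ 6 ∷ 4 ∷ 3 ∷ 2 ∷ 1 ∷ []) ∷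
    (8 ∷ 8 ∷ 8 ∷ 6 ∷ 5 ∷ 4 ∷ 3 ∷ 2 ∷ 1 ∷ []) ∷ (9 ∷ 9 ∷ 8 ∷ 7 ∷ 6 ∷ 5 ∷ 4 ∷ 3 ∷ 2 ∷ 1 ∷ []) ∷ []) ∷
  ((8 ∷ 1 ∷ []) , (5 ∷ 2 ∷ 1 ∷ 1 ∷ []) ,
    (3 ∷ 3 ∷ 1 ∷ 1 ∷ 1 ∷ 1 ∷ 1 ∷ 1 ∷ 1 ∷ []) ∷ (6 ∷ 3 ∷ 2 ∷ 1 ∷ 1 ∷ 1 ∷ 1 ∷ []) ∷
    (5 ∷ 5 ∷ 2 ∷ 2 ∷ 1 ∷ 1 ∷ 1 ∷ []) ∷ (5 ∷ 5 ∷ 3 ∷ 3 ∷ 1 ∷ 1 ∷ 1 ∷ []) ∷ (6 ∷ 6 ∷ 3 ∷ 3 ∷ 1 ∷ 1 ∷ 1 ∷ []) ∷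
    (5 ∷ 5 ∷ 5 ∷ 4 ∷ 2 ∷ 2 ∷ []) ∷ (6 ∷ 6 ∷ 6 ∷ 4 ∷ 4 ∷ 2 ∷ 1 ∷ []) ∷ (7 ∷ 7 ∷ 6 ∷ 6 ∷ 4 ∷ 3 ∷ 2 ∷ 1 ∷ []) ∷
    (9 ∷ 9 ∷ 8 ∷ 7 ∷ 6 ∷ 5 ∷ 4 ∷ 3 ∷ 1 ∷ 1 ∷ []) ∷ []) ∷
  ((7 ∷ 2 ∷ []) , (4 ∷ 4 ∷ 1 ∷ []) ,
    (6 ∷ 1 ∷ 1 ∷ 1 ∷ 1 ∷ 1 ∷ 1 ∷ []) ∷ (5 ∷ 2 ∷ 2 ∷ 2 ∷ 2 ∷ 1 ∷ []) ∷ (4 ∷ 4 ∷ 4 ∷ 2 ∷ 2 ∷ 1 ∷ []) ∷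
    (5 ∷ 5 ∷ 4 ∷ 4 ∷ 3 ∷ 1 ∷ []) ∷ (7 ∷ 7 ∷ 7 ∷ 5 ∷ 4 ∷ 3 ∷ 1 ∷ 1 ∷ []) ∷
    (8 ∷ 8 ∷ 7 ∷ 6 ∷ 5 ∷ 4 ∷ 2 ∷ 2 ∷ 1 ∷ []) ∷ []) ∷
  ((7 ∷ 1 ∷ 1 ∷ []) , (5 ∷ 3 ∷ 1 ∷ []) ,
    (3 ∷ 2 ∷ 2 ∷ 1 ∷ 1 ∷ 1 ∷ 1 ∷ 1 ∷ []) ∷ (4 ∷ 3 ∷ 2 ∷ 2 ∷ 1 ∷ 1 ∷ 1 ∷ []) ∷ (5 ∷ 3 ∷ 2 ∷ 2 ∷ 2 ∷ 2 ∷ []) ∷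
    (5 ∷ 5 ∷ 3 ∷ 2 ∷ 2 ∷ 2 ∷ []) ∷ (5 ∷ 5 ∷ 5 ∷ 3 ∷ 2 ∷ 2 ∷ []) ∷ (6 ∷ 6 ∷ 5 ∷ 4 ∷ 4 ∷ 2 ∷ 1 ∷ []) ∷
    (9 ∷ 9 ∷ 8 ∷ 7 ∷ 6 ∷ 5 ∷ 4 ∷ 2 ∷ 1 ∷ 1 ∷ []) ∷ []) ∷
  ((6 ∷ 3 ∷ []) , (6 ∷ 3 ∷ []) ,
    (2 ∷ 2 ∷ 2 ∷ 1 ∷ 1 ∷ 1 ∷ 1 ∷ 1 ∷ []) ∷ (3 ∷ 3 ∷ 3 ∷ 2 ∷ 1 ∷ 1 ∷ []) ∷ (5 ∷ 3 ∷ 3 ∷ 3 ∷ 2 ∷ 1 ∷ []) ∷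
    (5 ∷ 5 ∷ 5 ∷ 4 ∷ 1 ∷ 1 ∷ []) ∷ (6 ∷ 6 ∷ 6 ∷ 4 ∷ 2 ∷ 2 ∷ 1 ∷ []) ∷ (7 ∷ 7 ∷ 6 ∷ 5 ∷ 3 ∷ 3 ∷ 2 ∷ 1 ∷ []) ∷
    []) ∷
  ((6 ∷ 2 ∷ 1 ∷ []) , (3 ∷ 3 ∷ 1 ∷ 1 ∷ 1 ∷ []) ,
    (4 ∷ 4 ∷ 1 ∷ 1 ∷ 1 ∷ 1 ∷ 1 ∷ 1 ∷ []) ∷ (4 ∷ 4 ∷ 3 ∷ 3 ∷ 1 ∷ 1 ∷ []) ∷ (6 ∷ 6 ∷ 5 ∷ 5 ∷ 3 ∷ 1 ∷ 1 ∷ []) ∷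
    (8 ∷ 8 ∷ 7 ∷ 6 ∷ 5 ∷ 3 ∷ 3 ∷ 1 ∷ 1 ∷ []) ∷ []) ∷
  ((6 ∷ 1 ∷ 1 ∷ 1 ∷ []) , (4 ∷ 3 ∷ 1 ∷ 1 ∷ []) ,
    (5 ∷ 2 ∷ 1 ∷ 1 ∷ 1 ∷ 1 ∷ 1 ∷ 1 ∷ []) ∷ (5 ∷ 4 ∷ 1 ∷ 1 ∷ 1 ∷ 1 ∷ 1 ∷ 1 ∷ []) ∷
    (5 ∷ 4 ∷ 4 ∷ 1 ∷ 1 ∷ 1 ∷ 1 ∷ []) ∷ (6 ∷ 5 ∷ 4 ∷ 1 ∷ 1 ∷ 1 ∷ 1 ∷ []) ∷ (5 ∷ 5 ∷ 4 ∷ 3 ∷ 2 ∷ 2 ∷ []) ∷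
    (9 ∷ 9 ∷ 8 ∷ 7 ∷ 6 ∷ 5 ∷ 3 ∷ 2 ∷ 1 ∷ 1 ∷ []) ∷ []) ∷
  ((5 ∷ 4 ∷ []) , (5 ∷ 4 ∷ []) ,
    (2 ∷ 2 ∷ 2 ∷ 2 ∷ 1 ∷ 1 ∷ 1 ∷ []) ∷ (6 ∷ 2 ∷ 1 ∷ 1 ∷ 1 ∷ 1 ∷ 1 ∷ []) ∷ (6 ∷ 4 ∷ 1 ∷ 1 ∷ 1 ∷ 1 ∷ 1 ∷ []) ∷
    (4 ∷ 4 ∷ 4 ∷ 4 ∷ 1 ∷ []) ∷ (6 ∷ 5 ∷ 4 ∷ 4 ∷ 1 ∷ 1 ∷ 1 ∷ []) ∷ (6 ∷ 6 ∷ 5 ∷ 4 ∷ 1 ∷ 1 ∷ 1 ∷ []) ∷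
    (6 ∷ 6 ∷ 4 ∷ 4 ∷ 3 ∷ 2 ∷ 1 ∷ []) ∷ []) ∷
  ((5 ∷ 3 ∷ 1 ∷ []) , (7 ∷ 1 ∷ 1 ∷ []) ,
    (3 ∷ 1 ∷ 1 ∷ 1 ∷ 1 ∷ 1 ∷ 1 ∷ 1 ∷ 1 ∷ 1 ∷ []) ∷ (4 ∷ 2 ∷ 2 ∷ 2 ∷ 2 ∷ 2 ∷ []) ∷
    (5 ∷ 4 ∷ 2 ∷ 2 ∷ 2 ∷ 2 ∷ []) ∷ (5 ∷ 5 ∷ 4 ∷ 2 ∷ 2 ∷ 2 ∷ []) ∷ (6 ∷ 6 ∷ 5 ∷ 2 ∷ 2 ∷ 1 ∷ 1 ∷ []) ∷
    (7 ∷ 7 ∷ 6 ∷ 4 ∷ 4 ∷ 3 ∷ 1 ∷ 1 ∷ []) ∷ []) ∷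
  ((5 ∷ 2 ∷ 2 ∷ []) , (4 ∷ 3 ∷ 2 ∷ []) ,
    (3 ∷ 2 ∷ 2 ∷ 2 ∷ 1 ∷ 1 ∷ 1 ∷ []) ∷ (5 ∷ 2 ∷ 2 ∷ 2 ∷ 1 ∷ 1 ∷ 1 ∷ []) ∷ (5 ∷ 3 ∷ 3 ∷ 2 ∷ 2 ∷ 1 ∷ []) ∷
    (6 ∷ 6 ∷ 6 ∷ 4 ∷ 2 ∷ 1 ∷ 1 ∷ []) ∷ (7 ∷ 7 ∷ 6 ∷ 5 ∷ 3 ∷ 2 ∷ 2 ∷ 1 ∷ []) ∷ []) ∷
  ((5 ∷ 2 ∷ 1 ∷ 1 ∷ []) , (8 ∷ 1 ∷ []) ,
    (2 ∷ 1 ∷ 1 ∷ 1 ∷ 1 ∷ 1 ∷ 1 ∷ 1 ∷ 1 ∷ 1 ∷ []) ∷ (3 ∷ 2 ∷ 2 ∷ 2 ∷ 2 ∷ 2 ∷ []) ∷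
    (4 ∷ 4 ∷ 3 ∷ 2 ∷ 1 ∷ 1 ∷ 1 ∷ []) ∷ (6 ∷ 4 ∷ 4 ∷ 1 ∷ 1 ∷ 1 ∷ 1 ∷ []) ∷ (5 ∷ 5 ∷ 4 ∷ 3 ∷ 1 ∷ 1 ∷ 1 ∷ []) ∷
    (6 ∷ 6 ∷ 3 ∷ 3 ∷ 2 ∷ 1 ∷ 1 ∷ []) ∷ (8 ∷ 8 ∷ 7 ∷ 6 ∷ 4 ∷ 4 ∷ 2 ∷ 1 ∷ 1 ∷ []) ∷ []) ∷
  ((5 ∷ 1 ∷ 1 ∷ 1 ∷ 1 ∷ []) , (5 ∷ 1 ∷ 1 ∷ 1 ∷ 1 ∷ []) ,
    (4 ∷ 2 ∷ 1 ∷ 1 ∷ 1 ∷ 1 ∷ 1 ∷ 1 ∷ 1 ∷ 1 ∷ []) ∷ (5 ∷ 5 ∷ 2 ∷ 1 ∷ 1 ∷ 1 ∷ 1 ∷ []) ∷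
    (5 ∷ 4 ∷ 3 ∷ 2 ∷ 2 ∷ 2 ∷ []) ∷ (6 ∷ 4 ∷ 4 ∷ 3 ∷ 2 ∷ 1 ∷ 1 ∷ []) ∷
    (9 ∷ 9 ∷ 8 ∷ 7 ∷ 6 ∷ 4 ∷ 3 ∷ 2 ∷ 1 ∷ 1 ∷ []) ∷ []) ∷
  ((4 ∷ 4 ∷ 1 ∷ []) , (7 ∷ 2 ∷ []) ,
    (2 ∷ 2 ∷ 1 ∷ 1 ∷ 1 ∷ 1 ∷ 1 ∷ 1 ∷ 1 ∷ []) ∷ (3 ∷ 3 ∷ 2 ∷ 2 ∷ 2 ∷ 1 ∷ []) ∷ (4 ∷ 3 ∷ 3 ∷ 3 ∷ 2 ∷ 1 ∷ []) ∷
    (5 ∷ 4 ∷ 4 ∷ 4 ∷ 2 ∷ 1 ∷ []) ∷ (6 ∷ 5 ∷ 5 ∷ 4 ∷ 3 ∷ 1 ∷ 1 ∷ []) ∷ []) ∷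
  ((4 ∷ 3 ∷ 2 ∷ []) , (5 ∷ 2 ∷ 2 ∷ []) ,
    (5 ∷ 1 ∷ 1 ∷ 1 ∷ 1 ∷ 1 ∷ 1 ∷ 1 ∷ []) ∷ (3 ∷ 3 ∷ 3 ∷ 3 ∷ 1 ∷ 1 ∷ []) ∷ (4 ∷ 4 ∷ 4 ∷ 4 ∷ 2 ∷ []) ∷
    (6 ∷ 6 ∷ 4 ∷ 4 ∷ 1 ∷ 1 ∷ 1 ∷ []) ∷ (6 ∷ 6 ∷ 4 ∷ 4 ∷ 2 ∷ 2 ∷ 1 ∷ []) ∷ []) ∷
  ((4 ∷ 3 ∷ 1 ∷ 1 ∷ []) , (6 ∷ 1 ∷ 1 ∷ 1 ∷ []) ,
    (3 ∷ 2 ∷ 1 ∷ 1 ∷ 1 ∷ 1 ∷ 1 ∷ 1 ∷ 1 ∷ 1 ∷ []) ∷ (4 ∷ 3 ∷ 2 ∷ 2 ∷ 2 ∷ 2 ∷ []) ∷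
    (6 ∷ 5 ∷ 2 ∷ 2 ∷ 1 ∷ 1 ∷ 1 ∷ []) ∷ (6 ∷ 4 ∷ 4 ∷ 2 ∷ 2 ∷ 1 ∷ 1 ∷ []) ∷
    (7 ∷ 7 ∷ 6 ∷ 4 ∷ 3 ∷ 1 ∷ 1 ∷ 1 ∷ []) ∷ (7 ∷ 7 ∷ 5 ∷ 5 ∷ 4 ∷ 2 ∷ 1 ∷ 1 ∷ []) ∷ []) ∷
  ((4 ∷ 2 ∷ 2 ∷ 1 ∷ []) , (4 ∷ 2 ∷ 1 ∷ 1 ∷ 1 ∷ []) ,
    (4 ∷ 2 ∷ 2 ∷ 1 ∷ 1 ∷ 1 ∷ 1 ∷ 1 ∷ 1 ∷ []) ∷ (4 ∷ 4 ∷ 3 ∷ 1 ∷ 1 ∷ 1 ∷ 1 ∷ 1 ∷ []) ∷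
    (5 ∷ 4 ∷ 3 ∷ 3 ∷ 1 ∷ 1 ∷ 1 ∷ []) ∷ (6 ∷ 6 ∷ 3 ∷ 2 ∷ 1 ∷ 1 ∷ 1 ∷ []) ∷ (6 ∷ 5 ∷ 5 ∷ 2 ∷ 2 ∷ 1 ∷ 1 ∷ []) ∷
    (7 ∷ 7 ∷ 6 ∷ 4 ∷ 3 ∷ 3 ∷ 1 ∷ 1 ∷ []) ∷ []) ∷
  ((4 ∷ 2 ∷ 1 ∷ 1 ∷ 1 ∷ []) , (4 ∷ 2 ∷ 2 ∷ 1 ∷ []) ,
    (3 ∷ 3 ∷ 2 ∷ 1 ∷ 1 ∷ 1 ∷ 1 ∷ 1 ∷ []) ∷ (4 ∷ 4 ∷ 2 ∷ 2 ∷ 1 ∷ 1 ∷ 1 ∷ []) ∷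
    (6 ∷ 3 ∷ 3 ∷ 2 ∷ 1 ∷ 1 ∷ 1 ∷ []) ∷ (6 ∷ 4 ∷ 3 ∷ 2 ∷ 2 ∷ 1 ∷ 1 ∷ []) ∷
    (7 ∷ 7 ∷ 5 ∷ 4 ∷ 2 ∷ 2 ∷ 1 ∷ 1 ∷ []) ∷ (8 ∷ 8 ∷ 7 ∷ 5 ∷ 5 ∷ 3 ∷ 2 ∷ 1 ∷ 1 ∷ []) ∷ []) ∷
  ((4 ∷ 1 ∷ 1 ∷ 1 ∷ 1 ∷ 1 ∷ []) , (3 ∷ 2 ∷ 2 ∷ 1 ∷ 1 ∷ []) ,
    (5 ∷ 2 ∷ 2 ∷ 1 ∷ 1 ∷ 1 ∷ 1 ∷ 1 ∷ []) ∷ (5 ∷ 3 ∷ 2 ∷ 2 ∷ 1 ∷ 1 ∷ 1 ∷ 1 ∷ []) ∷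
    (5 ∷ 5 ∷ 3 ∷ 1 ∷ 1 ∷ 1 ∷ 1 ∷ 1 ∷ []) ∷ (5 ∷ 5 ∷ 4 ∷ 2 ∷ 1 ∷ 1 ∷ 1 ∷ 1 ∷ []) ∷
    (7 ∷ 5 ∷ 4 ∷ 2 ∷ 1 ∷ 1 ∷ 1 ∷ 1 ∷ []) ∷ (7 ∷ 6 ∷ 4 ∷ 3 ∷ 1 ∷ 1 ∷ 1 ∷ 1 ∷ []) ∷
    (7 ∷ 5 ∷ 5 ∷ 4 ∷ 2 ∷ 1 ∷ 1 ∷ 1 ∷ []) ∷ (7 ∷ 6 ∷ 5 ∷ 3 ∷ 3 ∷ 2 ∷ 1 ∷ 1 ∷ []) ∷
    (9 ∷ 9 ∷ 8 ∷ 7 ∷ 5 ∷ 4 ∷ 3 ∷ 2 ∷ 1 ∷ 1 ∷ []) ∷ []) ∷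
  ((3 ∷ 3 ∷ 3 ∷ []) , (2 ∷ 2 ∷ 2 ∷ 2 ∷ 1 ∷ []) ,
    (6 ∷ 3 ∷ 1 ∷ 1 ∷ 1 ∷ 1 ∷ 1 ∷ []) ∷ (6 ∷ 3 ∷ 3 ∷ 1 ∷ 1 ∷ 1 ∷ 1 ∷ []) ∷ (5 ∷ 4 ∷ 3 ∷ 3 ∷ 2 ∷ 1 ∷ []) ∷ []) ∷
  ((3 ∷ 3 ∷ 2 ∷ 1 ∷ []) , (3 ∷ 2 ∷ 2 ∷ 2 ∷ []) ,
    (3 ∷ 3 ∷ 3 ∷ 1 ∷ 1 ∷ 1 ∷ 1 ∷ []) ∷ (4 ∷ 3 ∷ 3 ∷ 3 ∷ 1 ∷ 1 ∷ []) ∷ (4 ∷ 4 ∷ 4 ∷ 4 ∷ 2 ∷ 1 ∷ []) ∷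
    (6 ∷ 5 ∷ 5 ∷ 3 ∷ 3 ∷ 1 ∷ 1 ∷ []) ∷ []) ∷
  ((3 ∷ 3 ∷ 1 ∷ 1 ∷ 1 ∷ []) , (6 ∷ 2 ∷ 1 ∷ []) ,
    (4 ∷ 1 ∷ 1 ∷ 1 ∷ 1 ∷ 1 ∷ 1 ∷ 1 ∷ 1 ∷ []) ∷ (4 ∷ 3 ∷ 3 ∷ 2 ∷ 1 ∷ 1 ∷ []) ∷
    (7 ∷ 6 ∷ 6 ∷ 5 ∷ 3 ∷ 2 ∷ 1 ∷ 1 ∷ []) ∷ []) ∷
  ((3 ∷ 2 ∷ 2 ∷ 2 ∷ []) , (3 ∷ 3 ∷ 2 ∷ 1 ∷ []) ,
    (4 ∷ 2 ∷ 2 ∷ 2 ∷ 1 ∷ 1 ∷ 1 ∷ []) ∷ (4 ∷ 4 ∷ 2 ∷ 2 ∷ 2 ∷ 1 ∷ []) ∷ (5 ∷ 5 ∷ 5 ∷ 1 ∷ 1 ∷ 1 ∷ []) ∷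
    (5 ∷ 5 ∷ 3 ∷ 3 ∷ 3 ∷ 1 ∷ []) ∷ (6 ∷ 6 ∷ 4 ∷ 3 ∷ 2 ∷ 2 ∷ 1 ∷ []) ∷ []) ∷
  ((3 ∷ 2 ∷ 2 ∷ 1 ∷ 1 ∷ []) , (4 ∷ 1 ∷ 1 ∷ 1 ∷ 1 ∷ 1 ∷ []) ,
    (4 ∷ 3 ∷ 1 ∷ 1 ∷ 1 ∷ 1 ∷ 1 ∷ 1 ∷ 1 ∷ 1 ∷ []) ∷ (6 ∷ 4 ∷ 2 ∷ 1 ∷ 1 ∷ 1 ∷ 1 ∷ 1 ∷ []) ∷
    (6 ∷ 5 ∷ 3 ∷ 1 ∷ 1 ∷ 1 ∷ 1 ∷ 1 ∷ []) ∷ (6 ∷ 4 ∷ 4 ∷ 3 ∷ 1 ∷ 1 ∷ 1 ∷ 1 ∷ []) ∷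
    (6 ∷ 6 ∷ 4 ∷ 3 ∷ 1 ∷ 1 ∷ 1 ∷ 1 ∷ []) ∷ (6 ∷ 6 ∷ 5 ∷ 3 ∷ 2 ∷ 1 ∷ 1 ∷ 1 ∷ []) ∷
    (7 ∷ 6 ∷ 4 ∷ 4 ∷ 3 ∷ 1 ∷ 1 ∷ 1 ∷ []) ∷ (7 ∷ 6 ∷ 6 ∷ 4 ∷ 3 ∷ 1 ∷ 1 ∷ 1 ∷ []) ∷
    (7 ∷ 7 ∷ 5 ∷ 4 ∷ 4 ∷ 2 ∷ 1 ∷ 1 ∷ []) ∷ []) ∷
  ((3 ∷ 2 ∷ 1 ∷ 1 ∷ 1 ∷ 1 ∷ []) , (3 ∷ 2 ∷ 1 ∷ 1 ∷ 1 ∷ 1 ∷ []) ,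
    (5 ∷ 3 ∷ 1 ∷ 1 ∷ 1 ∷ 1 ∷ 1 ∷ 1 ∷ 1 ∷ []) ∷ (5 ∷ 3 ∷ 3 ∷ 1 ∷ 1 ∷ 1 ∷ 1 ∷ 1 ∷ 1 ∷ []) ∷
    (6 ∷ 4 ∷ 3 ∷ 1 ∷ 1 ∷ 1 ∷ 1 ∷ 1 ∷ 1 ∷ []) ∷ (6 ∷ 4 ∷ 4 ∷ 2 ∷ 1 ∷ 1 ∷ 1 ∷ 1 ∷ 1 ∷ []) ∷
    (6 ∷ 5 ∷ 4 ∷ 2 ∷ 2 ∷ 1 ∷ 1 ∷ 1 ∷ 1 ∷ []) ∷ (6 ∷ 6 ∷ 4 ∷ 3 ∷ 2 ∷ 1 ∷ 1 ∷ 1 ∷ 1 ∷ []) ∷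
    (7 ∷ 6 ∷ 4 ∷ 4 ∷ 2 ∷ 1 ∷ 1 ∷ 1 ∷ 1 ∷ []) ∷ (7 ∷ 6 ∷ 5 ∷ 4 ∷ 2 ∷ 2 ∷ 1 ∷ 1 ∷ 1 ∷ []) ∷
    (7 ∷ 7 ∷ 5 ∷ 4 ∷ 3 ∷ 2 ∷ 1 ∷ 1 ∷ 1 ∷ []) ∷ (8 ∷ 7 ∷ 5 ∷ 5 ∷ 3 ∷ 2 ∷ 1 ∷ 1 ∷ 1 ∷ []) ∷
    (8 ∷ 7 ∷ 6 ∷ 5 ∷ 3 ∷ 3 ∷ 1 ∷ 1 ∷ 1 ∷ []) ∷ (8 ∷ 8 ∷ 6 ∷ 5 ∷ 4 ∷ 3 ∷ 1 ∷ 1 ∷ 1 ∷ []) ∷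
    (8 ∷ 8 ∷ 6 ∷ 6 ∷ 4 ∷ 3 ∷ 2 ∷ 1 ∷ 1 ∷ []) ∷ []) ∷
  ((3 ∷ 1 ∷ 1 ∷ 1 ∷ 1 ∷ 1 ∷ 1 ∷ []) , (3 ∷ 1 ∷ 1 ∷ 1 ∷ 1 ∷ 1 ∷ 1 ∷ []) ,
    (4 ∷ 3 ∷ 2 ∷ 1 ∷ 1 ∷ 1 ∷ 1 ∷ 1 ∷ 1 ∷ 1 ∷ []) ∷ (5 ∷ 4 ∷ 2 ∷ 2 ∷ 1 ∷ 1 ∷ 1 ∷ 1 ∷ 1 ∷ []) ∷
    (5 ∷ 5 ∷ 3 ∷ 2 ∷ 1 ∷ 1 ∷ 1 ∷ 1 ∷ 1 ∷ []) ∷ (6 ∷ 5 ∷ 3 ∷ 3 ∷ 1 ∷ 1 ∷ 1 ∷ 1 ∷ 1 ∷ []) ∷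
    (7 ∷ 5 ∷ 4 ∷ 3 ∷ 1 ∷ 1 ∷ 1 ∷ 1 ∷ 1 ∷ []) ∷ (7 ∷ 5 ∷ 5 ∷ 3 ∷ 2 ∷ 1 ∷ 1 ∷ 1 ∷ 1 ∷ []) ∷
    (7 ∷ 6 ∷ 5 ∷ 3 ∷ 3 ∷ 1 ∷ 1 ∷ 1 ∷ 1 ∷ []) ∷ (8 ∷ 6 ∷ 5 ∷ 4 ∷ 3 ∷ 1 ∷ 1 ∷ 1 ∷ 1 ∷ []) ∷
    (8 ∷ 6 ∷ 6 ∷ 4 ∷ 3 ∷ 2 ∷ 1 ∷ 1 ∷ 1 ∷ []) ∷ (8 ∷ 7 ∷ 6 ∷ 4 ∷ 4 ∷ 2 ∷ 1 ∷ 1 ∷ 1 ∷ []) ∷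
    (8 ∷ 7 ∷ 6 ∷ 5 ∷ 4 ∷ 2 ∷ 2 ∷ 1 ∷ 1 ∷ []) ∷ (9 ∷ 9 ∷ 8 ∷ 6 ∷ 5 ∷ 4 ∷ 3 ∷ 2 ∷ 1 ∷ 1 ∷ []) ∷ []) ∷
  ((2 ∷ 2 ∷ 2 ∷ 2 ∷ 1 ∷ []) , (3 ∷ 3 ∷ 3 ∷ []) ,
    (3 ∷ 3 ∷ 2 ∷ 2 ∷ 1 ∷ 1 ∷ []) ∷ (6 ∷ 5 ∷ 5 ∷ 2 ∷ 1 ∷ 1 ∷ 1 ∷ []) ∷ (6 ∷ 5 ∷ 4 ∷ 3 ∷ 3 ∷ 1 ∷ 1 ∷ []) ∷ []) ∷
  ((2 ∷ 2 ∷ 2 ∷ 1 ∷ 1 ∷ 1 ∷ []) , (2 ∷ 2 ∷ 1 ∷ 1 ∷ 1 ∷ 1 ∷ 1 ∷ []) ,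
    (4 ∷ 4 ∷ 2 ∷ 1 ∷ 1 ∷ 1 ∷ 1 ∷ 1 ∷ 1 ∷ []) ∷ (6 ∷ 4 ∷ 2 ∷ 2 ∷ 1 ∷ 1 ∷ 1 ∷ 1 ∷ []) ∷
    (6 ∷ 4 ∷ 3 ∷ 3 ∷ 1 ∷ 1 ∷ 1 ∷ 1 ∷ []) ∷ (6 ∷ 5 ∷ 3 ∷ 3 ∷ 2 ∷ 1 ∷ 1 ∷ 1 ∷ []) ∷
    (6 ∷ 5 ∷ 5 ∷ 3 ∷ 2 ∷ 1 ∷ 1 ∷ 1 ∷ []) ∷ (7 ∷ 6 ∷ 4 ∷ 3 ∷ 3 ∷ 1 ∷ 1 ∷ 1 ∷ []) ∷
    (7 ∷ 7 ∷ 5 ∷ 4 ∷ 2 ∷ 1 ∷ 1 ∷ 1 ∷ []) ∷ (7 ∷ 6 ∷ 5 ∷ 5 ∷ 3 ∷ 2 ∷ 1 ∷ 1 ∷ []) ∷ []) ∷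
  ((2 ∷ 2 ∷ 1 ∷ 1 ∷ 1 ∷ 1 ∷ 1 ∷ []) , (2 ∷ 2 ∷ 2 ∷ 1 ∷ 1 ∷ 1 ∷ []) ,
    (4 ∷ 3 ∷ 3 ∷ 1 ∷ 1 ∷ 1 ∷ 1 ∷ 1 ∷ []) ∷ (5 ∷ 3 ∷ 3 ∷ 2 ∷ 1 ∷ 1 ∷ 1 ∷ 1 ∷ []) ∷
    (5 ∷ 4 ∷ 4 ∷ 2 ∷ 1 ∷ 1 ∷ 1 ∷ 1 ∷ []) ∷ (6 ∷ 5 ∷ 3 ∷ 2 ∷ 2 ∷ 1 ∷ 1 ∷ 1 ∷ []) ∷
    (7 ∷ 5 ∷ 4 ∷ 2 ∷ 2 ∷ 1 ∷ 1 ∷ 1 ∷ []) ∷ (7 ∷ 5 ∷ 4 ∷ 4 ∷ 2 ∷ 1 ∷ 1 ∷ 1 ∷ []) ∷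
    (7 ∷ 6 ∷ 5 ∷ 3 ∷ 2 ∷ 2 ∷ 1 ∷ 1 ∷ []) ∷ (8 ∷ 7 ∷ 7 ∷ 5 ∷ 4 ∷ 3 ∷ 2 ∷ 1 ∷ 1 ∷ []) ∷ []) ∷
  ((2 ∷ 1 ∷ 1 ∷ 1 ∷ 1 ∷ 1 ∷ 1 ∷ 1 ∷ []) , (2 ∷ 1 ∷ 1 ∷ 1 ∷ 1 ∷ 1 ∷ 1 ∷ 1 ∷ []) ,
    (5 ∷ 3 ∷ 2 ∷ 1 ∷ 1 ∷ 1 ∷ 1 ∷ 1 ∷ 1 ∷ 1 ∷ []) ∷ (5 ∷ 4 ∷ 3 ∷ 1 ∷ 1 ∷ 1 ∷ 1 ∷ 1 ∷ 1 ∷ 1 ∷ []) ∷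
    (6 ∷ 4 ∷ 3 ∷ 2 ∷ 1 ∷ 1 ∷ 1 ∷ 1 ∷ 1 ∷ 1 ∷ []) ∷ (6 ∷ 5 ∷ 4 ∷ 2 ∷ 1 ∷ 1 ∷ 1 ∷ 1 ∷ 1 ∷ 1 ∷ []) ∷
    (6 ∷ 5 ∷ 4 ∷ 3 ∷ 2 ∷ 1 ∷ 1 ∷ 1 ∷ 1 ∷ 1 ∷ []) ∷ (7 ∷ 6 ∷ 4 ∷ 3 ∷ 2 ∷ 1 ∷ 1 ∷ 1 ∷ 1 ∷ 1 ∷ []) ∷
    (7 ∷ 6 ∷ 5 ∷ 4 ∷ 2 ∷ 1 ∷ 1 ∷ 1 ∷ 1 ∷ 1 ∷ []) ∷ (7 ∷ 6 ∷ 5 ∷ 4 ∷ 3 ∷ 2 ∷ 1 ∷ 1 ∷ 1 ∷ 1 ∷ []) ∷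
    (8 ∷ 7 ∷ 5 ∷ 4 ∷ 3 ∷ 2 ∷ 1 ∷ 1 ∷ 1 ∷ 1 ∷ []) ∷ (8 ∷ 7 ∷ 6 ∷ 5 ∷ 3 ∷ 2 ∷ 1 ∷ 1 ∷ 1 ∷ 1 ∷ []) ∷
    (8 ∷ 7 ∷ 6 ∷ 5 ∷ 4 ∷ 3 ∷ 1 ∷ 1 ∷ 1 ∷ 1 ∷ []) ∷ (9 ∷ 7 ∷ 6 ∷ 5 ∷ 4 ∷ 3 ∷ 2 ∷ 1 ∷ 1 ∷ 1 ∷ []) ∷
    (9 ∷ 8 ∷ 7 ∷ 5 ∷ 4 ∷ 3 ∷ 2 ∷ 1 ∷ 1 ∷ 1 ∷ []) ∷ (9 ∷ 8 ∷ 7 ∷ 6 ∷ 5 ∷ 3 ∷ 2 ∷ 1 ∷ 1 ∷ 1 ∷ []) ∷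
    (9 ∷ 8 ∷ 7 ∷ 6 ∷ 5 ∷ 4 ∷ 3 ∷ 1 ∷ 1 ∷ 1 ∷ []) ∷ (9 ∷ 9 ∷ 7 ∷ 6 ∷ 5 ∷ 4 ∷ 3 ∷ 2 ∷ 1 ∷ 1 ∷ []) ∷ []) ∷
  ((1 ∷ 1 ∷ 1 ∷ 1 ∷ 1 ∷ 1 ∷ 1 ∷ 1 ∷ 1 ∷ []) , (1 ∷ 1 ∷ 1 ∷ 1 ∷ 1 ∷ 1 ∷ 1 ∷ 1 ∷ 1 ∷ []) ,
    (5 ∷ 4 ∷ 2 ∷ 1 ∷ 1 ∷ 1 ∷ 1 ∷ 1 ∷ 1 ∷ 1 ∷ []) ∷ (5 ∷ 4 ∷ 3 ∷ 2 ∷ 1 ∷ 1 ∷ 1 ∷ 1 ∷ 1 ∷ 1 ∷ []) ∷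
    (6 ∷ 5 ∷ 3 ∷ 2 ∷ 1 ∷ 1 ∷ 1 ∷ 1 ∷ 1 ∷ 1 ∷ []) ∷ (6 ∷ 5 ∷ 4 ∷ 3 ∷ 1 ∷ 1 ∷ 1 ∷ 1 ∷ 1 ∷ 1 ∷ []) ∷
    (7 ∷ 5 ∷ 4 ∷ 3 ∷ 2 ∷ 1 ∷ 1 ∷ 1 ∷ 1 ∷ 1 ∷ []) ∷ (7 ∷ 6 ∷ 5 ∷ 3 ∷ 2 ∷ 1 ∷ 1 ∷ 1 ∷ 1 ∷ 1 ∷ []) ∷
    (7 ∷ 6 ∷ 5 ∷ 4 ∷ 3 ∷ 1 ∷ 1 ∷ 1 ∷ 1 ∷ 1 ∷ []) ∷ (8 ∷ 6 ∷ 5 ∷ 4 ∷ 3 ∷ 2 ∷ 1 ∷ 1 ∷ 1 ∷ 1 ∷ []) ∷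
    (8 ∷ 7 ∷ 6 ∷ 4 ∷ 3 ∷ 2 ∷ 1 ∷ 1 ∷ 1 ∷ 1 ∷ []) ∷ (8 ∷ 7 ∷ 6 ∷ 5 ∷ 4 ∷ 2 ∷ 1 ∷ 1 ∷ 1 ∷ 1 ∷ []) ∷
    (8 ∷ 7 ∷ 6 ∷ 5 ∷ 4 ∷ 3 ∷ 2 ∷ 1 ∷ 1 ∷ 1 ∷ []) ∷ (9 ∷ 8 ∷ 6 ∷ 5 ∷ 4 ∷ 3 ∷ 2 ∷ 1 ∷ 1 ∷ 1 ∷ []) ∷
    (9 ∷ 8 ∷ 7 ∷ 6 ∷ 4 ∷ 3 ∷ 2 ∷ 1 ∷ 1 ∷ 1 ∷ []) ∷ (9 ∷ 8 ∷ 7 ∷ 6 ∷ 5 ∷ 4 ∷ 2 ∷ 1 ∷ 1 ∷ 1 ∷ []) ∷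
    (9 ∷ 8 ∷ 7 ∷ 6 ∷ 5 ∷ 4 ∷ 3 ∷ 2 ∷ 1 ∷ 1 ∷ []) ∷ []) ∷ []
table _ = []

-- Boolean tests for the finite part

_≟ᵇ_ : List ℕ → List ℕ → Bool
[] ≟ᵇ [] = true
(x ∷ xs) ≟ᵇ (y ∷ ys) = (x ≡ᵇ y) ∧ (xs ≟ᵇ ys)
_ ≟ᵇ _ = false

_∈ᵇ_ : List ℕ → List (List ℕ) → Bool
x ∈ᵇ [] = false
x ∈ᵇ (y ∷ ys) = (x ≟ᵇ y) ∨ (x ∈ᵇ ys)

-- A missing entry yields the empty chain, which `chainOK` rejects.
find : List ℕ → List Entry → List ℕ × List (List ℕ)
find μ [] = [] , []
find μ ((ν , e) ∷ es) = if μ ≟ᵇ ν then e else find μ es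

star : ℕ → List ℕ → List ℕ
star k μ = proj₁ (find μ (table k))

rootsOf : ℕ → List ℕ → List (List ℕ)
rootsOf k μ = proj₂ (find μ (table k))

ownerIn : List Entry → List ℕ → Maybe (List ℕ)
ownerIn [] r = nothing
ownerIn ((μ , _ , rs) ∷ es) r = if r ∈ᵇ rs then just μ else ownerIn es r

owner : ℕ → List ℕ → Maybe (List ℕ)
owner k = ownerIn (table k)

parts : ℕ → ℕ → ℕ → List (List ℕ)
parts f m zero = [] ∷ []
parts zero m (suc k) = []
parts (suc f) m (suc k) = concatMap (λ x → map (suc x ∷_) (parts f (suc x) (k ∸ x))) (upTo (m ⊓ suc k))

partitions : ℕ → List (List ℕ)
partitions k = parts k k k

isPartition : List ℕ → Bool
isPartition [] = true
isPartition (x ∷ δ) = (1 ≤ᵇ x) ∧ (head0 δ ≤ᵇ x) ∧ isPartition δ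

isPar : ℕ → List ℕ → Bool
isPar k μ = isPartition μ ∧ (sum μ ≡ᵇ k)

isStair : List ℕ → Bool
isStair [] = true
isStair (x ∷ δ) = (length δ ≤ᵇ x) ∧ (x ≤ᵇ suc (length δ)) ∧ isStair δ

Chain : Set
Chain = List (ℕ × List ℕ)

withDinv : List (List ℕ) → Chain
withDinv = map (λ r → rowDinv r , r)

-- The candidate for C_{μ,i}: the orbit that is active at dinv i, advanced to that dinv. Values
-- below `start c` are fillers and belong to no claim.
elem : Chain → ℕ → List ℕ
elem [] i = []
elem ((d , r) ∷ []) i = ν^ (i ∸ d) r
elem ((d , r) ∷ c@((d′ , _) ∷ _)) i = if i <ᵇ d′ then ν^ (i ∸ d) r else elem c i

start : Chain → ℕ
start [] = 0
start ((d , _) ∷ _) = d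

lastOf : Chain → ℕ × List ℕ
lastOf [] = 0 , []
lastOf (p ∷ []) = p
lastOf (_ ∷ c@(_ ∷ _)) = lastOf c

-- The orbit of `r` has exactly d′ - d members: its last one has dinv d′ - 1, so the next orbit
-- continues without gap or overlap.
chainOK : Chain → Bool
chainOK [] = false
chainOK (_ ∷ []) = true
chainOK ((d , r) ∷ c@((d′ , _) ∷ _)) = (d <ᵇ d′) ∧ is-just (nuIter (pred (d′ ∸ d)) r) ∧ not (is-just (nuIter (d′ ∸ d) r)) ∧ chainOK c

nthLe : List ℕ → ℕ → ℕ → Bool
nthLe [] j n = false
nthLe (x ∷ xs) zero n = x ≤ᵇ n
nthLe (x ∷ xs) (suc j) n = nthLe xs j n

isOwner : List ℕ → Maybe (List ℕ) → Bool
isOwner μ nothing = false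
isOwner μ (just ν) = μ ≟ᵇ ν

-- Greedy choice of the indices i_j before the tail: a segment R opens at each initial partition,
-- and at `b`, the first index after the previous segment of ρ + 1 members.
starts : Chain → ℕ → List ℕ → List ℕ
starts c b [] = []
starts c b (i ∷ is) = if isInit (elem c i) ∨ (b ≤ᵇ i) then i ∷ starts c (suc (i + ρ (elem c i))) is else starts c b is

between : ℕ → ℕ → List ℕ
between a b = applyUpTo (a +_) (b ∸ a)

rising : List ℕ → ℕ → Bool
rising [] d = true
rising (x ∷ []) d = x <ᵇ d
rising (x ∷ xs@(y ∷ _)) d = (x <ᵇ y) ∧ rising xs d

nondecreasing : List ℕ → Bool
nondecreasing (x ∷ xs@(y ∷ _)) = (x ≤ᵇ y) ∧ nondecreasing xs
nondecreasing _ = true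

valley : List ℕ → Bool
valley (x ∷ xs@(y ∷ _)) = if y ≤ᵇ x then valley xs else nondecreasing (x ∷ xs)
valley _ = true

-- From `d` on every index is an i_j: each member lies in its own R with m = 0, and Δ is increasing
-- along ν.
then-tail : List ℕ → ℕ → ℕ → ℕ
then-tail [] d j = d + j
then-tail (x ∷ xs) d zero = x
then-tail (x ∷ xs) d (suc j) = then-tail xs d j

covered : Chain → List ℕ → ℕ → Bool
covered c ss i = any (λ s → (s ≤ᵇ i) ∧ (i ∸ s ≤ᵇ ρ (elem c s)) ∧ is-just (nuIter (i ∸ s) (elem c s))) ss

startsOK : Chain → ℕ → List ℕ → Bool
startsOK c d ss = rising ss d ∧ all (start c ≤ᵇ_) ss ∧ all (covered c ss) (between (start c) d)
  -- One value beyond `ss`, the first of the tail, so that the comparison at the junction is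
  -- included.
  ∧ valley (applyUpTo (λ j → Δ′ (elem c (then-tail ss d j))) (suc (length ss)))

rootOK : ℕ → List ℕ → List ℕ → Bool
rootOK k μ r = isPartition r ∧ (rowDefect r ≡ᵇ k) ∧ isInit r ∧ isOwner μ (owner k r)

N₀ : List ℕ → List ℕ → ℕ
N₀ μ μ* = (ζ μ + 2) ⊔ (ζ μ* + 2)

-- One instance of the reflection i ↦ C(n,2) - k - i: a member inside DP_n must land on a partner
-- inside DP_n. The test `i + k ≤ᵇ tri n` makes the truncated difference exact.
symAt : ℕ → ℕ → List ℕ → ℕ → ℕ → ℕ → Bool
symAt k ℓ f* i δ n = (n <ᵇ δ) ∨ ((i + k ≤ᵇ tri n) ∧ (ℓ ≤ᵇ tri n ∸ (i + k)) ∧ nthLe f* (tri n ∸ (i + k)) n)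

-- Indices up to `tri (pred N)` suffice: Δ ≤ N - 1 forces i + k + ℓ(μ) ≤ C(N-1,2), by `level⇒`.
symOK : ℕ → ℕ → ℕ → Chain → List ℕ → Bool
symOK k ℓ N c f* = all (λ i → all (symAt k ℓ f* i (Δ′ (elem c i))) (upTo N)) (between (start c) (suc (tri (pred N))))

profile : Chain → ℕ → List ℕ
profile c N = applyUpTo (λ i → Δ′ (elem c i)) (suc (tri (pred N)))

-- The last equation is area_n(γ_μ) = ℓ(μ) for n = ζ(μ) + 1: the size of γ_μ is d + k, and the Dyck
-- vector defining it has ℓ(μ) ones.
tailOK : ℕ → List ℕ → ℕ × List ℕ → Bool
tailOK k μ (d , t) = (t ≟ᵇ γmu μ) ∧ isStair t ∧ (length t ≡ᵇ ζ μ) ∧ (d + k + length μ ≡ᵇ tri (suc (ζ μ)))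

chainCheck : ℕ → List ℕ → List ℕ → Chain → Chain → Bool
chainCheck k μ μ* c c* =
  chainOK c ∧ (start c ≡ᵇ length μ*) ∧ tailOK k μ (lastOf c)
  ∧ all (λ i → Δ′ (elem c i) ≤ᵇ N₀ μ μ*) (between (start c) (proj₁ (lastOf c)))
  ∧ symOK k (length μ) (N₀ μ μ*) c (profile c* (N₀ μ μ*))
  ∧ startsOK c (proj₁ (lastOf c)) (starts c 0 (between (start c) (proj₁ (lastOf c))))

check : ℕ → List ℕ → Bool
check k μ = isPar k (star k μ) ∧ (star k (star k μ) ≟ᵇ μ) ∧ all (rootOK k μ) (rootsOf k μ)
  ∧ chainCheck k μ (star k μ) (withDinv (rootsOf k μ)) (withDinv (rootsOf k (star k μ)))

entryOK : ℕ → Entry → Bool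
entryOK k (μ , _ , rs) = isPar k μ ∧ all (_∈ᵇ rootsOf k μ) rs

leaf : List ℕ → ℕ → Bool
leaf γ d = not (isInit γ) ∨ is-just (owner d γ)

-- Prepends rows to γ, whose defect is d, in all ways that keep the parts below 10.
explore : ℕ → List ℕ → ℕ → Bool
explore zero γ d = (10 ≤ᵇ d) ∨ leaf γ d
explore (suc f) γ d = (10 ≤ᵇ d) ∨ (leaf γ d ∧ all (λ x → explore f (x ∷ γ) ((x ∸ rowScore x γ) + d)) (between (1 ⊔ head0 γ) 10))

dyckPart : List ℕ → List ℕ
dyckPart λ′ = dp (sum λ′) (dyck λ′)

-- Condition (8) assumes that the first partition lies in some chain, so without an owner there is
-- nothing to test.
conjAt : ℕ → Maybe (List ℕ) → List ℕ → Bool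
conjAt k nothing δ = true
conjAt k (just μ) δ = isPartition δ ∧ (rowDefect δ ≡ᵇ k) ∧ isOwner (star k μ) (owner k (root δ))

conjGo : ℕ → List ℕ → List ℕ → Bool
conjGo k γ δ = (10 ≤ᵇ k) ∨ conjAt k (owner k (root γ)) δ

conjOK : List ℕ → Bool
conjOK λ′ = conjGo (rowDefect (dyckPart λ′)) (dyckPart λ′) (dp (sum λ′) (dyck (conj λ′)))

-- Depth 10 and parts below 10 come from `init-small`: an initial partition of defect at most 9 has
-- at most 10 rows, each of length at most 9.
explored : explore 10 [] (rowDefect []) ≡ true
explored = refl

-- Sizes below 12 only; the others are settled by `large-trivial`.
conjugates-checked : all (λ n → all conjOK (partitions n)) (upTo 12) ≡ true
conjugates-checked = refl

entries-checked : all (λ k → all (entryOK k) (table k)) (upTo 10) ≡ true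
entries-checked = refl

chains-checked : all (λ k → all (check k) (partitions k)) (upTo 10) ≡ true
chains-checked = refl

-- Soundness of the tests

holds : ∀ {b} → b ≡ true → T b
holds refl = tt

split : ∀ a {b} → T (a ∧ b) → T a × T b
split a = Equivalence.to (T-∧ {a})

resolve : ∀ a {b} → T (a ∨ b) → ¬ T a → T b
resolve true _ ¬a = ⊥-elim (¬a tt)
resolve false t _ = t

all-∈ : ∀ {A : Set} (p : A → Bool) {xs x} → T (all p xs) → x ∈ xs → T (p x)
all-∈ p {xs} t = All.lookup (AllP.all⁺ p xs t)

≟ᵇ-sound : ∀ xs ys → T (xs ≟ᵇ ys) → xs ≡ ys
≟ᵇ-sound [] [] _ = refl
≟ᵇ-sound (x ∷ xs) (y ∷ ys) t with split (x ≡ᵇ y) t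
... | a , b = cong₂ _∷_ (≡ᵇ⇒≡ x y a) (≟ᵇ-sound xs ys b)

∈ᵇ-sound : ∀ x ys → T (x ∈ᵇ ys) → x ∈ ys
∈ᵇ-sound x (y ∷ ys) t with x ≟ᵇ y in eq
... | true = here (≟ᵇ-sound x y (holds eq))
... | false = there (∈ᵇ-sound x ys t)

isPartition-sound : ∀ γ → T (isPartition γ) → Partition γ
isPartition-sound [] _ = []
isPartition-sound (x ∷ δ) t with split (1 ≤ᵇ x) t
... | a , t′ with split (head0 δ ≤ᵇ x) t′
... | b , c = cons (≤ᵇ⇒≤ 1 x a) (≤ᵇ⇒≤ (head0 δ) x b) (isPartition-sound δ c)

isPar-sound : ∀ k μ → T (isPar k μ) → Par k μ
isPar-sound k μ t with split (isPartition μ) t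
... | a , b = fromPartition (isPartition-sound μ a) , ≡ᵇ⇒≡ (sum μ) k b

isStair-sound : ∀ γ → T (isStair γ) → Stair γ
isStair-sound [] _ = []
isStair-sound (x ∷ δ) t with split (length δ ≤ᵇ x) t
... | a , t′ with split (x ≤ᵇ suc (length δ)) t′
... | b , c = cons (≤ᵇ⇒≤ _ _ a) (≤ᵇ⇒≤ _ _ b) (isStair-sound δ c)

isOwner-sound : ∀ {μ m} → T (isOwner μ m) → m ≡ just μ
isOwner-sound {μ} {just ν} t = cong just (sym (≟ᵇ-sound μ ν t))

∈-between : ∀ {a b i} → a ≤ i → i < b → i ∈ between a b
∈-between {a} {b} {i} p q = subst (_∈ between a b) (m+[n∸m]≡n p) (∈-applyUpTo⁺ (a +_) (∸-monoˡ-< q p))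

∈-parts : ∀ f m {μ k} → Partition μ → sum μ ≡ k → k ≤ f → head0 μ ≤ m → μ ∈ parts f m k
∈-parts f m [] refl _ _ = here refl
∈-parts (suc f) m {suc x ∷ μ} (cons _ h d) refl (s≤s k≤f) x≤m =
  ∈-concatMap⁺ (λ y → map (suc y ∷_) (parts f (suc y) (x + sum μ ∸ y)))
    (Any.map (λ { refl → ∈-map⁺ (suc x ∷_) (∈-parts f (suc x) d (sym (m+n∸m≡n x (sum μ)))
      (≤-trans (m∸n≤m (x + sum μ) x) k≤f) h) })
      (∈-upTo⁺ {n = m ⊓ suc (x + sum μ)} (⊓-glb x≤m (s≤s (m≤m+n x (sum μ))))))

head≤sum : ∀ γ → head0 γ ≤ sum γ
head≤sum [] = z≤n
head≤sum (x ∷ γ) = m≤m+n x (sum γ)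

∈-partitions : ∀ {k μ} → Par k μ → μ ∈ partitions k
∈-partitions {k} {μ} (p , e) = ∈-parts k k (toPartition p) e ≤-refl (subst (head0 μ ≤_) e (head≤sum μ))

-- `xs` lists the rows still to be put on top, lowest first. Cutting a branch at defect 10 loses
-- nothing, since rows on top cannot lower the defect.
explore-sound : ∀ xs {f γ} → T (explore f γ (rowDefect γ)) → Partition (xs ʳ++ γ) → length xs ≤ f →
  head0 (xs ʳ++ γ) ≤ 9 → rowDefect (xs ʳ++ γ) ≤ 9 → T (leaf (xs ʳ++ γ) (rowDefect (xs ʳ++ γ)))
explore-sound [] {zero} {γ} t p l h d = resolve (10 ≤ᵇ rowDefect γ) t (λ q → <⇒≱ (≤ᵇ⇒≤ 10 (rowDefect γ) q) d)
explore-sound [] {suc f} {γ} t p l h d =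
  proj₁ (split (leaf γ (rowDefect γ)) (resolve (10 ≤ᵇ rowDefect γ) t (λ q → <⇒≱ (≤ᵇ⇒≤ 10 (rowDefect γ) q) d)))
explore-sound (x ∷ xs) {suc f} {γ} t p (s≤s l) h d = explore-sound xs
  (all-∈ (λ x → explore f (x ∷ γ) ((x ∸ rowScore x γ) + rowDefect γ))
    (proj₂ (split (leaf γ (rowDefect γ)) (resolve (10 ≤ᵇ rowDefect γ) t
      (λ q → <⇒≱ (≤ᵇ⇒≤ 10 (rowDefect γ) q) (≤-trans (m≤n+m (rowDefect γ) (x ∸ rowScore x γ)) (≤-trans rowDefect≤ d))))))
    (row-in pt head≤))
  p l h d
  where
  suffix : ∀ xs {γ} → Partition (xs ʳ++ γ) → Partition γ × head0 γ ≤ head0 (xs ʳ++ γ) × rowDefect γ ≤ rowDefect (xs ʳ++ γ)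
  suffix [] p = p , ≤-refl , ≤-refl
  suffix (x ∷ xs) {γ} p with suffix xs {x ∷ γ} p
  ... | cons _ h q , a , b = q , ≤-trans h a , ≤-trans (m≤n+m (rowDefect γ) _) b
  pt = proj₁ (suffix xs {x ∷ γ} p)
  head≤ = ≤-trans (proj₁ (proj₂ (suffix xs {x ∷ γ} p))) h
  rowDefect≤ = proj₂ (proj₂ (suffix xs {x ∷ γ} p))
  row-in : Partition (x ∷ γ) → x ≤ 9 → x ∈ between (1 ⊔ head0 γ) 10
  row-in (cons a b _) c = ∈-between (⊔-lub a b) (s≤s c)

is-just-sound : ∀ {m : Maybe (List ℕ)} → T (is-just m) → ∃ λ μ → m ≡ just μ
is-just-sound {just μ} _ = μ , refl

init-small : ∀ {γ} → Partition γ → isInit γ ≡ true → ∀ {d} → rowDefect γ ≤ d → length γ ≤ suc d × head0 γ ≤ d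
init-small [] _ _ = z≤n , z≤n
init-small {x ∷ δ} p i d = s≤s (≤-trans (length≤rowDefect p x≤) d) , ≤-trans x≤ (≤-trans (length≤rowDefect p x≤) d)
  where
  x≤ : x ≤ length δ
  x≤ = ≤ᵇ⇒≤ x (length δ) (holds i)

explore-complete : ∀ {f} → explore f [] (rowDefect []) ≡ true → 10 ≤ f →
  ∀ {γ} → Partition γ → isInit γ ≡ true → rowDefect γ ≤ 9 → ∃ λ μ → owner (rowDefect γ) γ ≡ just μ
explore-complete {f} e 10≤f {γ} p i d =
  is-just-sound (resolve (not (isInit γ)) found (λ q → subst (T ∘ not) i q))
  where
  back : reverse γ ʳ++ [] ≡ γ
  back = reverse-involutive γ
  small = init-small p i d
  found : T (leaf γ (rowDefect γ))
  found = subst (λ δ → T (leaf δ (rowDefect δ))) back (explore-sound (reverse γ) {f} {[]} (holds e)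
    (subst Partition (sym back) p) (≤-trans (≤-reflexive (length-reverse γ)) (≤-trans (proj₁ small) 10≤f))
    (subst (λ δ → head0 δ ≤ 9) (sym back) (proj₂ small)) (subst (λ δ → rowDefect δ ≤ 9) (sym back) d))

init-owned : ∀ {γ} → Partition γ → isInit γ ≡ true → rowDefect γ ≤ 9 → ∃ λ μ → owner (rowDefect γ) γ ≡ just μ
init-owned = explore-complete {10} explored ≤-refl

all-below : ∀ {n} (p : ℕ → Bool) → all p (upTo n) ≡ true → ∀ {k} → k < n → T (p k)
all-below p e k<n = all-∈ p (holds e) (∈-upTo⁺ k<n)

owner-entry : ∀ es {r μ} → ownerIn es r ≡ just μ → ∃ λ ν → ∃ λ rs → (μ , ν , rs) ∈ es × r ∈ rs
owner-entry ((μ , ν , rs) ∷ es) {r} e with r ∈ᵇ rs in eq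
owner-entry ((μ , ν , rs) ∷ es) {r} refl | true = ν , rs , here refl , ∈ᵇ-sound r rs (holds eq)
owner-entry ((μ , ν , rs) ∷ es) {r} e | false with owner-entry es e
... | ν′ , rs′ , a , b = ν′ , rs′ , there a , b

owner-sound : ∀ {k r μ} → k ≤ 9 → owner k r ≡ just μ → Par k μ × r ∈ rootsOf k μ
owner-sound {k} {r} {μ} k≤ e with owner-entry (table k) e
... | ν , rs , a , b with split (isPar k μ)
  (all-∈ (entryOK k) (all-below {10} (λ k → all (entryOK k) (table k)) entries-checked (s≤s k≤)) a)
... | t , u = isPar-sound k μ t , ∈ᵇ-sound r (rootsOf k μ) (all-∈ (_∈ᵇ rootsOf k μ) u b)

if-< : ∀ {A : Set} {i d} {x y : A} → i < d → (if i <ᵇ d then x else y) ≡ x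
if-< p rewrite <ᵇ-true p = refl

if-≮ : ∀ {A : Set} {i d} {x y : A} → d ≤ i → (if i <ᵇ d then x else y) ≡ y
if-≮ p rewrite <ᵇ-false p = refl

not-just : ∀ {m : Maybe (List ℕ)} {x} → T (not (is-just m)) → m ≡ just x → ⊥
not-just t refl = t

record Link (d d′ : ℕ) (r : List ℕ) : Set where
  field
    d<d′ : d < d′
    long : ∃ λ ε → nuIter (pred (d′ ∸ d)) r ≡ just ε
    short : ∀ m {γ} → nuIter m r ≡ just γ → d + m < d′

data IsChain : Chain → Set where
  end  : ∀ {d r} → IsChain ((d , r) ∷ [])
  _∷_ : ∀ {d r d′ r′ c} → Link d d′ r → IsChain ((d′ , r′) ∷ c) → IsChain ((d , r) ∷ (d′ , r′) ∷ c)

chainOK-link : ∀ d r d′ r′ c → T (chainOK ((d , r) ∷ (d′ , r′) ∷ c)) → Link d d′ r × T (chainOK ((d′ , r′) ∷ c))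
chainOK-link d r d′ r′ c t with split (d <ᵇ d′) t
... | a , t₁ with split (is-just (nuIter (pred (d′ ∸ d)) r)) t₁
... | b , t₂ with split (not (is-just (nuIter (d′ ∸ d) r))) t₂
... | n , t₃ = record { d<d′ = <ᵇ⇒< d d′ a ; long = is-just-sound b ; short = short } , t₃
  where
  short : ∀ m {γ} → nuIter m r ≡ just γ → d + m < d′
  short m e with d + m <? d′
  ... | yes p = p
  ... | no p = ⊥-elim (not-just n (proj₂ (nuIter-prefix (m ∸ (d′ ∸ d)) (d′ ∸ d)
                 (trans (cong (λ l → nuIter l r) (m∸n+n≡m (m≤n+o⇒m∸n≤o d′ d (≮⇒≥ p)))) e))))

chainOK-sound : ∀ c → T (chainOK c) → IsChain c
chainOK-sound (_ ∷ []) _ = end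
chainOK-sound ((d , r) ∷ c@((d′ , r′) ∷ c′)) t =
  proj₁ (chainOK-link d r d′ r′ c′ t) ∷ chainOK-sound c (proj₂ (chainOK-link d r d′ r′ c′ t))

-- An iterate that exists stays below the dinv at which the next orbit begins, so the case
-- distinction in `elem` selects the orbit of `r`.
chain-elem : ∀ {c d r m γ} → IsChain c → (d , r) ∈ c → nuIter m r ≡ just γ →
  start c ≤ d + m × elem c (d + m) ≡ γ
chain-elem {d = d} {r} {m} end (here refl) e =
  m≤m+n d m , trans (cong (λ l → ν^ l r) (m+n∸m≡n d m)) (sym (nuIter-ν^ m e))
chain-elem {d = d} {r} {m} (_∷_ {d′ = d′} l _) (here refl) e =
  m≤m+n d m , trans (if-< {i = d + m} {d′} (Link.short l m e))
    (trans (cong (λ l → ν^ l r) (m+n∸m≡n d m)) (sym (nuIter-ν^ m e)))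
chain-elem (l ∷ ch) (there x∈) e with chain-elem ch x∈ e
... | p , q = ≤-trans (<⇒≤ (Link.d<d′ l)) p , trans (if-≮ p) q

elem-reached : ∀ {c} → IsChain c → (∀ m → nuIter m (proj₂ (lastOf c)) ≡ just (ν^ m (proj₂ (lastOf c)))) →
  ∀ {i} → start c ≤ i → ∃ λ d → ∃ λ r → ∃ λ m → (d , r) ∈ c × d + m ≡ i × nuIter m r ≡ just (elem c i)
elem-reached (end {d} {r}) tl {i} p = d , r , i ∸ d , here refl , m+[n∸m]≡n p , tl (i ∸ d)
elem-reached (_∷_ {d} {r} {d′} l ch) tl {i} p with i <? d′
... | yes q = d , r , i ∸ d , here refl , m+[n∸m]≡n p ,
  trans (proj₂ at) (cong just (trans (nuIter-ν^ (i ∸ d) (proj₂ at)) (sym (if-< q))))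
  where
  i∸d≤ : i ∸ d ≤ pred (d′ ∸ d)
  i∸d≤ = pred-mono-≤ (∸-monoˡ-< q p)
  at : ∃ λ ε → nuIter (i ∸ d) r ≡ just ε
  at = nuIter-prefix (pred (d′ ∸ d) ∸ (i ∸ d)) (i ∸ d)
    (trans (cong (λ l → nuIter l r) (m∸n+n≡m i∸d≤)) (proj₂ (Link.long l)))
... | no q with elem-reached ch tl (≮⇒≥ q)
... | d₁ , r₁ , m , x∈ , e , f = d₁ , r₁ , m , there x∈ , e , trans f (cong just (sym (if-≮ (≮⇒≥ q))))

start≤last : ∀ {c} → IsChain c → start c ≤ proj₁ (lastOf c)
start≤last end = ≤-refl
start≤last (l ∷ ch) = ≤-trans (<⇒≤ (Link.d<d′ l)) (start≤last ch)

elem-tail : ∀ {c} → IsChain c → ∀ {i} → proj₁ (lastOf c) ≤ i → elem c i ≡ ν^ (i ∸ proj₁ (lastOf c)) (proj₂ (lastOf c))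
elem-tail end p = refl
elem-tail (l ∷ ch) p = trans (if-≮ (≤-trans (start≤last ch) p)) (elem-tail ch p)

last-∈ : ∀ {c} → IsChain c → lastOf c ∈ c
last-∈ end = here refl
last-∈ (l ∷ ch) = there (last-∈ ch)

nthLe-sound : ∀ f len j {n} → T (nthLe (applyUpTo f len) j n) → f j ≤ n
nthLe-sound f (suc len) zero t = ≤ᵇ⇒≤ _ _ t
nthLe-sound f (suc len) (suc j) t = nthLe-sound (f ∘ suc) len j t

rising-sound : ∀ ss d → T (rising ss d) → ∀ j → then-tail ss d j < then-tail ss d (suc j)
rising-sound [] d t j = +-monoʳ-< d (n<1+n j)
rising-sound (x ∷ []) d t zero = subst (x <_) (sym (+-identityʳ d)) (<ᵇ⇒< x d t)
rising-sound (x ∷ []) d t (suc j) = +-monoʳ-< d (n<1+n j)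
rising-sound (x ∷ xs@(y ∷ _)) d t zero = <ᵇ⇒< x y (proj₁ (split (x <ᵇ y) t))
rising-sound (x ∷ xs@(y ∷ _)) d t (suc j) = rising-sound xs d (proj₂ (split (x <ᵇ y) t)) j

then-tail-≥ : ∀ ss {d b} → T (all (b ≤ᵇ_) ss) → b ≤ d → ∀ j → b ≤ then-tail ss d j
then-tail-≥ [] t p j = ≤-trans p (m≤m+n _ j)
then-tail-≥ (x ∷ ss) {d} {b} t p zero = ≤ᵇ⇒≤ b x (proj₁ (split (b ≤ᵇ x) t))
then-tail-≥ (x ∷ ss) {d} {b} t p (suc j) = then-tail-≥ ss (proj₂ (split (b ≤ᵇ x) t)) p j

then-tail-end : ∀ ss d j → then-tail ss d (length ss + j) ≡ d + j
then-tail-end [] d j = refl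
then-tail-end (x ∷ ss) d j = then-tail-end ss d j

then-tail-any : ∀ {P : ℕ → Set} ss d → Any P ss → ∃ λ j → P (then-tail ss d j)
then-tail-any (x ∷ ss) d (here p) = 0 , p
then-tail-any (x ∷ ss) d (there q) with then-tail-any ss d q
... | j , p = suc j , p

nondecreasing-sound : ∀ u n → T (nondecreasing (applyUpTo u (suc n))) → ∀ a → a < n → u a ≤ u (suc a)
nondecreasing-sound u (suc n) t zero p = ≤ᵇ⇒≤ _ _ (proj₁ (split (u 0 ≤ᵇ u 1) t))
nondecreasing-sound u (suc n) t (suc a) (s≤s p) = nondecreasing-sound (u ∘ suc) n (proj₂ (split (u 0 ≤ᵇ u 1) t)) a p

valley-sound : ∀ u n → T (valley (applyUpTo u (suc n))) → ∃ λ t →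
  (∀ a → a < t → u (suc a) ≤ u a) × (∀ a → t ≤ a → a < n → u a ≤ u (suc a))
valley-sound u zero t = 0 , (λ _ ()) , (λ _ _ ())
valley-sound u (suc n) t with u 1 ≤ᵇ u 0 in eq
... | false = 0 , (λ _ ()) , (λ a _ p → nondecreasing-sound u (suc n) t a p)
... | true with valley-sound (u ∘ suc) n t
... | s , down , up = suc s ,
  (λ { zero _ → ≤ᵇ⇒≤ _ _ (holds eq) ; (suc a) (s≤s p) → down a p }) ,
  (λ { (suc a) (s≤s p) (s≤s q) → up a p q })

stepwise-down : ∀ (u : ℕ → ℕ) t → (∀ a → a < t → u (suc a) ≤ u a) → ∀ a b → a ≤ b → b ≤ t → u b ≤ u a
stepwise-down u t h a zero z≤n _ = ≤-refl
stepwise-down u t h a (suc b) p q with m≤n⇒m<n∨m≡n p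
... | inj₁ (s≤s a≤b) = ≤-trans (h b q) (stepwise-down u t h a b a≤b (<⇒≤ q))
... | inj₂ refl = ≤-refl

stepwise-up : ∀ (u : ℕ → ℕ) t → (∀ a → t ≤ a → u a ≤ u (suc a)) → ∀ a b → t ≤ a → a ≤ b → u a ≤ u b
stepwise-up u t h a zero _ z≤n = ≤-refl
stepwise-up u t h a (suc b) q p with m≤n⇒m<n∨m≡n p
... | inj₁ (s≤s a≤b) = ≤-trans (stepwise-up u t h a b q a≤b) (h b (≤-trans q a≤b))
... | inj₂ refl = ≤-refl

-- Membership in 𝒞 μ and conditions (1)–(9)

chain : ℕ → List ℕ → Chain
chain k μ = withDinv (rootsOf k μ)

record Facts (k : ℕ) (μ : List ℕ) : Set where
  μ* = star k μ
  c = chain k μ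
  c* = chain k μ*
  d = proj₁ (lastOf c)
  t = proj₂ (lastOf c)
  N = N₀ μ μ*
  field
    par*   : Par k μ*
    invol  : star k μ* ≡ μ
    roots  : ∀ {r} → r ∈ rootsOf k μ → Partition r × rowDefect r ≡ k × isInit r ≡ true × owner k r ≡ just μ
    isCh   : IsChain c
    begins : start c ≡ length μ*
    t≡γμ   : t ≡ γmu μ
    stair  : Stair t
    len    : length t ≡ ζ μ
    size   : d + k + length μ ≡ tri (suc (ζ μ))
    early  : ∀ {i} → start c ≤ i → i < d → Δ′ (elem c i) ≤ N
    small  : ∀ {i n} → start c ≤ i → i ≤ tri (pred N) → n < N → Δ′ (elem c i) ≤ n →
             i + k ≤ tri n × length μ ≤ tri n ∸ (i + k) × Δ′ (elem c* (tri n ∸ (i + k))) ≤ n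
    ss     : List ℕ
    ssOK   : T (startsOK c d ss)

T⇒≡ : ∀ {b} → T b → b ≡ true
T⇒≡ {true} _ = refl

rootOK-sound : ∀ {k μ r} → T (rootOK k μ r) → Partition r × rowDefect r ≡ k × isInit r ≡ true × owner k r ≡ just μ
rootOK-sound {k} {μ} {r} t₀ =
  let a , t₁ = split (isPartition r) t₀
      b , t₂ = split (rowDefect r ≡ᵇ k) t₁
      c , t₃ = split (isInit r) t₂
  in isPartition-sound r a , ≡ᵇ⇒≡ (rowDefect r) k b , T⇒≡ c , isOwner-sound t₃

symOK-sound : ∀ {k ℓ N c c*} → T (symOK k ℓ N c (profile c* N)) → ∀ {i n} → start c ≤ i → i ≤ tri (pred N) →
  n < N → Δ′ (elem c i) ≤ n → i + k ≤ tri n × ℓ ≤ tri n ∸ (i + k) × Δ′ (elem c* (tri n ∸ (i + k))) ≤ n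
symOK-sound {k} {ℓ} {N} {c} {c*} t₀ {i} {n} lo hi n<N δ≤n =
  let f* = profile c* N
      t₁ = all-∈ (symAt k ℓ f* i (Δ′ (elem c i)))
             (all-∈ (λ i → all (symAt k ℓ f* i (Δ′ (elem c i))) (upTo N)) t₀ (∈-between lo (s≤s hi))) (∈-upTo⁺ n<N)
      a , t₂ = split (i + k ≤ᵇ tri n) (resolve (n <ᵇ Δ′ (elem c i)) t₁ (λ q → <⇒≱ (<ᵇ⇒< n _ q) δ≤n))
      b , t₃ = split (ℓ ≤ᵇ tri n ∸ (i + k)) t₂
  in ≤ᵇ⇒≤ _ _ a , ≤ᵇ⇒≤ _ _ b , nthLe-sound (λ i → Δ′ (elem c* i)) (suc (tri (pred N))) _ t₃

facts : ∀ {k μ} → T (check k μ) → Facts k μ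
facts {k} {μ} t₀ =
  let μ* = star k μ
      c = chain k μ
      c* = chain k μ*
      N = N₀ μ μ*
      d , t = lastOf c
      a₁ , t₁ = split (isPar k μ*) t₀
      a₂ , t₂ = split (star k μ* ≟ᵇ μ) t₁
      a₃ , t₃ = split (all (rootOK k μ) (rootsOf k μ)) t₂
      a₄ , t₄ = split (chainOK c) t₃
      a₅ , t₅ = split (start c ≡ᵇ length μ*) t₄
      a₆ , t₆ = split (tailOK k μ (lastOf c)) t₅
      b₁ , u₁ = split (t ≟ᵇ γmu μ) a₆
      b₂ , u₂ = split (isStair t) u₁
      b₃ , b₄ = split (length t ≡ᵇ ζ μ) u₂
      a₇ , t₇ = split (all (λ i → Δ′ (elem c i) ≤ᵇ N) (between (start c) d)) t₆
      a₈ , a₉ = split (symOK k (length μ) N c (profile c* N)) t₇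
  in record
    { par* = isPar-sound k μ* a₁
    ; invol = ≟ᵇ-sound (star k μ*) μ a₂
    ; roots = λ r∈ → rootOK-sound (all-∈ (rootOK k μ) a₃ r∈)
    ; isCh = chainOK-sound c a₄
    ; begins = ≡ᵇ⇒≡ (start c) (length μ*) a₅
    ; t≡γμ = ≟ᵇ-sound t (γmu μ) b₁
    ; stair = isStair-sound t b₂
    ; len = ≡ᵇ⇒≡ (length t) (ζ μ) b₃
    ; size = ≡ᵇ⇒≡ (d + k + length μ) (tri (suc (ζ μ))) b₄
    ; early = λ lo hi → ≤ᵇ⇒≤ _ _ (all-∈ (λ i → Δ′ (elem c i) ≤ᵇ N) a₇ (∈-between lo hi))
    ; small = symOK-sound {c = c} {c*} a₈
    ; ss = starts c 0 (between (start c) d)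
    ; ssOK = a₉
    }

Par-facts : ∀ {k μ} → k ≤ 9 → Par k μ → Facts k μ
Par-facts {k} {μ} k≤ p = facts (all-∈ (check k) {xs = partitions k}
  (all-below {10} (λ k → all (check k) (partitions k)) chains-checked (s≤s k≤)) (∈-partitions p))

-- Membership through the owner of the root makes disjointness and closure under ν immediate; the
-- enumeration by `elem` is derived afterwards.
𝒞 : ℕ → List ℕ → List ℕ → Set
𝒞 k μ γ = DPstar k γ × owner k (root γ) ≡ just μ

-- The second family is the first one relabelled by the involution `star`, which yields the
-- symmetric pairing in (4).
𝒞̄ : ℕ → List ℕ → List ℕ → Set
𝒞̄ k μ = 𝒞 k (star k μ)

mk𝒞 : ∀ {k μ γ} → Partition γ → rowDefect γ ≡ k → owner k (root γ) ≡ just μ → 𝒞 k μ γ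
mk𝒞 p e o = (fromPartition p , trans (defect≡rowDefect p) e) , o

𝒞-Partition : ∀ {k μ γ} → 𝒞 k μ γ → Partition γ
𝒞-Partition ((p , _) , _) = toPartition p

𝒞-rowDefect : ∀ {k μ γ} → 𝒞 k μ γ → rowDefect γ ≡ k
𝒞-rowDefect m@((_ , e) , _) = trans (sym (defect≡rowDefect (𝒞-Partition m))) e

𝒞-sum : ∀ {k μ γ} → 𝒞 k μ γ → sum γ ≡ dinv γ + k
𝒞-sum {γ = γ} m = trans (sum≡rowDinv+rowDefect γ) (cong₂ _+_ (sym (dinv≡rowDinv (𝒞-Partition m))) (𝒞-rowDefect m))

𝒞-iter : ∀ {k μ γ δ} m → 𝒞 k μ γ → nuIter m γ ≡ just δ → 𝒞 k μ δ × dinv δ ≡ m + dinv γ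
𝒞-iter {k} m x e = mk𝒞 pt (trans ddδ (𝒞-rowDefect x)) (trans (cong (owner k) rt) (proj₂ x)) ,
  trans (dinv≡rowDinv pt) (trans dvδ (cong (m +_) (sym (dinv≡rowDinv (𝒞-Partition x)))))
  where open Orbit (orbit m (𝒞-Partition x) e)

-- A single chain: enumeration by dinv, and conditions (5) and (6)

module OneChain {k μ} (k≤ : k ≤ 9) (F : Facts k μ) where
  open Facts F

  ∈c⇒ : ∀ {d r} → (d , r) ∈ c → d ≡ rowDinv r × r ∈ rootsOf k μ
  ∈c⇒ x∈ with ∈-map⁻ (λ r → rowDinv r , r) x∈
  ... | r , r∈ , refl = refl , r∈

  Partition-t : Partition t
  Partition-t = proj₁ (roots (proj₂ (∈c⇒ (last-∈ isCh))))

  member⇒ : ∀ {γ} → 𝒞 k μ γ → start c ≤ dinv γ × elem c (dinv γ) ≡ γ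
  member⇒ {γ} x = subst (λ i → start c ≤ i × elem c i ≡ γ) eq
    (chain-elem isCh (∈-map⁺ (λ r → rowDinv r , r) (proj₂ (owner-sound k≤ (proj₂ x)))) reach)
    where
    open RootOf (root-spec (𝒞-Partition x))
    eq : rowDinv (root γ) + steps ≡ dinv γ
    eq = trans (+-comm (rowDinv (root γ)) steps) (sym (trans (dinv≡rowDinv (𝒞-Partition x)) (Orbit.dvδ (orbit steps pt reach))))

  member⇐ : ∀ {i} → start c ≤ i → 𝒞 k μ (elem c i) × dinv (elem c i) ≡ i
  member⇐ p with elem-reached isCh (tail-defined stair Partition-t) p
  ... | d , r , m , x∈ , e , reach with ∈c⇒ x∈
  ... | refl , r∈ with roots r∈
  ... | pr , ddr , ir , or =
    let mem , dm = 𝒞-iter m (mk𝒞 pr ddr (trans (cong (owner k) (root-init pr ir)) or)) reach in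
    mem , trans dm (trans (cong (m +_) (dinv≡rowDinv pr)) (trans (+-comm m (rowDinv r)) e))

  unique : ∀ {γ i} → 𝒞 k μ γ → dinv γ ≡ i → γ ≡ elem c i
  unique x refl = sym (proj₂ (member⇒ x))

  start≤d : start c ≤ d
  start≤d = start≤last isCh

  tail-elem : ∀ {i} → d ≤ i → nuIter (i ∸ d) t ≡ just (elem c i)
  tail-elem {i} p = trans (tail-defined stair Partition-t (i ∸ d)) (cong just (sym (elem-tail isCh p)))

  -- `size` converts the number i - d of steps from γ_μ, plus C(ζ+1,2), into i + k + ℓ(μ); the rest
  -- is `tail-Δ`.
  tail-level : ∀ {i n} → d ≤ i → suc (ζ μ) ≤ n →
    (Δ′ (elem c i) ≤ n → i + k + length μ ≤ tri n) × (i + k + length μ ≤ tri n → Δ′ (elem c i) ≤ n)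
  tail-level {i} {n} d≤i ζ<n = subst₂ (λ a b → (Δ′ (elem c i) ≤ a → b ≤ tri a) × (b ≤ tri a → Δ′ (elem c i) ≤ a))
    n≡ total (tail-Δ (n ∸ suc (length t)) (i ∸ d) stair Partition-t (tail-elem d≤i))
    where
    n≡ : n ∸ suc (length t) + suc (length t) ≡ n
    n≡ = m∸n+n≡m (subst (λ l → suc l ≤ n) (sym len) ζ<n)
    total : (i ∸ d) + tri (suc (length t)) ≡ i + k + length μ
    total = begin
      (i ∸ d) + tri (suc (length t)) ≡⟨ cong (λ l → (i ∸ d) + tri (suc l)) len ⟩
      (i ∸ d) + tri (suc (ζ μ)) ≡⟨ cong ((i ∸ d) +_) size ⟨
      (i ∸ d) + (d + k + length μ) ≡⟨ re (i ∸ d) d k (length μ) ⟩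
      ((i ∸ d) + d) + k + length μ ≡⟨ cong (λ x → x + k + length μ) (m∸n+n≡m d≤i) ⟩
      i + k + length μ ∎
      where
      open ≡-Reasoning
      re : ∀ a b c e → a + (b + c + e) ≡ (a + b) + c + e
      re = solve-∀

  ζ<pred-N : suc (ζ μ) ≤ pred N
  ζ<pred-N = pred-mono-≤ (≤-trans (≤-reflexive (+-comm 2 (ζ μ))) (m≤m⊔n (ζ μ + 2) (ζ μ* + 2)))

  ζ<N : suc (ζ μ) ≤ N
  ζ<N = ≤-trans ζ<pred-N (pred[n]≤n {N})

  before-tail : ∀ {i n} → i < d → suc (ζ μ) ≤ n → i + k + length μ ≤ tri n
  before-tail i<d ζ<n = ≤-trans (+-monoˡ-≤ (length μ) (+-monoˡ-≤ k (<⇒≤ i<d)))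
    (≤-trans (≤-reflexive size) (tri-mono ζ<n))

  -- Before the tail the conclusion is automatic, because i < d and d + k + ℓ(μ) = C(ζ+1,2) ≤
  -- C(n,2).
  level⇒ : ∀ {i n} → suc (ζ μ) ≤ n → Δ′ (elem c i) ≤ n → i + k + length μ ≤ tri n
  level⇒ {i} ζ<n δ with i <? d
  ... | yes i<d = before-tail i<d ζ<n
  ... | no i≮d = proj₁ (tail-level (≮⇒≥ i≮d) ζ<n) δ

  -- Before the tail, Δ ≤ N is one of the finite checks; this is why the converse starts only at
  -- `N`.
  level⇐ : ∀ {i n} → N ≤ n → start c ≤ i → i + k + length μ ≤ tri n → Δ′ (elem c i) ≤ n
  level⇐ {i} N≤n lo le with i <? d
  ... | yes i<d = ≤-trans (early lo i<d) N≤n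
  ... | no i≮d = proj₂ (tail-level (≮⇒≥ i≮d) (≤-trans ζ<N N≤n)) le

  s : ℕ → ℕ
  s = then-tail ss d

  u : ℕ → ℕ
  u j = Δ′ (elem c (s j))

  private
    ss₁ = split (rising ss d) ssOK
    ss₂ = split (all (start c ≤ᵇ_) ss) (proj₂ ss₁)
    ss₃ = split (all (covered c ss) (between (start c) d)) (proj₂ ss₂)

  s-≥ : ∀ j → start c ≤ s j
  s-≥ = then-tail-≥ ss (proj₁ ss₂) start≤d

  u-tail : ∀ a → length ss ≤ a → u a ≤ u (suc a)
  u-tail a p = subst₂ (λ x y → Δ′ (elem c x) ≤ Δ′ (elem c y)) (sym at) (sym at′)
    (Orbit.mon (orbit 1 (Orbit.pt (orbit j Partition-t here′)) next))
    where
    j = a ∸ length ss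
    at : s a ≡ d + j
    at = trans (cong s (sym (m+[n∸m]≡n p))) (then-tail-end ss d j)
    at′ : s (suc a) ≡ d + suc j
    at′ = trans (cong (s ∘ suc) (sym (m+[n∸m]≡n p))) (trans (cong s (sym (+-suc (length ss) j))) (then-tail-end ss d (suc j)))
    here′ : nuIter j t ≡ just (elem c (d + j))
    here′ = trans (cong (λ l → nuIter l t) (sym (m+n∸m≡n d j))) (tail-elem (m≤m+n d j))
    next : nuIter 1 (elem c (d + j)) ≡ just (elem c (d + suc j))
    next = trans (sym (nuIter-+ 1 j here′)) (trans (cong (λ l → nuIter l t) (sym (m+n∸m≡n d (suc j)))) (tail-elem (m≤m+n d (suc j))))

  covers : ∀ {γ} → 𝒞 k μ γ → ∃ λ j → InR (elem c (s j)) γ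
  covers {γ} x with member⇒ x
  ... | lo , e with dinv γ <? d
  ... | no i≮d = length ss + (dinv γ ∸ d) , 0 , z≤n ,
    cong just (trans (cong (elem c) (trans (then-tail-end ss d _) (m+[n∸m]≡n (≮⇒≥ i≮d)))) e)
  ... | yes i<d with then-tail-any ss d (any⁻ _ ss (all-∈ (covered c ss) (proj₁ ss₃) (∈-between lo i<d)))
  ... | j , t₀ with split (s j ≤ᵇ dinv γ) t₀
  ... | a , t₁ with split (dinv γ ∸ s j ≤ᵇ ρ (elem c (s j))) t₁
  ... | b , t₂ with is-just-sound t₂
  ... | ε , reach = j , dinv γ ∸ s j , ≤ᵇ⇒≤ _ _ b , trans reach (cong just (trans (unique mem level) e))
    where
    mem = proj₁ (𝒞-iter (dinv γ ∸ s j) (proj₁ (member⇐ (s-≥ j))) reach)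
    level : dinv ε ≡ dinv γ
    level = trans (proj₂ (𝒞-iter (dinv γ ∸ s j) (proj₁ (member⇐ (s-≥ j))) reach))
      (trans (cong (dinv γ ∸ s j +_) (proj₂ (member⇐ (s-≥ j)))) (m∸n+n≡m (≤ᵇ⇒≤ (s j) (dinv γ) a)))

  cond5 : Cond5 k (𝒞 k) (𝒞̄ k) μ μ*
  cond5 = elem c ,
    (λ i p → let m , e = member⇐ (≤-trans (≤-reflexive begins) p) in m , e , λ γ x q → unique x q) ,
    s , rising-sound ss d (proj₁ ss₁) , (λ j → ≤-trans (≤-reflexive (sym begins)) (s-≥ j)) ,
    (λ γ → mk⇔ covers (λ { (j , m , _ , reach) → proj₁ (𝒞-iter m (proj₁ (member⇐ (s-≥ j))) reach) })) ,
    proj₁ v ,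
    (λ a b a≤b b≤t → subst₂ _≤_ (sym (Δ≡Δ′ _)) (sym (Δ≡Δ′ _)) (stepwise-down u (proj₁ v) (proj₁ (proj₂ v)) a b a≤b b≤t)) ,
    (λ a b t≤a a≤b → subst₂ _≤_ (sym (Δ≡Δ′ _)) (sym (Δ≡Δ′ _)) (stepwise-up u (proj₁ v) up a b t≤a a≤b))
    where
    v = valley-sound u (length ss) (proj₂ ss₃)
    up : ∀ a → proj₁ v ≤ a → u a ≤ u (suc a)
    up a t≤a with a <? length ss
    ... | yes p = proj₂ (proj₂ v) a t≤a p
    ... | no p = u-tail a (≮⇒≥ p)

  cond6 : Cond6 k (𝒞 k) (𝒞̄ k) μ μ*
  cond6 n N≤n i = mk⇔
    (λ { (lo , hi) → let lo′ = ≤-trans (≤-reflexive begins) lo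
                         m , e = member⇐ lo′ in
         elem c i , m , ≤-trans (≤-reflexive (Δ≡Δ′ (elem c i))) (level⇐ N≤n lo′ (subst (i + k + length μ ≤_) (C2≡tri n) hi)) , e })
    (λ { (γ , x , δ , refl) → let lo , e = member⇒ x in
         ≤-trans (≤-reflexive (sym begins)) lo ,
         subst (dinv γ + k + length μ ≤_) (sym (C2≡tri n))
           (level⇒ (≤-trans ζ<N N≤n) (subst (λ ε → Δ′ ε ≤ n) (sym e) (subst (_≤ n) (Δ≡Δ′ γ) δ))) }) ,
    (λ γ γ′ x _ e x′ _ e′ → trans (unique x e) (sym (unique x′ e′)))

-- Reflection between a chain and its partner, and condition (9)

module TwoChains {k μ} (k≤ : k ≤ 9) (F : Facts k μ) where
  open Facts F
  open OneChain k≤ F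

  F* : Facts k μ*
  F* = Par-facts k≤ par*

  module P* = OneChain k≤ F*

  start* : start c* ≡ length μ
  start* = trans (Facts.begins F*) (cong length invol)

  -- Below N the claim is one of the finite checks; from N on both level sets are the intervals of condition (6).
  reflected : ∀ {γ n} → 𝒞 k μ γ → Δ′ γ ≤ n → let i = dinv γ in
    i + k ≤ tri n × start c* ≤ tri n ∸ (i + k) × Δ′ (elem c* (tri n ∸ (i + k))) ≤ n
  reflected {γ} {n} x δ with member⇒ x | n <? N
  ... | lo , e | yes n<N =
    let i = dinv γ
        δ′ = subst (λ ε → Δ′ ε ≤ n) (sym e) δ
        n≤ = pred-mono-≤ n<N
        le = level⇒ {i} ζ<pred-N (≤-trans δ′ n≤)
        a , b , f = small lo (≤-trans (≤-trans (m≤m+n i k) (m≤m+n (i + k) (length μ))) le) n<N δ′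
    in a , ≤-trans (≤-reflexive start*) b , f
  ... | lo , e | no n≮N =
    let i = dinv γ
        N≤n = ≮⇒≥ n≮N
        δ′ = subst (λ ε → Δ′ ε ≤ n) (sym e) δ
        le = level⇒ {i} (≤-trans ζ<N N≤n) δ′
        i+k≤ = ≤-trans (m≤m+n (i + k) (length μ)) le
        j = tri n ∸ (i + k)
        lo* = ≤-trans (≤-reflexive start*)
                (subst (_≤ j) (m+n∸m≡n (i + k) (length μ)) (∸-monoˡ-≤ (i + k) le))
        N*≤n = subst (_≤ n) (trans (⊔-comm (ζ μ + 2) (ζ μ* + 2)) (cong (λ x → (ζ μ* + 2) ⊔ (ζ x + 2)) (sym invol))) N≤n
        le* = ≤-trans (+-monoʳ-≤ (j + k) (≤-trans (≤-reflexive (sym begins)) lo))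
                (≤-reflexive (trans (re j k i) (m∸n+n≡m i+k≤)))
    in i+k≤ , lo* , P*.level⇐ N*≤n lo* le*
    where
    re : ∀ a b c → a + b + c ≡ a + (c + b)
    re = solve-∀

area≡ : ∀ {k μ γ} n → 𝒞 k μ γ → area n γ ≡ tri n ∸ (dinv γ + k)
area≡ n x = cong₂ _∸_ (C2≡tri n) (𝒞-sum x)

double-reflect : ∀ {T i k} → i + k ≤ T → T ∸ ((T ∸ (i + k)) + k) ≡ i
double-reflect {T} {i} {k} p = trans (cong (T ∸_) (trans (+-comm _ k) (sym eq))) (m∸[m∸n]≡n (≤-trans (m≤m+n i k) p))
  where
  eq : T ∸ i ≡ k + (T ∸ (i + k))
  eq = sym (trans (cong (k +_) (sym (∸-+-assoc T i k))) (m+[n∸m]≡n (m+n≤o⇒m≤o∸n k (subst (_≤ T) (+-comm i k) p))))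

-- The only candidate for g(γ) is the partner member whose dinv is area_n(γ). `reflected` places it
-- in DP_n, and applying the reflection twice gives back dinv γ.
cond9 : ∀ {k} → k ≤ 9 → Cond9 k (𝒞 k) (𝒞̄ k)
cond9 {k} k≤ μ p n = (λ γ _ → elem c* (area n γ)) , (maps , inj , surj , swaps) , unique-g
  where
  F = Par-facts k≤ p
  open Facts F
  open OneChain k≤ F
  module TC = TwoChains k≤ F
  module P* = OneChain k≤ TC.F*
  module TC* = TwoChains k≤ TC.F*
  B = λ γ → 𝒞 k μ γ × InDP n γ
  B̄ = λ γ → 𝒞̄ k μ γ × InDP n γ
  refl-at : ∀ {γ} → B γ → dinv γ + k ≤ tri n × start c* ≤ area n γ × Δ′ (elem c* (area n γ)) ≤ n
  refl-at {γ} (x , δ) = subst (λ j → dinv γ + k ≤ tri n × start c* ≤ j × Δ′ (elem c* j) ≤ n)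
    (sym (area≡ n x)) (TC.reflected x (inDP⇒ n γ δ))
  image : ∀ {γ} → B γ → 𝒞̄ k μ (elem c* (area n γ)) × dinv (elem c* (area n γ)) ≡ area n γ
  image b = P*.member⇐ (proj₁ (proj₂ (refl-at b)))
  maps : ∀ γ (b : B γ) → B̄ (elem c* (area n γ))
  maps γ b = proj₁ (image b) , inDP⇐ n _ (proj₂ (proj₂ (refl-at b)))
  swaps : ∀ γ (b : B γ) → area n γ ≡ dinv (elem c* (area n γ)) × dinv γ ≡ area n (elem c* (area n γ))
  swaps γ b@(x , _) = sym (proj₂ (image b)) , sym (begin
    area n (elem c* (area n γ)) ≡⟨ area≡ n (proj₁ (image b)) ⟩
    tri n ∸ (dinv (elem c* (area n γ)) + k) ≡⟨ cong (λ a → tri n ∸ (a + k)) (trans (proj₂ (image b)) (area≡ n x)) ⟩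
    tri n ∸ ((tri n ∸ (dinv γ + k)) + k) ≡⟨ double-reflect (proj₁ (refl-at b)) ⟩
    dinv γ ∎)
    where open ≡-Reasoning
  inj : ∀ γ δ (b : B γ) (b′ : B δ) → elem c* (area n γ) ≡ elem c* (area n δ) → γ ≡ δ
  inj γ δ b b′ e = trans (unique (proj₁ b) refl) (sym (unique (proj₁ b′)
    (trans (proj₂ (swaps δ b′)) (trans (cong (area n) (sym e)) (sym (proj₂ (swaps γ b)))))))
  surj : ∀ δ → B̄ δ → Σ (List ℕ) λ γ → Σ (B γ) λ b → elem c* (area n γ) ≡ δ
  surj δ (y , dp) = γ , b , trans (cong (elem c*) back) (proj₂ (P*.member⇒ y))
    where
    j = tri n ∸ (dinv δ + k)
    γ = elem c j
    -- A preimage comes from reflecting in the opposite direction; `invol` identifies the partner of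
    -- the partner with the original chain.
    r = TC*.reflected y (inDP⇒ n δ dp)
    r′ : start c ≤ j × Δ′ γ ≤ n
    r′ = subst (λ ν → start (chain k ν) ≤ j × Δ′ (elem (chain k ν) j) ≤ n) invol (proj₂ r)
    b : B γ
    b = proj₁ (member⇐ (proj₁ r′)) , inDP⇐ n γ (proj₂ r′)
    back : area n γ ≡ dinv δ
    back = trans (area≡ n (proj₁ b)) (trans (cong (λ a → tri n ∸ (a + k)) (proj₂ (member⇐ (proj₁ r′)))) (double-reflect (proj₁ r)))
  unique-g : ∀ g → IsOppositeBijection n B B̄ g → ∀ γ (b : B γ) → g γ b ≡ elem c* (area n γ)
  unique-g g (m , _ , _ , sw) γ b = P*.unique (proj₁ (m γ b)) (sym (proj₁ (sw γ b)))

-- The remaining conditions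

cond3 : ∀ {k} → k ≤ 9 → Cond3 k (𝒞 k) (𝒞̄ k)
cond3 {k} k≤ μ p m = ν^ m (γmu μ) , subst (λ r → nuIter m r ≡ just (ν^ m r)) t≡γμ (tail-defined stair Partition-t m) ,
  subst (λ r → 𝒞 k μ (ν^ m r)) t≡γμ (subst (𝒞 k μ) (trans (elem-tail isCh (m≤m+n d m)) (cong (λ l → ν^ l t) (m+n∸m≡n d m)))
    (proj₁ (member⇐ (≤-trans start≤d (m≤m+n d m)))))
  where
  open Facts (Par-facts k≤ p)
  open OneChain k≤ (Par-facts k≤ p)

cond1 : ∀ {k} → k ≤ 9 → Cond1 k (𝒞 k) (𝒞̄ k)
cond1 {k} k≤ =
  (λ μ μ′ _ _ ≢ γ x y → ≢ (just-injective (trans (sym (proj₂ x)) (proj₂ y)))) ,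
  (λ μ μ′ p p′ ≢ γ x y → ≢ (trans (sym (invol (Par-facts k≤ p)))
     (trans (cong (star k) (just-injective (trans (sym (proj₂ x)) (proj₂ y)))) (invol (Par-facts k≤ p′)))))
  where open Facts

cond2 : ∀ {k} → k ≤ 9 → Cond2 k (𝒞 k) (𝒞̄ k)
cond2 {k} k≤ = (λ γ → mk⇔ (owned γ) (λ (_ , _ , x) → proj₁ x)) , (λ γ → mk⇔ (owned* γ ∘ owned γ) (λ (_ , _ , x) → proj₁ x))
  where
  owned : ∀ γ → DPstar k γ → Σ (List ℕ) λ μ → Par k μ × 𝒞 k μ γ
  owned γ q@(p , e) = let μ , o = own in μ , proj₁ (owner-sound k≤ o) , q , o
    where
    open RootOf (root-spec (toPartition p))
    rowDefect≡k : rowDefect (root γ) ≡ k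
    rowDefect≡k = trans (sym (Orbit.ddδ (orbit steps pt reach))) (trans (sym (defect≡rowDefect (toPartition p))) e)
    own : ∃ λ μ → owner k (root γ) ≡ just μ
    own = subst (λ l → ∃ λ μ → owner l (root γ) ≡ just μ) rowDefect≡k
      (init-owned pt init (subst (_≤ 9) (sym rowDefect≡k) k≤))
  owned* : ∀ γ → (Σ (List ℕ) λ μ → Par k μ × 𝒞 k μ γ) → Σ (List ℕ) λ μ → Par k μ × 𝒞̄ k μ γ
  owned* γ (μ , p , x) = star k μ , Facts.par* F , subst (λ ν → 𝒞 k ν γ) (sym (Facts.invol F)) x
    where F = Par-facts k≤ p

cond456 : ∀ {k} → k ≤ 9 → Cond456 k (𝒞 k) (𝒞̄ k)
cond456 {k} k≤ μ p = μ* , par* , (same , λ γ → mk⇔ id id) , only , cond5 , cond6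
  where
  open Facts (Par-facts k≤ p)
  open OneChain k≤ (Par-facts k≤ p)
  same : SameSet (𝒞 k μ) (𝒞̄ k μ*)
  same γ = mk⇔ (subst (λ ν → 𝒞 k ν γ) (sym invol)) (subst (λ ν → 𝒞 k ν γ) invol)
  only : ∀ μ′ → Par k μ′ → SameSet (𝒞 k μ) (𝒞̄ k μ′) → SameSet (𝒞 k μ′) (𝒞̄ k μ) → μ′ ≡ μ*
  only μ′ p′ e _ = trans (sym (Facts.invol (Par-facts k≤ p′)))
    (cong (star k) (just-injective (trans (sym (proj₂ (Equivalence.to (e (elem c (start c))) x))) (proj₂ x))))
    where
    -- A chain is nonempty, and the owner of one member already determines `star k μ′`, hence μ′.
    x = proj₁ (member⇐ {start c} ≤-refl)

cond7 : ∀ {k} → Cond7 k (𝒞 k) (𝒞̄ k)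
cond7 μ _ γ x h = proj₁ (𝒞-iter 1 x (nuStep-defined {γ} h))

cond8 : ∀ {k} → k ≤ 9 → Cond8 k (𝒞 k) (𝒞̄ k)
cond8 {k} k≤ μ p n λ′ (pλ , refl) x with n <? 12
... | yes n<12 = mk𝒞 (isPartition-sound δ a) (≡ᵇ⇒≡ (rowDefect δ) k b) (isOwner-sound c)
  where
  γ = dp n (dyck λ′)
  δ = dp n (dyck (conj λ′))
  t₀ : T (conjOK λ′)
  t₀ = all-∈ conjOK (all-below {12} (λ n → all conjOK (partitions n)) conjugates-checked n<12) (∈-partitions (pλ , refl))
  t₁ : T (conjGo k γ δ)
  t₁ = subst (λ l → T (conjGo l γ δ)) (𝒞-rowDefect x) t₀
  t₂ : T (conjAt k (just μ) δ)
  t₂ = subst (λ m → T (conjAt k m δ)) (proj₂ x) (resolve (10 ≤ᵇ k) t₁ (λ q → <⇒≱ (≤ᵇ⇒≤ 10 k q) k≤))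
  a = proj₁ (split (isPartition δ) t₂)
  b = proj₁ (split (rowDefect δ ≡ᵇ k) (proj₂ (split (isPartition δ) t₂)))
  c = proj₂ (split (rowDefect δ ≡ᵇ k) (proj₂ (split (isPartition δ) t₂)))
... | no n≮12 with large-trivial (≮⇒≥ n≮12) (toPartition pλ) refl (subst (_≤ 9) (sym (𝒞-rowDefect x)) k≤)
-- Both partitions lie in the orbit of the empty partition. Its defect 0 forces k = 0, where the
-- empty partition is its own partner.
... | (m , e) , (m′ , e′) with trans (sym (𝒞-rowDefect x)) (Orbit.ddδ (orbit m [] e))
... | refl = mk𝒞 (Orbit.pt O′) (Orbit.ddδ O′) (trans (cong (owner 0) (Orbit.rt O′)) (cong (just ∘ star 0) μ≡))
  where
  O′ = orbit m′ [] e′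
  μ≡ : [] ≡ μ
  μ≡ = just-injective (trans (sym (cong (owner 0) (Orbit.rt (orbit m [] e)))) (proj₂ x))

theorem4p10 : (k : ℕ) → k ≤ 9 →
    Σ (List ℕ → List ℕ → Set) λ 𝒞 → Σ (List ℕ → List ℕ → Set) λ 𝒞̄ →
    Cond1 k 𝒞 𝒞̄ × Cond2 k 𝒞 𝒞̄ × Cond3 k 𝒞 𝒞̄ × Cond456 k 𝒞 𝒞̄ ×
    Cond7 k 𝒞 𝒞̄ × Cond8 k 𝒞 𝒞̄ × Cond9 k 𝒞 𝒞̄
theorem4p10 k k≤ = 𝒞 k , 𝒞̄ k ,
  cond1 k≤ , cond2 k≤ , cond3 k≤ , cond456 k≤ , cond7 , cond8 k≤ , cond9 k≤
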